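{- Let $a$ be a real number with $0\le a<1$ and let $p$ be a prime number. Then the set of real numbers $\alpha$ such that $$\liminf_{q\to+\infty}\, q\,(\log q)^{2-a}\,\|q\alpha\|\,|q|_p\,\bigl(\log(2/|q|_p)\bigr)^a>0$$ (where $q$ runs over positive integers) has Hausdorff dimension $1$.
   Context: For a real number $x$, $\|x\|$ denotes the distance from $x$ to the nearest integer. For a prime $p$, $|\cdot|_p$ is the $p$-adic absolute value normalized so that $|p|_p=p^{ -1}$. -}

module Defs where

open import Axiom.ExcludedMiddle using (ExcludedMiddle)
open import Data.Bool using (if_then_else_)
open import Data.Integer using (ℤ; +_)
open import Data.Nat as ℕ using (ℕ; zero; suc; NonZero; _!)
import Data.Nat.Combinatorics as ℕ
import Data.Nat.Properties as ℕ
open import Data.Nat.Divisibility using (_∣?_)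
open import Data.Nat.Primality using (Prime; prime⇒nonZero)
open import Data.Product using (Σ; ∃; ∃-syntax; _×_; _,_)
open import Data.Rational as ℚ using (ℚ; 0ℚ; 1ℚ; ½)
import Data.Rational.Properties as ℚ
open import Data.Rational.Solver using (module +-*-Solver)
open import Data.Unit using (⊤)
open import Data.Empty using (⊥)
open import Data.Sum using (_⊎_; inj₁; inj₂)
open import Level using (0ℓ)
open import Relation.Binary.PropositionalEquality
open import Relation.Nullary using (¬_; yes; no; does)
open import Relation.Unary using (Pred; _∈_)

open +-*-Solver using (solve; _:+_; _:*_; _:-_; :-_; _:=_; con)

-- Real numbers are Cauchy sequences of rationals, equal when _≈_.

Cauchy : (ℕ → ℚ) → Set
Cauchy u = ∀ ε → 0ℚ ℚ.< ε →
  ∃[ N ] ∀ m n → N ℕ.≤ m → N ℕ.≤ n → ℚ.∣ u m ℚ.- u n ∣ ℚ.< ε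

record ℝ : Set where
  constructor mkℝ
  field
    seq    : ℕ → ℚ
    cauchy : Cauchy seq

open ℝ public

private
  halves : ∀ ε → ½ ℚ.* ε ℚ.+ ½ ℚ.* ε ≡ ε
  halves = solve 1 (λ e → con ½ :* e :+ con ½ :* e := e) refl

  half-pos : ∀ ε → 0ℚ ℚ.< ε → 0ℚ ℚ.< ½ ℚ.* ε
  half-pos ε ε>0 = subst (ℚ._< ½ ℚ.* ε) (ℚ.*-zeroʳ ½) (ℚ.*-monoʳ-<-pos ½ ε>0)

  ⊔ˡ : ∀ {M N n} → M ℕ.⊔ N ℕ.≤ n → M ℕ.≤ n
  ⊔ˡ {M} {N} = ℕ.≤-trans (ℕ.m≤m⊔n M N)

  ⊔ʳ : ∀ {M N n} → M ℕ.⊔ N ℕ.≤ n → N ℕ.≤ n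
  ⊔ʳ {M} {N} = ℕ.≤-trans (ℕ.m≤n⊔m M N)

  const-cauchy : ∀ r → Cauchy (λ _ → r)
  const-cauchy r ε ε>0 = 0 , λ _ _ _ _ →
    subst (λ d → ℚ.∣ d ∣ ℚ.< ε) (sym (ℚ.+-inverseʳ r)) ε>0

  +-cauchy : ∀ u v → Cauchy u → Cauchy v → Cauchy (λ n → u n ℚ.+ v n)
  +-cauchy u v cu cv ε ε>0 =
    let M , hM = cu (½ ℚ.* ε) (half-pos ε ε>0)
        N , hN = cv (½ ℚ.* ε) (half-pos ε ε>0)
    in M ℕ.⊔ N , λ m n m≥ n≥ → begin-strict
      ℚ.∣ (u m ℚ.+ v m) ℚ.- (u n ℚ.+ v n) ∣
        ≡⟨ cong ℚ.∣_∣ (solve 4 (λ a b c d →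
             (a :+ b) :- (c :+ d) := (a :- c) :+ (b :- d)) refl
             (u m) (v m) (u n) (v n)) ⟩
      ℚ.∣ (u m ℚ.- u n) ℚ.+ (v m ℚ.- v n) ∣
        ≤⟨ ℚ.∣p+q∣≤∣p∣+∣q∣ (u m ℚ.- u n) (v m ℚ.- v n) ⟩
      ℚ.∣ u m ℚ.- u n ∣ ℚ.+ ℚ.∣ v m ℚ.- v n ∣
        <⟨ ℚ.+-mono-< (hM m n (⊔ˡ {M} {N} m≥) (⊔ˡ {M} {N} n≥))
                      (hN m n (⊔ʳ {M} {N} m≥) (⊔ʳ {M} {N} n≥)) ⟩
      ½ ℚ.* ε ℚ.+ ½ ℚ.* ε
        ≡⟨ halves ε ⟩
      ε ∎
    where open ℚ.≤-Reasoning

  neg-cauchy : ∀ u → Cauchy u → Cauchy (λ n → ℚ.- u n)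
  neg-cauchy u cu ε ε>0 =
    let N , hN = cu ε ε>0
    in N , λ m n m≥ n≥ → begin-strict
      ℚ.∣ ℚ.- u m ℚ.- (ℚ.- u n) ∣
        ≡⟨ cong ℚ.∣_∣ (solve 2 (λ a b → :- a :- (:- b) := :- (a :- b)) refl (u m) (u n)) ⟩
      ℚ.∣ ℚ.- (u m ℚ.- u n) ∣
        ≡⟨ ℚ.∣-p∣≡∣p∣ (u m ℚ.- u n) ⟩
      ℚ.∣ u m ℚ.- u n ∣
        <⟨ hN m n m≥ n≥ ⟩
      ε ∎
    where open ℚ.≤-Reasoning

  ∣p∣≤∣q∣+∣p-q∣ : ∀ p q → ℚ.∣ p ∣ ℚ.≤ ℚ.∣ q ∣ ℚ.+ ℚ.∣ p ℚ.- q ∣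
  ∣p∣≤∣q∣+∣p-q∣ p q = begin
    ℚ.∣ p ∣                     ≡⟨ cong ℚ.∣_∣ (solve 2 (λ a b → a := b :+ (a :- b)) refl p q) ⟩
    ℚ.∣ q ℚ.+ (p ℚ.- q) ∣       ≤⟨ ℚ.∣p+q∣≤∣p∣+∣q∣ q (p ℚ.- q) ⟩
    ℚ.∣ q ∣ ℚ.+ ℚ.∣ p ℚ.- q ∣   ∎
    where open ℚ.≤-Reasoning

  ∣p∣-∣q∣≤∣p-q∣ : ∀ p q → ℚ.∣ p ∣ ℚ.- ℚ.∣ q ∣ ℚ.≤ ℚ.∣ p ℚ.- q ∣
  ∣p∣-∣q∣≤∣p-q∣ p q = begin
    ℚ.∣ p ∣ ℚ.- ℚ.∣ q ∣
      ≤⟨ ℚ.+-monoˡ-≤ (ℚ.- ℚ.∣ q ∣) (∣p∣≤∣q∣+∣p-q∣ p q) ⟩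
    (ℚ.∣ q ∣ ℚ.+ ℚ.∣ p ℚ.- q ∣) ℚ.- ℚ.∣ q ∣
      ≡⟨ solve 2 (λ a b → (a :+ b) :- a := b) refl ℚ.∣ q ∣ ℚ.∣ p ℚ.- q ∣ ⟩
    ℚ.∣ p ℚ.- q ∣ ∎
    where open ℚ.≤-Reasoning

  ∣p-q∣≡∣q-p∣ : ∀ p q → ℚ.∣ p ℚ.- q ∣ ≡ ℚ.∣ q ℚ.- p ∣
  ∣p-q∣≡∣q-p∣ p q = trans (sym (ℚ.∣-p∣≡∣p∣ (p ℚ.- q)))
    (cong ℚ.∣_∣ (solve 2 (λ a b → :- (a :- b) := b :- a) refl p q))

  ∣∣p∣-∣q∣∣≤∣p-q∣ : ∀ p q → ℚ.∣ ℚ.∣ p ∣ ℚ.- ℚ.∣ q ∣ ∣ ℚ.≤ ℚ.∣ p ℚ.- q ∣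
  ∣∣p∣-∣q∣∣≤∣p-q∣ p q with ℚ.∣p∣≡p∨∣p∣≡-p (ℚ.∣ p ∣ ℚ.- ℚ.∣ q ∣)
  ... | inj₁ eq = subst (ℚ._≤ ℚ.∣ p ℚ.- q ∣) (sym eq) (∣p∣-∣q∣≤∣p-q∣ p q)
  ... | inj₂ eq = begin
    ℚ.∣ ℚ.∣ p ∣ ℚ.- ℚ.∣ q ∣ ∣   ≡⟨ eq ⟩
    ℚ.- (ℚ.∣ p ∣ ℚ.- ℚ.∣ q ∣)   ≡⟨ solve 2 (λ a b → :- (a :- b) := b :- a) refl ℚ.∣ p ∣ ℚ.∣ q ∣ ⟩
    ℚ.∣ q ∣ ℚ.- ℚ.∣ p ∣         ≤⟨ ∣p∣-∣q∣≤∣p-q∣ q p ⟩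
    ℚ.∣ q ℚ.- p ∣               ≡⟨ ∣p-q∣≡∣q-p∣ q p ⟩
    ℚ.∣ p ℚ.- q ∣               ∎
    where open ℚ.≤-Reasoning

  abs-cauchy : ∀ u → Cauchy u → Cauchy (λ n → ℚ.∣ u n ∣)
  abs-cauchy u cu ε ε>0 =
    let N , hN = cu ε ε>0
    in N , λ m n m≥ n≥ →
      ℚ.≤-<-trans (∣∣p∣-∣q∣∣≤∣p-q∣ (u m) (u n)) (hN m n m≥ n≥)

  bounded : ∀ {u} → Cauchy u →
    ∃[ B ] ℚ.Positive B × ∃[ N ] ∀ n → N ℕ.≤ n → ℚ.∣ u n ∣ ℚ.≤ B
  bounded {u} cu =
    let N , hN = cu 1ℚ (ℚ.positive⁻¹ 1ℚ)
    in ℚ.∣ u N ∣ ℚ.+ 1ℚ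
     , ℚ.positive (ℚ.+-mono-≤-< (ℚ.0≤∣p∣ (u N)) (ℚ.positive⁻¹ 1ℚ))
     , N , λ n n≥ → begin
         ℚ.∣ u n ∣                          ≤⟨ ∣p∣≤∣q∣+∣p-q∣ (u n) (u N) ⟩
         ℚ.∣ u N ∣ ℚ.+ ℚ.∣ u n ℚ.- u N ∣    ≤⟨ ℚ.+-monoʳ-≤ ℚ.∣ u N ∣ (ℚ.<⇒≤ (hN n N n≥ ℕ.≤-refl)) ⟩
         ℚ.∣ u N ∣ ℚ.+ 1ℚ                   ∎
    where open ℚ.≤-Reasoning

  ∣∣*< : ∀ {B p d δ} → ℚ.Positive B → ℚ.∣ p ∣ ℚ.≤ B → ℚ.∣ d ∣ ℚ.< δ →
         ℚ.∣ p ℚ.* d ∣ ℚ.< B ℚ.* δ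
  ∣∣*< {B} {p} {d} {δ} B>0 p≤ d< = begin-strict
    ℚ.∣ p ℚ.* d ∣           ≡⟨ ℚ.∣p*q∣≡∣p∣*∣q∣ p d ⟩
    ℚ.∣ p ∣ ℚ.* ℚ.∣ d ∣     ≤⟨ ℚ.*-monoʳ-≤-nonNeg ℚ.∣ d ∣ {{ℚ.∣-∣-nonNeg d}} p≤ ⟩
    B ℚ.* ℚ.∣ d ∣           <⟨ ℚ.*-monoʳ-<-pos B {{B>0}} d< ⟩
    B ℚ.* δ                 ∎
    where open ℚ.≤-Reasoning

  product-diff : ∀ a b c d → a ℚ.* b ℚ.- c ℚ.* d ≡ a ℚ.* (b ℚ.- d) ℚ.+ d ℚ.* (a ℚ.- c)
  product-diff a b c d = begin
    a ℚ.* b ℚ.- c ℚ.* d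
      ≡⟨ solve 3 (λ x y z → x :+ :- y := (x :+ :- z) :+ (z :+ :- y)) refl
           (a ℚ.* b) (c ℚ.* d) (a ℚ.* d) ⟩
    (a ℚ.* b ℚ.- a ℚ.* d) ℚ.+ (a ℚ.* d ℚ.- c ℚ.* d)
      ≡⟨ cong₂ ℚ._+_ (solve 3 (λ x y z → x :* y :+ :- (x :* z) := x :* (y :+ :- z)) refl a b d)
                     (solve 3 (λ x y z → x :* z :+ :- (y :* z) := z :* (x :+ :- y)) refl a c d) ⟩
    a ℚ.* (b ℚ.- d) ℚ.+ d ℚ.* (a ℚ.- c) ∎
    where open ≡-Reasoning

  divide : ∀ C ε → ℚ.Positive C → 0ℚ ℚ.< ε → ∃[ δ ] 0ℚ ℚ.< δ × C ℚ.* δ ≡ ε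
  divide C ε C>0 ε>0 = C⁻¹ ℚ.* ε
    , subst (ℚ._< C⁻¹ ℚ.* ε) (ℚ.*-zeroʳ C⁻¹)
        (ℚ.*-monoʳ-<-pos C⁻¹ {{ℚ.1/pos⇒pos C {{C>0}}}} ε>0)
    , trans (sym (ℚ.*-assoc C C⁻¹ ε))
        (trans (cong (ℚ._* ε) (ℚ.*-inverseʳ C {{C≢0}})) (ℚ.*-identityˡ ε))
    where
    C≢0 : ℚ.NonZero C
    C≢0 = ℚ.pos⇒nonZero C {{C>0}}
    C⁻¹ : ℚ
    C⁻¹ = (ℚ.1/ C) {{C≢0}}

  product-bound : ∀ {A B a b c d δ} → ℚ.Positive A → ℚ.Positive B →
    ℚ.∣ a ∣ ℚ.≤ A → ℚ.∣ d ∣ ℚ.≤ B → ℚ.∣ b ℚ.- d ∣ ℚ.< δ → ℚ.∣ a ℚ.- c ∣ ℚ.< δ →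
    ℚ.∣ a ℚ.* b ℚ.- c ℚ.* d ∣ ℚ.< (A ℚ.+ B) ℚ.* δ
  product-bound {A} {B} {a} {b} {c} {d} {δ} A>0 B>0 a≤ d≤ b-d< a-c< = begin-strict
    ℚ.∣ a ℚ.* b ℚ.- c ℚ.* d ∣
      ≡⟨ cong ℚ.∣_∣ (product-diff a b c d) ⟩
    ℚ.∣ a ℚ.* (b ℚ.- d) ℚ.+ d ℚ.* (a ℚ.- c) ∣
      ≤⟨ ℚ.∣p+q∣≤∣p∣+∣q∣ (a ℚ.* (b ℚ.- d)) (d ℚ.* (a ℚ.- c)) ⟩
    ℚ.∣ a ℚ.* (b ℚ.- d) ∣ ℚ.+ ℚ.∣ d ℚ.* (a ℚ.- c) ∣
      <⟨ ℚ.+-mono-< (∣∣*< {A} {a} {b ℚ.- d} {δ} A>0 a≤ b-d<)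
                    (∣∣*< {B} {d} {a ℚ.- c} {δ} B>0 d≤ a-c<) ⟩
    A ℚ.* δ ℚ.+ B ℚ.* δ
      ≡⟨ sym (ℚ.*-distribʳ-+ δ A B) ⟩
    (A ℚ.+ B) ℚ.* δ ∎
    where open ℚ.≤-Reasoning

  *-cauchy : ∀ u v → Cauchy u → Cauchy v → Cauchy (λ n → u n ℚ.* v n)
  *-cauchy u v cu cv ε ε>0 =
    let A , A>0 , K , hA = bounded {u} cu
        B , B>0 , L , hB = bounded {v} cv
        C>0 = ℚ.positive (ℚ.+-mono-< (ℚ.positive⁻¹ A {{A>0}}) (ℚ.positive⁻¹ B {{B>0}}))
        δ , δ>0 , Cδ≡ε = divide (A ℚ.+ B) ε C>0 ε>0
    in go A B δ K L A>0 B>0 hA hB Cδ≡ε (cu δ δ>0) (cv δ δ>0)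
    where
    Close : (ℕ → ℚ) → ℚ → Set
    Close w η = ∃[ N ] ∀ m n → N ℕ.≤ m → N ℕ.≤ n → ℚ.∣ w m ℚ.- w n ∣ ℚ.< η

    go : ∀ A B δ K L → ℚ.Positive A → ℚ.Positive B →
      (∀ n → K ℕ.≤ n → ℚ.∣ u n ∣ ℚ.≤ A) → (∀ n → L ℕ.≤ n → ℚ.∣ v n ∣ ℚ.≤ B) →
      (A ℚ.+ B) ℚ.* δ ≡ ε → Close u δ → Close v δ → Close (λ n → u n ℚ.* v n) ε
    go A B δ K L A>0 B>0 hA hB Cδ≡ε (M , hM) (N , hN) =
      (K ℕ.⊔ L) ℕ.⊔ (M ℕ.⊔ N) , λ m n m≥ n≥ →
        let m≥KL = ⊔ˡ {K ℕ.⊔ L} {M ℕ.⊔ N} m≥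
            m≥MN = ⊔ʳ {K ℕ.⊔ L} {M ℕ.⊔ N} m≥
            n≥KL = ⊔ˡ {K ℕ.⊔ L} {M ℕ.⊔ N} n≥
            n≥MN = ⊔ʳ {K ℕ.⊔ L} {M ℕ.⊔ N} n≥
        in subst (ℚ.∣ u m ℚ.* v m ℚ.- u n ℚ.* v n ∣ ℚ.<_) Cδ≡ε
             (product-bound {A} {B} {u m} {v m} {u n} {v n} {δ} A>0 B>0
               (hA m (⊔ˡ {K} {L} m≥KL)) (hB n (⊔ʳ {K} {L} n≥KL))
               (hN m n (⊔ʳ {M} {N} m≥MN) (⊔ʳ {M} {N} n≥MN))
               (hM m n (⊔ˡ {M} {N} m≥MN) (⊔ˡ {M} {N} n≥MN)))

infix  4 _≈_ _<_ _≤_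
infixl 6 _+_ _-_
infixl 7 _*_
infix  8 -_

fromℚ : ℚ → ℝ
fromℚ r = mkℝ (λ _ → r) (const-cauchy r)

fromℤ : ℤ → ℝ
fromℤ k = fromℚ (k ℚ./ 1)

fromℕ : ℕ → ℝ
fromℕ n = fromℤ (+ n)

0ℝ 1ℝ : ℝ
0ℝ = fromℚ 0ℚ
1ℝ = fromℚ 1ℚ

-_ ∣_∣ : ℝ → ℝ
- x   = mkℝ (λ n → ℚ.- seq x n) (neg-cauchy (seq x) (cauchy x))
∣ x ∣ = mkℝ (λ n → ℚ.∣ seq x n ∣) (abs-cauchy (seq x) (cauchy x))

_+_ _-_ _*_ : ℝ → ℝ → ℝ
x + y = mkℝ (λ n → seq x n ℚ.+ seq y n) (+-cauchy (seq x) (seq y) (cauchy x) (cauchy y))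
x - y = x + (- y)
x * y = mkℝ (λ n → seq x n ℚ.* seq y n) (*-cauchy (seq x) (seq y) (cauchy x) (cauchy y))

_≈_ _<_ _≤_ : ℝ → ℝ → Set
x ≈ y = ∀ ε → 0ℚ ℚ.< ε → ∃[ N ] ∀ n → N ℕ.≤ n → ℚ.∣ seq x n ℚ.- seq y n ∣ ℚ.< ε
x < y = ∃[ ε ] 0ℚ ℚ.< ε × ∃[ N ] ∀ n → N ℕ.≤ n → seq x n ℚ.+ ε ℚ.≤ seq y n
x ≤ y = ¬ (y < x)

pow : ℝ → ℕ → ℝ
pow x zero    = 1ℝ
pow x (suc n) = x * pow x n

∑< : ℕ → (ℕ → ℝ) → ℝ
∑< zero    f = 0ℝ
∑< (suc n) f = ∑< n f + f n

Converges : (ℕ → ℝ) → ℝ → Set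
Converges f x = ∀ ε → 0ℝ < ε → ∃[ N ] ∀ n → N ℕ.≤ n → ∣ f n - x ∣ < ε

infix 4 _≈∞_ _≤∞_ _<∞_

data ℝ∞ : Set where
  -∞ +∞ : ℝ∞
  fin   : ℝ → ℝ∞

_≤∞_ _<∞_ _≈∞_ : ℝ∞ → ℝ∞ → Set
-∞    ≤∞ _     = ⊤
_     ≤∞ +∞    = ⊤
fin x ≤∞ fin y = x ≤ y
_     ≤∞ _     = ⊥
x <∞ y = ¬ (y ≤∞ x)
x ≈∞ y = x ≤∞ y × y ≤∞ x

IsSup IsInf : ∀ {ℓ} {I : Set ℓ} → (I → ℝ∞) → ℝ∞ → Set ℓ
IsSup g s = (∀ i → g i ≤∞ s) × (∀ b → (∀ i → g i ≤∞ b) → s ≤∞ b)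
IsInf g s = (∀ i → s ≤∞ g i) × (∀ b → (∀ i → b ≤∞ g i) → b ≤∞ s)

-- The exponent of p in q: the largest k ≤ q with p ^ k ∣ q.  The bound
-- loses nothing for q ≥ 1 and p ≥ 2, as then p ^ k ∣ q gives k < p ^ k ≤ q.
val : ℕ → ℕ → ℕ
val p q = search q
  where
  search : ℕ → ℕ
  search zero    = zero
  search (suc k) = if does (p ℕ.^ suc k ∣? q) then suc k else search k

module _ (p : ℕ) (pr : Prime p) (q : ℕ) where

  private instance
    pᵛ≢0 : NonZero (p ℕ.^ val p q)
    pᵛ≢0 = ℕ.m^n≢0 p (val p q) {{prime⇒nonZero pr}}

  padicAbs : ℚ
  padicAbs = + 1 ℚ./ (p ℕ.^ val p q)

  padicAbs≢0 : ℚ.NonZero padicAbs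
  padicAbs≢0 = ℚ.pos⇒nonZero padicAbs {{ℚ.normalize-pos 1 (p ℕ.^ val p q)}}

  2/padicAbs : ℚ
  2/padicAbs = ((+ 2) ℚ./ 1) ℚ.÷ padicAbs
    where instance _ = padicAbs≢0

-- Classical logic, as in ordinary analysis.  Excluded middle for all types
-- picks an object with a given property when one exists, so that limits,
-- suprema and infima are total functions, with a default value otherwise;
-- what is picked here is always unique up to _≈_ or _≈∞_.

module Classical (em : ∀ {ℓ} → ExcludedMiddle ℓ) where

  infixr 9 _^_

  choose : ∀ {a ℓ} {A : Set a} → A → (A → Set ℓ) → A
  choose default P with em {P = ∃ P}
  ... | yes (x , _) = x
  ... | no _        = default

  lim : (ℕ → ℝ) → ℝ
  lim f = choose 0ℝ (Converges f)

  sup inf : ∀ {ℓ} {I : Set ℓ} → (I → ℝ∞) → ℝ∞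
  sup g = choose +∞ (IsSup g)
  inf g = choose -∞ (IsInf g)

  liminf : (ℕ → ℝ) → ℝ∞
  liminf f = sup λ N → inf λ k → fin (f (N ℕ.+ k))

  exp : ℝ → ℝ
  exp x = lim λ n → ∑< n λ k → pow x k * fromℚ (ℚ._/_ (+ 1) (k !) {{k ℕ.!≢0}})

  -- Meaningful for x > 0.
  log : ℝ → ℝ
  log x = choose 0ℝ λ y → exp y ≈ x

  -- Meaningful for x ≥ 0, with 0 ^ 0 = 1 and 0 ^ c = 0 otherwise.
  _^_ : ℝ → ℝ → ℝ
  x ^ c = if does (em {P = 0ℝ < x}) then exp (c * log x)
          else if does (em {P = c ≈ 0ℝ}) then 1ℝ else 0ℝ

  real : ℝ∞ → ℝ
  real (fin x) = x
  real _       = 0ℝ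

  distℤ : ℝ → ℝ
  distℤ x = real (inf λ (k : ℤ) → fin ∣ x - fromℤ k ∣)

  -- The diameter, in [0,+∞]; that of the empty set is 0.
  diam : Pred ℝ 0ℓ → ℝ∞
  diam U = sup dist
    where
    dist : ⊤ ⊎ Σ (ℝ × ℝ) (λ (x , y) → x ∈ U × y ∈ U) → ℝ∞
    dist (inj₁ _)             = fin 0ℝ
    dist (inj₂ ((x , y) , _)) = fin ∣ x - y ∣

  record Cover (δ : ℝ) (S : Pred ℝ 0ℓ) : Set₁ where
    field
      piece  : ℕ → Pred ℝ 0ℓ
      small  : ∀ i → diam (piece i) ≤∞ fin δ
      covers : ∀ x → x ∈ S → ∃[ i ] x ∈ piece i

  open Cover

  -- The pieces have finite diameter, so real loses nothing here.  A series of
  -- nonnegative terms is the supremum of its partial sums.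
  cost : ∀ {δ S} → ℝ → Cover δ S → ℝ∞
  cost s 𝒰 = sup λ n → fin (∑< n λ i → real (diam (piece 𝒰 i)) ^ s)

  premeasure : ℝ → ℝ → Pred ℝ 0ℓ → ℝ∞
  premeasure s δ S = inf λ (𝒰 : Cover δ S) → cost s 𝒰

  hausdorffMeasure : ℝ → Pred ℝ 0ℓ → ℝ∞
  hausdorffMeasure s S = sup λ ((δ , _) : Σ ℝ (0ℝ <_)) → premeasure s δ S

  -- At s = 0 the convention 0 ^ 0 = 1 charges for empty pieces too; this
  -- leaves the infimum unchanged.
  dimH : Pred ℝ 0ℓ → ℝ∞
  dimH S = inf λ ((s , _) : Σ ℝ λ s → 0ℝ ≤ s × hausdorffMeasure s S ≈∞ fin 0ℝ) → fin s

  module _ (a : ℝ) (p : ℕ) (pr : Prime p) (α : ℝ) where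

    littlewoodProduct : ℕ → ℝ
    littlewoodProduct q =
      fromℕ q * log (fromℕ q) ^ (fromℕ 2 - a) * distℤ (fromℕ q * α)
        * fromℚ (padicAbs p pr q) * log (fromℚ (2/padicAbs p pr q)) ^ a

{-# OPTIONS --safe #-}
module Submission where

-- Every s > 1 gives ℝ measure zero.  For s < 1 take R = 2 ^ (u + 1) with u large and
-- build a point as a nested sequence of R-adic intervals (nodes), starting from [1 , 2].
-- Write q = p ^ k m and let n be the level with R ^ (n - 1) < 4 m q ≤ R ^ n.  Fractions of
-- level n with the same k are 4 R ^ (- n) apart, so a node of level n is near to at most one
-- of them for each of the O(n) values of k.  Forbid the three nodes around it at depth
-- t below n, where 2 ^ (u t) ≈ n: avoiding them costs only the power 1 + 1 / u ≤ 2 - a of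
-- log q.  A cover of small s-dimensional cost likewise forbids five nodes for each piece.
-- A forbidden node at depth d below the current one has weight 2 ^ (- u d).  Passing to a
-- child divides the average total weight by two, so if the total is below 1 then some
-- child has total at most ½, which leaves room for the nodes forbidden at the next level.
-- Hence a point exists that satisfies the Diophantine condition and escapes the cover.

open import Axiom.ExcludedMiddle using (ExcludedMiddle)
open import Data.Nat using (ℕ; suc)
open import Data.Nat.Primality using (Prime)
open import Defs

open import Data.Bool using (if_then_else_; true; false)
open import Data.Empty using (⊥; ⊥-elim)
open import Data.Integer as ℤ using (ℤ; +_; -[1+_])
import Data.Integer.Properties as ℤ
open import Data.List as List using (List; []; _∷_; length; _++_)
import Data.List.Properties as List
open import Data.List.Membership.Propositional using (_∈_; _∉_)
open import Data.List.Membership.Propositional.Properties using (∈-map⁺; ∈-++⁺ˡ; ∈-++⁺ʳ)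
open import Data.List.Relation.Unary.Any using (here; there)
open import Data.Nat as ℕ using (zero; _!)
import Data.Nat.Combinatorics as ℕ
open import Data.Nat.Divisibility using (_∣_; _∣?_; _∣0; 1∣_; divides; divides-refl)
open import Data.Nat.DivMod using (m≡m%n+[m/n]*n; m%n<n; m<n⇒m/n≡0; m<n⇒m%n≡m; [m+kn]%n≡m%n; m*n/n≡m; +-distrib-/-∣ʳ)
open import Data.Nat.Primality using (prime⇒nonZero; prime⇒nonTrivial)
import Data.Nat.Properties as ℕ
import Data.Nat.Solver as ℕ
open import Data.Product using (Σ; ∃; ∃-syntax; _×_; _,_; proj₁; proj₂)
open import Data.Rational as ℚ using (ℚ; 0ℚ; 1ℚ; ½; toℚᵘ)
import Data.Rational.Properties as ℚ
open import Data.Rational.Solver using (module +-*-Solver)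
import Data.Rational.Unnormalised as ℚᵘ
import Data.Rational.Unnormalised.Properties as ℚᵘ
open import Data.Sum using (_⊎_; inj₁; inj₂)
open import Data.Unit using (tt)
open import Level using (0ℓ)
open import Relation.Binary.PropositionalEquality hiding (J)
open import Relation.Nullary using (¬_; Dec; yes; no; does)
open import Relation.Unary using (Pred)

open +-*-Solver using (solve; _:+_; _:*_; _:-_; :-_; _:=_; con)
module ℕS = ℕ.+-*-Solver

-- A potential takes the place of a measure on a Cantor set: the path has to escape infinitely many
-- pieces of a cover, of all sizes, together with the fractions, and one total weight treats both
-- alike. The base is twice 2 ^ u because a forbidden node lies below only one of the R children,
-- and there its weight grows by 2 ^ u; averaging over the children halves it. The price is that a
-- node of length R ^ (- d) weighs its length to the power u / (u + 1) instead of 1. The strict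
-- inequalities s < 1 and a < 1 pay for this loss: u is taken with u (1 - s) ≥ 1 and u (1 - a) ≥ 1.
-- For q = p ^ k m one has q |q|_p = m, so keeping α at distance R ^ (- n - t) from the fractions x
-- / q bounds q ‖qα‖ |q|_p below by m q R ^ (- n - t), which exceeds R ^ (- t - 1) / 4 by the choice
-- of n. The last factor enters through log (2 / |q|_p) ≥ log 2 ≥ ½. Starting from [1 , 2] keeps α
-- positive, so that the numerators x are natural numbers. All scales are powers of two, so that
-- estimates become inequalities between exponents.

κ : ℤ → ℚ
κ i = i ℚ./ 1

ι : ℕ → ℚ
ι n = κ (+ n)

toℚᵘ-κ : ∀ i → toℚᵘ (κ i) ℚᵘ.≃ ℚᵘ.mkℚᵘ i 0
toℚᵘ-κ i = ℚ.toℚᵘ-fromℚᵘ (ℚᵘ.mkℚᵘ i 0)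

κ-+ : ∀ i j → κ (i ℤ.+ j) ≡ κ i ℚ.+ κ j
κ-+ i j = ℚ.toℚᵘ-injective (begin
  toℚᵘ (κ (i ℤ.+ j))             ≈⟨ toℚᵘ-κ (i ℤ.+ j) ⟩
  ℚᵘ.mkℚᵘ (i ℤ.+ j) 0            ≈⟨ ℚᵘ.*≡* (cong (ℤ._* (+ 1)) (cong₂ ℤ._+_ (sym (ℤ.*-identityʳ i)) (sym (ℤ.*-identityʳ j)))) ⟩
  ℚᵘ.mkℚᵘ i 0 ℚᵘ.+ ℚᵘ.mkℚᵘ j 0   ≈⟨ ℚᵘ.+-cong (ℚᵘ.≃-sym (toℚᵘ-κ i)) (ℚᵘ.≃-sym (toℚᵘ-κ j)) ⟩
  toℚᵘ (κ i) ℚᵘ.+ toℚᵘ (κ j)     ≈⟨ ℚᵘ.≃-sym (ℚ.toℚᵘ-homo-+ (κ i) (κ j)) ⟩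
  toℚᵘ (κ i ℚ.+ κ j)             ∎)
  where open ℚᵘ.≃-Reasoning

κ-* : ∀ i j → κ (i ℤ.* j) ≡ κ i ℚ.* κ j
κ-* i j = ℚ.toℚᵘ-injective (begin
  toℚᵘ (κ (i ℤ.* j))             ≈⟨ toℚᵘ-κ (i ℤ.* j) ⟩
  ℚᵘ.mkℚᵘ i 0 ℚᵘ.* ℚᵘ.mkℚᵘ j 0   ≈⟨ ℚᵘ.*-cong (ℚᵘ.≃-sym (toℚᵘ-κ i)) (ℚᵘ.≃-sym (toℚᵘ-κ j)) ⟩
  toℚᵘ (κ i) ℚᵘ.* toℚᵘ (κ j)     ≈⟨ ℚᵘ.≃-sym (ℚ.toℚᵘ-homo-* (κ i) (κ j)) ⟩
  toℚᵘ (κ i ℚ.* κ j)             ∎)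
  where open ℚᵘ.≃-Reasoning

κ-mono-≤ : ∀ {i j} → i ℤ.≤ j → κ i ℚ.≤ κ j
κ-mono-≤ {i} {j} i≤j = ℚ.toℚᵘ-cancel-≤ (begin
  toℚᵘ (κ i)    ≃⟨ toℚᵘ-κ i ⟩
  ℚᵘ.mkℚᵘ i 0   ≤⟨ ℚᵘ.*≤* (ℤ.*-monoʳ-≤-nonNeg (+ 1) i≤j) ⟩
  ℚᵘ.mkℚᵘ j 0   ≃⟨ ℚᵘ.≃-sym (toℚᵘ-κ j) ⟩
  toℚᵘ (κ j)    ∎)
  where open ℚᵘ.≤-Reasoning

κ-mono-< : ∀ {i j} → i ℤ.< j → κ i ℚ.< κ j
κ-mono-< {i} {j} i<j = ℚ.toℚᵘ-cancel-< (begin-strict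
  toℚᵘ (κ i)    ≃⟨ toℚᵘ-κ i ⟩
  ℚᵘ.mkℚᵘ i 0   <⟨ ℚᵘ.*<* (ℤ.*-monoʳ-<-pos (+ 1) i<j) ⟩
  ℚᵘ.mkℚᵘ j 0   ≃⟨ ℚᵘ.≃-sym (toℚᵘ-κ j) ⟩
  toℚᵘ (κ j)    ∎)
  where open ℚᵘ.≤-Reasoning

κ-cancel-< : ∀ {i j} → κ i ℚ.< κ j → i ℤ.< j
κ-cancel-< {i} {j} κi<κj with i ℤ.<? j
... | yes i<j = i<j
... | no i≮j  = ⊥-elim (ℚ.<-irrefl refl (ℚ.<-≤-trans κi<κj (κ-mono-≤ (ℤ.≮⇒≥ i≮j))))

ι-+ : ∀ m n → ι (m ℕ.+ n) ≡ ι m ℚ.+ ι n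
ι-+ m n = κ-+ (+ m) (+ n)

ι-* : ∀ m n → ι (m ℕ.* n) ≡ ι m ℚ.* ι n
ι-* m n = trans (cong κ (ℤ.pos-* m n)) (κ-* (+ m) (+ n))

ι-mono-≤ : ∀ {m n} → m ℕ.≤ n → ι m ℚ.≤ ι n
ι-mono-≤ m≤n = κ-mono-≤ (ℤ.+≤+ m≤n)

ι-mono-< : ∀ {m n} → m ℕ.< n → ι m ℚ.< ι n
ι-mono-< m<n = κ-mono-< (ℤ.+<+ m<n)

ι-cancel-< : ∀ {m n} → ι m ℚ.< ι n → m ℕ.< n
ι-cancel-< lt = ℤ.drop‿+<+ (κ-cancel-< lt)

0≤ι : ∀ n → 0ℚ ℚ.≤ ι n
0≤ι n = ι-mono-≤ {0} {n} ℕ.z≤n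

-- Inequalities and null sequences in ℚ

infixl 6 _⊞_
infixl 7 _⊠_

_⊞_ : ∀ {p q} → 0ℚ ℚ.≤ p → 0ℚ ℚ.≤ q → 0ℚ ℚ.≤ p ℚ.+ q
0≤p ⊞ 0≤q = ℚ.+-mono-≤ 0≤p 0≤q

_⊠_ : ∀ {p q} → 0ℚ ℚ.≤ p → 0ℚ ℚ.≤ q → 0ℚ ℚ.≤ p ℚ.* q
_⊠_ {p} {q} 0≤p 0≤q = subst (ℚ._≤ p ℚ.* q) (ℚ.*-zeroˡ q)
  (ℚ.*-monoʳ-≤-nonNeg q {{ℚ.nonNegative 0≤q}} 0≤p)

0<* : ∀ {p q} → 0ℚ ℚ.< p → 0ℚ ℚ.< q → 0ℚ ℚ.< p ℚ.* q
0<* {p} {q} 0<p 0<q = subst (ℚ._< p ℚ.* q) (ℚ.*-zeroˡ q)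
  (ℚ.*-monoˡ-<-pos q {{ℚ.positive 0<q}} 0<p)

0<+ : ∀ {p q} → 0ℚ ℚ.< p → 0ℚ ℚ.≤ q → 0ℚ ℚ.< p ℚ.+ q
0<+ = ℚ.+-mono-<-≤

gap : ∀ {p q} → p ℚ.≤ q → 0ℚ ℚ.≤ q ℚ.- p
gap {p} {q} p≤q = subst (ℚ._≤ q ℚ.- p) (ℚ.+-inverseʳ p) (ℚ.+-monoˡ-≤ (ℚ.- p) p≤q)

gap< : ∀ {p q} → p ℚ.< q → 0ℚ ℚ.< q ℚ.- p
gap< {p} {q} p<q = subst (ℚ._< q ℚ.- p) (ℚ.+-inverseʳ p) (ℚ.+-monoˡ-< (ℚ.- p) p<q)

-- Nearly every inequality below is reduced to this one: the difference d is written as a sum of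
-- products of known nonnegative gaps, and the ring solver checks the identity q = p + d.
≤-by : ∀ {p q d} → 0ℚ ℚ.≤ d → q ≡ p ℚ.+ d → p ℚ.≤ q
≤-by {p} {q} 0≤d q≡ = subst₂ ℚ._≤_ (ℚ.+-identityʳ p) (sym q≡) (ℚ.+-monoʳ-≤ p 0≤d)

<-by : ∀ {p q d} → 0ℚ ℚ.< d → q ≡ p ℚ.+ d → p ℚ.< q
<-by {p} {q} 0<d q≡ = subst₂ ℚ._<_ (ℚ.+-identityʳ p) (sym q≡) (ℚ.+-monoʳ-< p 0<d)

0≤½ : 0ℚ ℚ.≤ ½
0≤½ = ℚ.nonNegative⁻¹ ½

0<½ : 0ℚ ℚ.< ½
0<½ = ℚ.positive⁻¹ ½

0<1 : 0ℚ ℚ.< 1ℚ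
0<1 = ℚ.positive⁻¹ 1ℚ

0≤1 : 0ℚ ℚ.≤ 1ℚ
0≤1 = ℚ.nonNegative⁻¹ 1ℚ

∣∣≤ : ∀ {p q} → p ℚ.≤ q → ℚ.- p ℚ.≤ q → ℚ.∣ p ∣ ℚ.≤ q
∣∣≤ {p} {q} p≤q -p≤q with ℚ.∣p∣≡p∨∣p∣≡-p p
... | inj₁ eq = subst (ℚ._≤ q) (sym eq) p≤q
... | inj₂ eq = subst (ℚ._≤ q) (sym eq) -p≤q

p≤∣p∣ : ∀ p → p ℚ.≤ ℚ.∣ p ∣
p≤∣p∣ p with ℚ.≤-total 0ℚ p
... | inj₁ 0≤p = ℚ.≤-reflexive (sym (ℚ.0≤p⇒∣p∣≡p 0≤p))
... | inj₂ p≤0 = ℚ.≤-trans p≤0 (ℚ.0≤∣p∣ p)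

-p≤∣p∣ : ∀ p → ℚ.- p ℚ.≤ ℚ.∣ p ∣
-p≤∣p∣ p = subst (ℚ.- p ℚ.≤_) (ℚ.∣-p∣≡∣p∣ p) (p≤∣p∣ (ℚ.- p))

reciprocal : ∀ ε → 0ℚ ℚ.< ε → ∃[ r ] 0ℚ ℚ.< r × ε ℚ.* r ≡ 1ℚ
reciprocal ε ε>0 = (ℚ.1/ ε) {{nz}} , ℚ.positive⁻¹ _ {{ℚ.1/pos⇒pos ε {{pos}}}} , ℚ.*-inverseʳ ε {{nz}}
  where
  pos = ℚ.positive ε>0
  nz  = ℚ.pos⇒nonZero ε {{pos}}

-- The absolute value of the numerator serves, since the denominator is at least 1.
archimedean : ∀ r → ∃[ n ] r ℚ.≤ ι n
archimedean r@(ℚ.mkℚ i d-1 _) = ℤ.∣ i ∣ , ℚ.toℚᵘ-cancel-≤ (begin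
  toℚᵘ r                   ≤⟨ ℚᵘ.*≤* (step i) ⟩
  ℚᵘ.mkℚᵘ (+ ℤ.∣ i ∣) 0    ≃⟨ ℚᵘ.≃-sym (toℚᵘ-κ (+ ℤ.∣ i ∣)) ⟩
  toℚᵘ (ι ℤ.∣ i ∣)         ∎)
  where
  open ℚᵘ.≤-Reasoning
  step : ∀ i → i ℤ.* (+ 1) ℤ.≤ (+ ℤ.∣ i ∣) ℤ.* (+ suc d-1)
  step (+ n)    = subst₂ ℤ._≤_ (ℤ.pos-* n 1) (ℤ.pos-* n (suc d-1)) (ℤ.+≤+ (ℕ.*-monoʳ-≤ n (ℕ.s≤s ℕ.z≤n)))
  step -[1+ n ] = ℤ.≤-trans (ℤ.≤-reflexive (ℤ.*-identityʳ -[1+ n ]))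
                    (subst (-[1+ n ] ℤ.≤_) (ℤ.pos-* (suc n) (suc d-1)) ℤ.-≤+)

-- 2 ^ (- n), the unit for lengths and weights alike: a node of level t has length `h (v ℕ.* t)`,
-- and a forbidden node at depth d has weight `h (u ℕ.* d)`.
h : ℕ → ℚ
h zero    = 1ℚ
h (suc n) = ½ ℚ.* h n

0<h : ∀ n → 0ℚ ℚ.< h n
0<h zero    = 0<1
0<h (suc n) = 0<* 0<½ (0<h n)

0≤h : ∀ n → 0ℚ ℚ.≤ h n
0≤h n = ℚ.<⇒≤ (0<h n)

h-+ : ∀ m n → h (m ℕ.+ n) ≡ h m ℚ.* h n
h-+ zero n    = sym (ℚ.*-identityˡ (h n))
h-+ (suc m) n = trans (cong (½ ℚ.*_) (h-+ m n)) (sym (ℚ.*-assoc ½ (h m) (h n)))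

2^-suc : ∀ n → ι (2 ℕ.^ suc n) ≡ ι (2 ℕ.^ n) ℚ.+ ι (2 ℕ.^ n)
2^-suc n = trans (cong ι (cong (2 ℕ.^ n ℕ.+_) (ℕ.+-identityʳ (2 ℕ.^ n)))) (ι-+ (2 ℕ.^ n) (2 ℕ.^ n))

2^*h : ∀ n → ι (2 ℕ.^ n) ℚ.* h n ≡ 1ℚ
2^*h zero    = refl
2^*h (suc n) = trans (cong (ℚ._* h (suc n)) (2^-suc n))
  (trans (solve 2 (λ a b → (a :+ a) :* (con ½ :* b) := a :* b) refl (ι (2 ℕ.^ n)) (h n)) (2^*h n))

n≤2^n : ∀ n → n ℕ.≤ 2 ℕ.^ n
n≤2^n zero    = ℕ.z≤n
n≤2^n (suc n) = subst (suc n ℕ.≤_) (cong (2 ℕ.^ n ℕ.+_) (sym (ℕ.+-identityʳ (2 ℕ.^ n))))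
  (ℕ.+-mono-≤ (ℕ.m^n>0 2 n) (n≤2^n n))

h-mono : ∀ {m n} → m ℕ.≤ n → h n ℚ.≤ h m
h-mono {m} {n} m≤n = subst (λ k → h k ℚ.≤ h m) (ℕ.m+[n∸m]≡n m≤n) (go (n ℕ.∸ m))
  where
  go : ∀ k → h (m ℕ.+ k) ℚ.≤ h m
  go zero    = ℚ.≤-reflexive (cong h (ℕ.+-identityʳ m))
  go (suc k) = ℚ.≤-trans (ℚ.≤-reflexive (cong h (ℕ.+-suc m k)))
    (ℚ.≤-trans (≤-by (0≤½ ⊠ 0≤h (m ℕ.+ k)) (solve 1 (λ a → a := con ½ :* a :+ con ½ :* a) refl (h (m ℕ.+ k)))) (go k))

h-null : ∀ ε → 0ℚ ℚ.< ε → ∃[ n ] h n ℚ.≤ ε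
h-null ε ε>0 = n , ≤-by (0≤h n ⊠ gap 1≤) eq
  where
  r   = proj₁ (reciprocal ε ε>0)
  n   = proj₁ (archimedean r)
  1≤  : 1ℚ ℚ.≤ ε ℚ.* ι (2 ℕ.^ n)
  1≤ = subst (ℚ._≤ ε ℚ.* ι (2 ℕ.^ n)) (proj₂ (proj₂ (reciprocal ε ε>0)))
    (ℚ.*-monoˡ-≤-nonNeg ε {{ℚ.nonNegative (ℚ.<⇒≤ ε>0)}}
      (ℚ.≤-trans (proj₂ (archimedean r)) (ι-mono-≤ (n≤2^n n))))
  eq : ε ≡ h n ℚ.+ h n ℚ.* (ε ℚ.* ι (2 ℕ.^ n) ℚ.- 1ℚ)
  eq = trans (trans (sym (ℚ.*-identityʳ ε)) (cong (ε ℚ.*_) (sym (2^*h n))))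
    (solve 3 (λ e a b → e :* (a :* b) := b :+ b :* (e :* a :- con 1ℚ)) refl ε (ι (2 ℕ.^ n)) (h n))

ℚ*-mono : ∀ r {p q} → 0ℚ ℚ.≤ r → p ℚ.≤ q → r ℚ.* p ℚ.≤ r ℚ.* q
ℚ*-mono r 0≤r = ℚ.*-monoˡ-≤-nonNeg r {{ℚ.nonNegative 0≤r}}

ℚ*-mono-< : ∀ r {p q} → 0ℚ ℚ.< r → p ℚ.< q → r ℚ.* p ℚ.< r ℚ.* q
ℚ*-mono-< r 0<r = ℚ.*-monoʳ-<-pos r {{ℚ.positive 0<r}}

ℚ*-cancel : ∀ r {p q} → 0ℚ ℚ.< r → r ℚ.* p ℚ.≤ r ℚ.* q → p ℚ.≤ q
ℚ*-cancel r 0<r = ℚ.*-cancelˡ-≤-pos r {{ℚ.positive 0<r}}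

ℚ*-cancel-≡ : ∀ r {p q} → 0ℚ ℚ.< r → r ℚ.* p ≡ r ℚ.* q → p ≡ q
ℚ*-cancel-≡ r 0<r eq = ℚ.≤-antisym (ℚ*-cancel r 0<r (ℚ.≤-reflexive eq)) (ℚ*-cancel r 0<r (ℚ.≤-reflexive (sym eq)))

-- Order and arithmetic of real numbers

Eventually : (ℕ → Set) → Set
Eventually P = ∃[ N ] ∀ n → N ℕ.≤ n → P n

ev-always : ∀ {P} → (∀ n → P n) → Eventually P
ev-always p = 0 , λ n _ → p n

ev-map : ∀ {P Q : ℕ → Set} → (∀ n → P n → Q n) → Eventually P → Eventually Q
ev-map f (N , p) = N , λ n N≤n → f n (p n N≤n)

ev-map₂ : ∀ {P Q R : ℕ → Set} → (∀ n → P n → Q n → R n) → Eventually P → Eventually Q → Eventually R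
ev-map₂ f (M , p) (N , q) = M ℕ.⊔ N , λ n le →
  f n (p n (ℕ.≤-trans (ℕ.m≤m⊔n M N) le)) (q n (ℕ.≤-trans (ℕ.m≤n⊔m M N) le))

ev-∃ : ∀ {P} → Eventually P → ∃ P
ev-∃ (N , p) = N , p N ℕ.≤-refl

∣∣<⇒ : ∀ {p q ε} → ℚ.∣ p ℚ.- q ∣ ℚ.< ε → p ℚ.≤ q ℚ.+ ε × q ℚ.≤ p ℚ.+ ε
∣∣<⇒ {p} {q} {ε} lt =
  ≤-by (gap (ℚ.≤-trans (p≤∣p∣ (p ℚ.- q)) (ℚ.<⇒≤ lt)))
       (solve 3 (λ p q e → q :+ e := p :+ (e :- (p :- q))) refl p q ε) ,
  ≤-by (gap (ℚ.≤-trans (-p≤∣p∣ (p ℚ.- q)) (ℚ.<⇒≤ lt)))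
       (solve 3 (λ p q e → p :+ e := q :+ (e :- (:- (p :- q)))) refl p q ε)

⇒∣∣≤ : ∀ {p q ε} → p ℚ.≤ q ℚ.+ ε → q ℚ.≤ p ℚ.+ ε → ℚ.∣ p ℚ.- q ∣ ℚ.≤ ε
⇒∣∣≤ {p} {q} {ε} p≤ q≤ = ∣∣≤
  (≤-by (gap p≤) (solve 3 (λ p q e → e := (p :- q) :+ ((q :+ e) :- p)) refl p q ε))
  (≤-by (gap q≤) (solve 3 (λ p q e → e := :- (p :- q) :+ ((p :+ e) :- q)) refl p q ε))

half< : ∀ ε → 0ℚ ℚ.< ε → ½ ℚ.* ε ℚ.< ε
half< ε ε>0 = <-by (0<* 0<½ ε>0) (solve 1 (λ e → e := con ½ :* e :+ con ½ :* e) refl ε)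

pointwise-≤ : ∀ {x y} → (∀ n → seq x n ℚ.≤ seq y n) → x ≤ y
pointwise-≤ le (ε , ε>0 , N , lt) = ℚ.<-irrefl refl
  (ℚ.<-≤-trans (<-by ε>0 refl) (ℚ.≤-trans (lt N ℕ.≤-refl) (le N)))

ev⇒≤ : ∀ {x y} → (∀ ε → 0ℚ ℚ.< ε → Eventually λ n → seq x n ℚ.≤ seq y n ℚ.+ ε) → x ≤ y
ev⇒≤ {x} {y} ev (ε , ε>0 , lt) =
  let n , a , b = ev-∃ (ev-map₂ (λ _ a b → a , b) lt (ev (½ ℚ.* ε) (0<* 0<½ ε>0)))
  in ℚ.<-irrefl refl (ℚ.<-≤-trans (ℚ.+-monoʳ-< (seq y n) (half< ε ε>0)) (ℚ.≤-trans a b))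

-- As `x ≤ y` is only the negation of `y < x`, the information comes from comparing the two
-- sequences at one index K beyond which both vary by less than δ = ε / 8. If x exceeds y by ε / 2
-- there, it exceeds y by ε / 4 from then on, which is `y < x`; otherwise the bound follows with ε /
-- 4 to spare.
≤⇒ev : ∀ {x y} → x ≤ y → ∀ ε → 0ℚ ℚ.< ε → Eventually λ n → seq x n ℚ.≤ seq y n ℚ.+ ε
≤⇒ev {x} {y} x≤y ε ε>0 with cauchy x (h 3 ℚ.* ε) (0<* (0<h 3) ε>0) | cauchy y (h 3 ℚ.* ε) (0<* (0<h 3) ε>0)
... | M , cx | N , cy = go
  where
  K = M ℕ.⊔ N
  δ = h 3 ℚ.* ε
  0≤δ : 0ℚ ℚ.≤ δ
  0≤δ = 0≤h 3 ⊠ ℚ.<⇒≤ ε>0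
  X : ∀ n → K ℕ.≤ n → seq x n ℚ.≤ seq x K ℚ.+ δ × seq x K ℚ.≤ seq x n ℚ.+ δ
  X n le = ∣∣<⇒ (cx n K (ℕ.≤-trans (ℕ.m≤m⊔n M N) le) (ℕ.m≤m⊔n M N))
  Y : ∀ n → K ℕ.≤ n → seq y n ℚ.≤ seq y K ℚ.+ δ × seq y K ℚ.≤ seq y n ℚ.+ δ
  Y n le = ∣∣<⇒ (cy n K (ℕ.≤-trans (ℕ.m≤n⊔m M N) le) (ℕ.m≤n⊔m M N))
  go : Eventually λ n → seq x n ℚ.≤ seq y n ℚ.+ ε
  go with ℚ.≤-total (seq x K) (seq y K ℚ.+ ½ ℚ.* ε)
  ... | inj₁ a = K , λ n le → ≤-by (gap a ⊞ gap (proj₁ (X n le)) ⊞ gap (proj₂ (Y n le)) ⊞ 0≤δ ⊞ 0≤δ)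
    (solve 5 (λ xn xk yn yk e → yn :+ e := xn :+ ((yk :+ con ½ :* e :- xk) :+ (xk :+ con (h 3) :* e :- xn)
      :+ (yn :+ con (h 3) :* e :- yk) :+ con (h 3) :* e :+ con (h 3) :* e)) refl (seq x n) (seq x K) (seq y n) (seq y K) ε)
  ... | inj₂ a = ⊥-elim (x≤y (δ ℚ.+ δ , 0<+ (0<* (0<h 3) ε>0) 0≤δ , K , λ n le →
    ≤-by (gap a ⊞ gap (proj₂ (X n le)) ⊞ gap (proj₁ (Y n le)))
    (solve 5 (λ xn xk yn yk e → xn := (yn :+ (con (h 3) :* e :+ con (h 3) :* e)) :+ ((xk :- (yk :+ con ½ :* e)) :+ (xn :+ con (h 3) :* e :- xk)
      :+ (yk :+ con (h 3) :* e :- yn))) refl (seq x n) (seq x K) (seq y n) (seq y K) ε)))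

bounded : ∀ x → ∃[ B ] Eventually λ n → ℚ.∣ seq x n ∣ ℚ.≤ ι B
bounded x =
  let N , c = cauchy x 1ℚ 0<1
      B , le = archimedean (ℚ.∣ seq x N ∣ ℚ.+ 1ℚ)
  in B , N , λ n N≤n → let a , b = ∣∣<⇒ {seq x n} {seq x N} (c n N N≤n ℕ.≤-refl) in
    ℚ.≤-trans (∣∣≤
      (≤-by (gap a ⊞ gap (p≤∣p∣ (seq x N)))
        (solve 3 (λ p q r → r :+ con 1ℚ := p :+ ((q :+ con 1ℚ :- p) :+ (r :- q))) refl (seq x n) (seq x N) ℚ.∣ seq x N ∣))
      (≤-by (gap b ⊞ gap (-p≤∣p∣ (seq x N)))
        (solve 3 (λ p q r → r :+ con 1ℚ := :- p :+ ((p :+ con 1ℚ :- q) :+ (r :- (:- q)))) refl (seq x n) (seq x N) ℚ.∣ seq x N ∣))) le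

pointwise-≈ : ∀ {x y} → (∀ n → seq x n ≡ seq y n) → x ≈ y
pointwise-≈ {x} {y} eq ε ε>0 = ev-always λ n →
  subst (λ d → ℚ.∣ d ∣ ℚ.< ε) (sym (trans (cong (ℚ._- seq y n) (eq n)) (ℚ.+-inverseʳ (seq y n)))) ε>0

≈⇒≤ : ∀ {x y} → x ≈ y → x ≤ y
≈⇒≤ {x} {y} eq = ev⇒≤ {x} {y} λ ε ε>0 → ev-map (λ n a → proj₁ (∣∣<⇒ {seq x n} {seq y n} a)) (eq ε ε>0)

≈⇒≥ : ∀ {x y} → x ≈ y → y ≤ x
≈⇒≥ {x} {y} eq = ev⇒≤ {y} {x} λ ε ε>0 → ev-map (λ n a → proj₂ (∣∣<⇒ {seq x n} {seq y n} a)) (eq ε ε>0)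

≤-antisym : ∀ {x y} → x ≤ y → y ≤ x → x ≈ y
≤-antisym {x} {y} x≤y y≤x ε ε>0 = ev-map₂
  (λ n a b → ℚ.≤-<-trans (⇒∣∣≤ {seq x n} {seq y n} a b) (half< ε ε>0))
  (≤⇒ev {x} {y} x≤y (½ ℚ.* ε) (0<* 0<½ ε>0)) (≤⇒ev {y} {x} y≤x (½ ℚ.* ε) (0<* 0<½ ε>0))

0≤gap : ∀ {x y} → x ≤ y → 0ℝ ≤ y - x
0≤gap {x} {y} x≤y = ev⇒≤ {0ℝ} {y - x} λ ε ε>0 → ev-map
  (λ n a → ≤-by (gap a) (solve 3 (λ x y e → (y :+ :- x) :+ e := con 0ℚ :+ (y :+ e :- x)) refl (seq x n) (seq y n) ε))
  (≤⇒ev {x} {y} x≤y ε ε>0)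

0<gap : ∀ {x y} → x < y → 0ℝ < y - x
0<gap {x} {y} (ε , ε>0 , ev) = ε , ε>0 , ev-map
  (λ n a → ≤-by (gap a) (solve 3 (λ x y e → y :+ :- x := (con 0ℚ :+ e) :+ (y :- (x :+ e))) refl (seq x n) (seq y n) ε)) ev

-- The counterpart of `≤-by` for real numbers. The identity y = x + d is demanded termwise of the
-- representing sequences, so the solver for ℚ proves it.
≤-cert : ∀ {x y d} → 0ℝ ≤ d → (∀ n → seq y n ≡ seq x n ℚ.+ seq d n) → x ≤ y
≤-cert {x} {y} {d} 0≤d eq = ev⇒≤ {x} {y} λ ε ε>0 → ev-map
  (λ n a → ≤-by (gap a) (trans (cong (ℚ._+ ε) (eq n))
    (solve 3 (λ x d e → x :+ d :+ e := x :+ (d :+ e :- con 0ℚ)) refl (seq x n) (seq d n) ε)))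
  (≤⇒ev {0ℝ} {d} 0≤d ε ε>0)

<-cert : ∀ {x y d} → 0ℝ < d → (∀ n → seq y n ≡ seq x n ℚ.+ seq d n) → x < y
<-cert {x} {y} {d} (ε , ε>0 , ev) eq = ε , ε>0 , ev-map
  (λ n a → ≤-by (gap a) (trans (eq n)
    (solve 3 (λ x d e → x :+ d := x :+ e :+ (d :- (con 0ℚ :+ e))) refl (seq x n) (seq d n) ε))) ev

0≤-+ : ∀ {x y} → 0ℝ ≤ x → 0ℝ ≤ y → 0ℝ ≤ x + y
0≤-+ {x} {y} 0≤x 0≤y = ev⇒≤ {0ℝ} {x + y} λ ε ε>0 → ev-map₂
  (λ n a b → ≤-by (gap a ⊞ gap b) (solve 3 (λ x y e → x :+ y :+ e := con 0ℚ :+ ((x :+ con ½ :* e :- con 0ℚ) :+ (y :+ con ½ :* e :- con 0ℚ)))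
    refl (seq x n) (seq y n) ε))
  (≤⇒ev {0ℝ} {x} 0≤x (½ ℚ.* ε) (0<* 0<½ ε>0)) (≤⇒ev {0ℝ} {y} 0≤y (½ ℚ.* ε) (0<* 0<½ ε>0))

0<-+ : ∀ {x y} → 0ℝ < x → 0ℝ ≤ y → 0ℝ < x + y
0<-+ {x} {y} (ε , ε>0 , ev) 0≤y = ½ ℚ.* ε , 0<* 0<½ ε>0 , ev-map₂
  (λ n a b → ≤-by (gap a ⊞ gap b) (solve 3 (λ x y e → x :+ y := con 0ℚ :+ con ½ :* e :+ ((x :- (con 0ℚ :+ e)) :+ (y :+ con ½ :* e :- con 0ℚ)))
    refl (seq x n) (seq y n) ε))
  ev (≤⇒ev {0ℝ} {y} 0≤y (½ ℚ.* ε) (0<* 0<½ ε>0))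

0<-* : ∀ {x y} → 0ℝ < x → 0ℝ < y → 0ℝ < x * y
0<-* {x} {y} (ε , ε>0 , ev) (δ , δ>0 , ev′) = ε ℚ.* δ , 0<* ε>0 δ>0 , ev-map₂
  (λ n a b → ≤-by (gap a ⊠ gap b ⊞ ℚ.<⇒≤ ε>0 ⊠ gap b ⊞ gap a ⊠ ℚ.<⇒≤ δ>0)
    (solve 4 (λ x y e d → x :* y := con 0ℚ :+ e :* d :+ ((x :- (con 0ℚ :+ e)) :* (y :- (con 0ℚ :+ d)) :+ e :* (y :- (con 0ℚ :+ d)) :+ (x :- (con 0ℚ :+ e)) :* d))
    refl (seq x n) (seq y n) ε δ)) ev ev′

-- The tolerance for products: when |x| ≤ A and |y| ≤ B, errors of δ ≤ 1 in both factors change x y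
-- by at most (A + B + 1) δ.
small : ∀ A B ε → 0ℚ ℚ.< ε → ∃[ δ ] 0ℚ ℚ.< δ × δ ℚ.≤ 1ℚ × (ι A ℚ.+ ι B ℚ.+ 1ℚ) ℚ.* δ ℚ.≤ ε
small A B ε ε>0 =
  let C , C>0 , eq = reciprocal (ι A ℚ.+ ι B ℚ.+ 1ℚ) (ℚ.+-mono-≤-< (0≤ι A ⊞ 0≤ι B) 0<1)
      k , hk≤ = h-null (C ℚ.* ε) (0<* C>0 ε>0)
  in h k , 0<h k , h-mono {0} {k} ℕ.z≤n ,
     ℚ.≤-trans (ℚ*-mono D (0≤ι A ⊞ 0≤ι B ⊞ 0≤1) hk≤)
       (ℚ.≤-reflexive (trans (sym (ℚ.*-assoc D C ε)) (trans (cong (ℚ._* ε) eq) (ℚ.*-identityˡ ε))))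
  where
  D = ι A ℚ.+ ι B ℚ.+ 1ℚ

0≤-* : ∀ {x y} → 0ℝ ≤ x → 0ℝ ≤ y → 0ℝ ≤ x * y
0≤-* {x} {y} 0≤x 0≤y = ev⇒≤ {0ℝ} {x * y} λ ε ε>0 →
  let A , evA = bounded x
      B , evB = bounded y
      δ , δ>0 , δ≤1 , Cδ≤ε = small A B ε ε>0
      0≤δ = ℚ.<⇒≤ δ>0
  in ev-map₂ (λ n (a , A≤) (b , B≤) → ≤-by
      (gap a ⊠ gap b ⊞ 0≤δ ⊠ gap (ℚ.≤-trans (p≤∣p∣ (seq x n)) A≤) ⊞ 0≤δ ⊠ gap (ℚ.≤-trans (p≤∣p∣ (seq y n)) B≤) ⊞ 0≤δ ⊠ gap δ≤1 ⊞ gap Cδ≤ε)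
      (solve 6 (λ x y d A B e → x :* y :+ e := con 0ℚ :+ ((x :+ d :- con 0ℚ) :* (y :+ d :- con 0ℚ) :+ d :* (A :- x) :+ d :* (B :- y)
         :+ d :* (con 1ℚ :- d) :+ (e :- (A :+ B :+ con 1ℚ) :* d))) refl (seq x n) (seq y n) δ (ι A) (ι B) ε))
     (ev-map₂ (λ _ → _,_) (≤⇒ev {0ℝ} {x} 0≤x δ δ>0) evA) (ev-map₂ (λ _ → _,_) (≤⇒ev {0ℝ} {y} 0≤y δ δ>0) evB)

≤-refl : ∀ {x} → x ≤ x
≤-refl {x} = pointwise-≤ {x} {x} λ n → ℚ.≤-refl

≤-trans : ∀ {x y z} → x ≤ y → y ≤ z → x ≤ z
≤-trans {x} {y} {z} a b = ≤-cert {x} {z} {(y - x) + (z - y)} (0≤-+ {y - x} {z - y} (0≤gap {x} {y} a) (0≤gap {y} {z} b))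
  λ n → solve 3 (λ x y z → z := x :+ ((y :+ :- x) :+ (z :+ :- y))) refl (seq x n) (seq y n) (seq z n)

<-≤-trans : ∀ {x y z} → x < y → y ≤ z → x < z
<-≤-trans {x} {y} {z} a b = <-cert {x} {z} {(y - x) + (z - y)} (0<-+ {y - x} {z - y} (0<gap {x} {y} a) (0≤gap {y} {z} b))
  λ n → solve 3 (λ x y z → z := x :+ ((y :+ :- x) :+ (z :+ :- y))) refl (seq x n) (seq y n) (seq z n)

≤-<-trans : ∀ {x y z} → x ≤ y → y < z → x < z
≤-<-trans {x} {y} {z} a b = <-cert {x} {z} {(z - y) + (y - x)} (0<-+ {z - y} {y - x} (0<gap {y} {z} b) (0≤gap {x} {y} a))
  λ n → solve 3 (λ x y z → z := x :+ ((z :+ :- y) :+ (y :+ :- x))) refl (seq x n) (seq y n) (seq z n)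

<-irrefl : ∀ {x} → ¬ x < x
<-irrefl {x} = ≤-refl {x}

<⇒≤ : ∀ {x y} → x < y → x ≤ y
<⇒≤ {x} {y} x<y y<x = <-irrefl {x} (<-≤-trans {x} {y} {x} x<y (pre y<x))
  where
  pre : y < x → y ≤ x
  pre (ε , ε>0 , ev) = ev⇒≤ {y} {x} λ η η>0 → ev-map
    (λ n a → ≤-by (gap a ⊞ ℚ.<⇒≤ ε>0 ⊞ ℚ.<⇒≤ η>0) (solve 4 (λ x y e f → x :+ f := y :+ ((x :- (y :+ e)) :+ e :+ f)) refl (seq x n) (seq y n) ε η)) ev

≈-sym : ∀ {x y} → x ≈ y → y ≈ x
≈-sym {x} {y} e = ≤-antisym {y} {x} (≈⇒≥ {x} {y} e) (≈⇒≤ {x} {y} e)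

≈-trans : ∀ {x y z} → x ≈ y → y ≈ z → x ≈ z
≈-trans {x} {y} {z} a b = ≤-antisym {x} {z} (≤-trans {x} {y} {z} (≈⇒≤ {x} {y} a) (≈⇒≤ {y} {z} b))
  (≤-trans {z} {y} {x} (≈⇒≥ {y} {z} b) (≈⇒≥ {x} {y} a))

+-mono-≤ : ∀ {x y z w} → x ≤ y → z ≤ w → x + z ≤ y + w
+-mono-≤ {x} {y} {z} {w} a b = ≤-cert {x + z} {y + w} {(y - x) + (w - z)} (0≤-+ {y - x} {w - z} (0≤gap {x} {y} a) (0≤gap {z} {w} b))
  λ n → solve 4 (λ x y z w → y :+ w := x :+ z :+ ((y :+ :- x) :+ (w :+ :- z))) refl (seq x n) (seq y n) (seq z n) (seq w n)

neg-mono-≤ : ∀ {x y} → x ≤ y → - y ≤ - x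
neg-mono-≤ {x} {y} a = ≤-cert { - y} { - x} {y - x} (0≤gap {x} {y} a)
  λ n → solve 2 (λ x y → :- x := :- y :+ (y :+ :- x)) refl (seq x n) (seq y n)

*-monoˡ-≤ : ∀ {z x y} → 0ℝ ≤ z → x ≤ y → z * x ≤ z * y
*-monoˡ-≤ {z} {x} {y} 0≤z a = ≤-cert {z * x} {z * y} {z * (y - x)} (0≤-* {z} {y - x} 0≤z (0≤gap {x} {y} a))
  λ n → solve 3 (λ x y z → z :* y := z :* x :+ (z :* (y :+ :- x))) refl (seq x n) (seq y n) (seq z n)

*-monoʳ-≤ : ∀ {z x y} → 0ℝ ≤ z → x ≤ y → x * z ≤ y * z
*-monoʳ-≤ {z} {x} {y} 0≤z a = ≤-cert {x * z} {y * z} {z * (y - x)} (0≤-* {z} {y - x} 0≤z (0≤gap {x} {y} a))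
  λ n → solve 3 (λ x y z → y :* z := x :* z :+ (z :* (y :+ :- x))) refl (seq x n) (seq y n) (seq z n)

*-mono-≤ : ∀ {x y z w} → 0ℝ ≤ y → 0ℝ ≤ z → x ≤ y → z ≤ w → x * z ≤ y * w
*-mono-≤ {x} {y} {z} {w} 0≤y 0≤z a b =
  ≤-trans {x * z} {y * z} {y * w} (*-monoʳ-≤ {z} {x} {y} 0≤z a) (*-monoˡ-≤ {y} {z} {w} 0≤y b)

+-cong : ∀ {x y z w} → x ≈ y → z ≈ w → x + z ≈ y + w
+-cong {x} {y} {z} {w} a b = ≤-antisym {x + z} {y + w} (+-mono-≤ {x} {y} {z} {w} (≈⇒≤ {x} {y} a) (≈⇒≤ {z} {w} b))
  (+-mono-≤ {y} {x} {w} {z} (≈⇒≥ {x} {y} a) (≈⇒≥ {z} {w} b))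

fromℚ-mono-≤ : ∀ {p q} → p ℚ.≤ q → fromℚ p ≤ fromℚ q
fromℚ-mono-≤ {p} {q} le = pointwise-≤ {fromℚ p} {fromℚ q} λ _ → le

fromℚ-mono-< : ∀ {p q} → p ℚ.< q → fromℚ p < fromℚ q
fromℚ-mono-< {p} {q} lt = q ℚ.- p , gap< lt , ev-always λ _ → ℚ.≤-reflexive (solve 2 (λ p q → p :+ (q :- p) := q) refl p q)

fromℚ-cancel-< : ∀ {p q} → fromℚ p < fromℚ q → p ℚ.< q
fromℚ-cancel-< {p} {q} (ε , ε>0 , N , le) = ℚ.<-≤-trans (<-by ε>0 refl) (le N ℕ.≤-refl)

upper-bound : ∀ x → ∃[ B ] x ≤ fromℕ B
upper-bound x = let B , ev = bounded x in B , ev⇒≤ {x} {fromℕ B} λ ε ε>0 → ev-map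
  (λ n a → ℚ.≤-trans (ℚ.≤-trans (p≤∣p∣ (seq x n)) a) (≤-by (ℚ.<⇒≤ ε>0) refl)) ev

lower-bound : ∀ x → ∃[ B ] - fromℕ B ≤ x
lower-bound x = let B , ev = bounded x in B , ev⇒≤ { - fromℕ B} {x} λ ε ε>0 → ev-map
  (λ n a → ≤-by (gap (ℚ.≤-trans (-p≤∣p∣ (seq x n)) a) ⊞ ℚ.<⇒≤ ε>0)
     (solve 3 (λ x b e → x :+ e := :- b :+ ((b :- (:- x)) :+ e)) refl (seq x n) (ι B) ε)) ev

<⇒+ε≤ : ∀ {x y} → x < y → ∃[ ε ] 0ℚ ℚ.< ε × x + fromℚ ε ≤ y
<⇒+ε≤ {x} {y} (ε , ε>0 , ev) = ε , ε>0 , ev⇒≤ {x + fromℚ ε} {y} λ η η>0 →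
  ev-map (λ n a → ℚ.≤-trans a (≤-by (ℚ.<⇒≤ η>0) refl)) ev

≤-+ε : ∀ {x y} → (∀ ε → 0ℚ ℚ.< ε → x ≤ y + fromℚ ε) → x ≤ y
≤-+ε {x} {y} f = ev⇒≤ {x} {y} λ ε ε>0 → ev-map
  (λ n a → ℚ.≤-trans a (ℚ.≤-reflexive (solve 2 (λ y e → y :+ con ½ :* e :+ con ½ :* e := y :+ e) refl (seq y n) ε)))
  (≤⇒ev {x} {y + fromℚ (½ ℚ.* ε)} (f (½ ℚ.* ε) (0<* 0<½ ε>0)) (½ ℚ.* ε) (0<* 0<½ ε>0))

approx : ∀ x ε → 0ℚ ℚ.< ε → ∃[ r ] x ≤ fromℚ r × fromℚ r ≤ x + fromℚ ε
approx x ε ε>0 =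
  let N , c = cauchy x (½ ℚ.* ε) (0<* 0<½ ε>0)
      r = seq x N ℚ.+ ½ ℚ.* ε
  in r ,
     ev⇒≤ {x} {fromℚ r} (λ η η>0 → N , λ n le → ℚ.≤-trans (proj₁ (∣∣<⇒ {seq x n} {seq x N} (c n N le ℕ.≤-refl))) (≤-by (ℚ.<⇒≤ η>0) refl)) ,
     ev⇒≤ {fromℚ r} {x + fromℚ ε} λ η η>0 → N , λ n le →
       ≤-by (gap (proj₂ (∣∣<⇒ {seq x n} {seq x N} (c n N le ℕ.≤-refl))) ⊞ ℚ.<⇒≤ η>0)
         (solve 4 (λ a b e f → a :+ e :+ f := b :+ con ½ :* e :+ ((a :+ con ½ :* e :- b) :+ f)) refl (seq x n) (seq x N) ε η)

x≤∣x∣ : ∀ x → x ≤ ∣ x ∣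
x≤∣x∣ x = pointwise-≤ {x} {∣ x ∣} λ n → p≤∣p∣ (seq x n)

-x≤∣x∣ : ∀ x → - x ≤ ∣ x ∣
-x≤∣x∣ x = pointwise-≤ { - x} {∣ x ∣} λ n → -p≤∣p∣ (seq x n)

∣∣-least : ∀ {x y} → x ≤ y → - x ≤ y → ∣ x ∣ ≤ y
∣∣-least {x} {y} a b = ev⇒≤ {∣ x ∣} {y} λ ε ε>0 → ev-map₂ (λ n p q → ∣∣≤ p q) (≤⇒ev {x} {y} a ε ε>0) (≤⇒ev { - x} {y} b ε ε>0)

*-inverse-/ : ∀ n .{{_ : ℕ.NonZero n}} → ι n ℚ.* (+ 1 ℚ./ n) ≡ 1ℚ
*-inverse-/ (suc d) = ℚ.toℚᵘ-injective (begin
  toℚᵘ (ι (suc d) ℚ.* (+ 1 ℚ./ suc d))            ≈⟨ ℚ.toℚᵘ-homo-* (ι (suc d)) (+ 1 ℚ./ suc d) ⟩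
  toℚᵘ (ι (suc d)) ℚᵘ.* toℚᵘ (+ 1 ℚ./ suc d)      ≈⟨ ℚᵘ.*-cong (toℚᵘ-κ (+ suc d)) (ℚ.toℚᵘ-fromℚᵘ (ℚᵘ.mkℚᵘ (+ 1) d)) ⟩
  ℚᵘ.mkℚᵘ (+ suc d) 0 ℚᵘ.* ℚᵘ.mkℚᵘ (+ 1) d       ≈⟨ ℚᵘ.*≡* (trans (ℤ.*-identityʳ _) (trans (ℤ.*-identityʳ (+ suc d))
                                                     (sym (trans (ℤ.*-identityˡ _) (cong +_ (ℕ.*-identityˡ (suc d))))))) ⟩
  ℚᵘ.1ℚᵘ                                           ∎)
  where open ℚᵘ.≃-Reasoning

0<1/ : ∀ n .{{_ : ℕ.NonZero n}} → 0ℚ ℚ.< + 1 ℚ./ n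
0<1/ n = ℚ.positive⁻¹ _ {{ℚ.normalize-pos 1 n}}

ι-suc : ∀ n → ι (suc n) ≡ 1ℚ ℚ.+ ι n
ι-suc = ι-+ 1

0<ι : ∀ n → 0ℚ ℚ.< ι (suc n)
0<ι n = ι-mono-< {0} {suc n} (ℕ.s≤s ℕ.z≤n)

-- Finite sums of rationals

∑ : ℕ → (ℕ → ℚ) → ℚ
∑ zero    f = 0ℚ
∑ (suc n) f = ∑ n f ℚ.+ f n

∑-cong : ∀ n {f g} → (∀ i → i ℕ.< n → f i ≡ g i) → ∑ n f ≡ ∑ n g
∑-cong zero    e = refl
∑-cong (suc n) e = cong₂ ℚ._+_ (∑-cong n (λ i i<n → e i (ℕ.m<n⇒m<1+n i<n))) (e n ℕ.≤-refl)

∑-+ : ∀ n f g → ∑ n (λ i → f i ℚ.+ g i) ≡ ∑ n f ℚ.+ ∑ n g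
∑-+ zero    f g = refl
∑-+ (suc n) f g = trans (cong (ℚ._+ (f n ℚ.+ g n)) (∑-+ n f g))
  (solve 4 (λ a b c d → (a :+ b) :+ (c :+ d) := (a :+ c) :+ (b :+ d)) refl (∑ n f) (∑ n g) (f n) (g n))

∑-* : ∀ n c f → ∑ n (λ i → c ℚ.* f i) ≡ c ℚ.* ∑ n f
∑-* zero    c f = sym (ℚ.*-zeroʳ c)
∑-* (suc n) c f = trans (cong (ℚ._+ c ℚ.* f n) (∑-* n c f)) (sym (ℚ.*-distribˡ-+ c (∑ n f) (f n)))

∑-head : ∀ n f → ∑ (suc n) f ≡ f 0 ℚ.+ ∑ n (λ i → f (suc i))
∑-head zero    f = trans (ℚ.+-identityˡ (f 0)) (sym (ℚ.+-identityʳ (f 0)))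
∑-head (suc n) f = trans (cong (ℚ._+ f (suc n)) (∑-head n f)) (ℚ.+-assoc (f 0) (∑ n (λ i → f (suc i))) (f (suc n)))

∑-mono : ∀ n {f g} → (∀ i → i ℕ.< n → f i ℚ.≤ g i) → ∑ n f ℚ.≤ ∑ n g
∑-mono zero    le = ℚ.≤-refl
∑-mono (suc n) le = ℚ.+-mono-≤ (∑-mono n (λ i i<n → le i (ℕ.m<n⇒m<1+n i<n))) (le n ℕ.≤-refl)

∑-nonneg : ∀ n {f} → (∀ i → 0ℚ ℚ.≤ f i) → 0ℚ ℚ.≤ ∑ n f
∑-nonneg zero    0≤f = ℚ.≤-refl
∑-nonneg (suc n) 0≤f = ∑-nonneg n 0≤f ⊞ 0≤f n

∑-∣∣ : ∀ n f → ℚ.∣ ∑ n f ∣ ℚ.≤ ∑ n (λ i → ℚ.∣ f i ∣)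
∑-∣∣ zero    f = ℚ.≤-refl
∑-∣∣ (suc n) f = ℚ.≤-trans (ℚ.∣p+q∣≤∣p∣+∣q∣ (∑ n f) (f n)) (ℚ.+-monoˡ-≤ ℚ.∣ f n ∣ (∑-∣∣ n f))

-- The comparison test in Cauchy form. Its main use is with g the exponential series at a natural
-- number B ≥ |x|, where the tails can be computed.
∑-tail : ∀ {f g} → (∀ i → ℚ.∣ f i ∣ ℚ.≤ g i) → ∀ m k → ℚ.∣ ∑ (m ℕ.+ k) f ℚ.- ∑ m f ∣ ℚ.≤ ∑ (m ℕ.+ k) g ℚ.- ∑ m g
∑-tail {f} {g} le m zero rewrite ℕ.+-identityʳ m | ℚ.+-inverseʳ (∑ m f) | ℚ.+-inverseʳ (∑ m g) = ℚ.≤-refl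
∑-tail {f} {g} le m (suc k) rewrite ℕ.+-suc m k = begin
  ℚ.∣ ∑ (m ℕ.+ k) f ℚ.+ f (m ℕ.+ k) ℚ.- ∑ m f ∣          ≡⟨ cong ℚ.∣_∣ (swap (∑ (m ℕ.+ k) f) (f (m ℕ.+ k)) (∑ m f)) ⟩
  ℚ.∣ (∑ (m ℕ.+ k) f ℚ.- ∑ m f) ℚ.+ f (m ℕ.+ k) ∣        ≤⟨ ℚ.∣p+q∣≤∣p∣+∣q∣ (∑ (m ℕ.+ k) f ℚ.- ∑ m f) (f (m ℕ.+ k)) ⟩
  ℚ.∣ ∑ (m ℕ.+ k) f ℚ.- ∑ m f ∣ ℚ.+ ℚ.∣ f (m ℕ.+ k) ∣    ≤⟨ ℚ.+-mono-≤ (∑-tail le m k) (le (m ℕ.+ k)) ⟩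
  (∑ (m ℕ.+ k) g ℚ.- ∑ m g) ℚ.+ g (m ℕ.+ k)              ≡⟨ sym (swap (∑ (m ℕ.+ k) g) (g (m ℕ.+ k)) (∑ m g)) ⟩
  ∑ (m ℕ.+ k) g ℚ.+ g (m ℕ.+ k) ℚ.- ∑ m g                ∎
  where
  open ℚ.≤-Reasoning
  swap : ∀ a b c → a ℚ.+ b ℚ.- c ≡ (a ℚ.- c) ℚ.+ b
  swap = solve 3 (λ a b c → a :+ b :- c := (a :- c) :+ b) refl

∑-tail-≤ : ∀ {f g} → (∀ i → ℚ.∣ f i ∣ ℚ.≤ g i) → ∀ {m n} → m ℕ.≤ n → ℚ.∣ ∑ n f ℚ.- ∑ m f ∣ ℚ.≤ ∑ n g ℚ.- ∑ m g
∑-tail-≤ {f} {g} le {m} {n} m≤n = subst (λ k → ℚ.∣ ∑ k f ℚ.- ∑ m f ∣ ℚ.≤ ∑ k g ℚ.- ∑ m g)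
  (ℕ.m+[n∸m]≡n m≤n) (∑-tail le m (n ℕ.∸ m))

∑-mono-length : ∀ {f} → (∀ i → 0ℚ ℚ.≤ f i) → ∀ {m n} → m ℕ.≤ n → ∑ m f ℚ.≤ ∑ n f
∑-mono-length {f} 0≤f {m} {n} m≤n = ≤-by
  (ℚ.≤-trans (ℚ.0≤∣p∣ (∑ n f ℚ.- ∑ m f)) (∑-tail-≤ (λ i → ℚ.≤-reflexive (ℚ.0≤p⇒∣p∣≡p (0≤f i))) m≤n))
  (solve 2 (λ a b → a := b :+ (a :- b)) refl (∑ n f) (∑ m f))

-- The exponential series over ℚ

qpow : ℚ → ℕ → ℚ
qpow x zero    = 1ℚ
qpow x (suc n) = x ℚ.* qpow x n

1/_! : ℕ → ℚ
1/ k ! = ℚ._/_ (+ 1) (k !) {{k ℕ.!≢0}}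

T : ℚ → ℕ → ℚ
T x k = qpow x k ℚ.* 1/ k !

E : ℚ → ℕ → ℚ
E x n = ∑ n (T x)

ι-1/! : ∀ k → ι (suc k) ℚ.* 1/ suc k ! ≡ 1/ k !
ι-1/! k = begin
  a ℚ.* b                     ≡⟨ sym (ℚ.*-identityˡ (a ℚ.* b)) ⟩
  1ℚ ℚ.* (a ℚ.* b)            ≡⟨ cong (ℚ._* (a ℚ.* b)) (sym c*d) ⟩
  (c ℚ.* d) ℚ.* (a ℚ.* b)     ≡⟨ solve 4 (λ a b c d → (c :* d) :* (a :* b) := d :* ((a :* c) :* b)) refl a b c d ⟩
  d ℚ.* ((a ℚ.* c) ℚ.* b)     ≡⟨ cong (λ z → d ℚ.* (z ℚ.* b)) (sym (ι-* (suc k) (k !))) ⟩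
  d ℚ.* (ι (suc k !) ℚ.* b)   ≡⟨ cong (d ℚ.*_) (*-inverse-/ (suc k !) {{suc k ℕ.!≢0}}) ⟩
  d ℚ.* 1ℚ                    ≡⟨ ℚ.*-identityʳ d ⟩
  d                           ∎
  where
  open ≡-Reasoning
  a = ι (suc k)
  b = 1/ suc k !
  c = ι (k !)
  d = 1/ k !
  c*d : c ℚ.* d ≡ 1ℚ
  c*d = *-inverse-/ (k !) {{k ℕ.!≢0}}

-- This recurrence carries what the binomial theorem, the decay of the terms and the Lipschitz bound
-- need, so that none of them has to handle factorials.
T-suc : ∀ x k → ι (suc k) ℚ.* T x (suc k) ≡ x ℚ.* T x k
T-suc x k = trans (solve 4 (λ a x p b → a :* ((x :* p) :* b) := x :* (p :* (a :* b))) refl (ι (suc k)) x (qpow x k) (1/ suc k !))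
  (cong (λ z → x ℚ.* (qpow x k ℚ.* z)) (ι-1/! k))

0≤1/! : ∀ k → 0ℚ ℚ.≤ 1/ k !
0≤1/! k = ℚ.<⇒≤ (0<1/ (k !) {{k ℕ.!≢0}})

qpow-nonneg : ∀ {x} → 0ℚ ℚ.≤ x → ∀ k → 0ℚ ℚ.≤ qpow x k
qpow-nonneg 0≤x zero    = 0≤1
qpow-nonneg 0≤x (suc k) = 0≤x ⊠ qpow-nonneg 0≤x k

T-nonneg : ∀ {x} → 0ℚ ℚ.≤ x → ∀ k → 0ℚ ℚ.≤ T x k
T-nonneg 0≤x k = qpow-nonneg 0≤x k ⊠ 0≤1/! k

qpow-∣∣ : ∀ x b → ℚ.∣ x ∣ ℚ.≤ b → ∀ k → ℚ.∣ qpow x k ∣ ℚ.≤ qpow b k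
qpow-∣∣ x b le zero    = ℚ.≤-refl
qpow-∣∣ x b le (suc k) = begin
  ℚ.∣ x ℚ.* qpow x k ∣          ≡⟨ ℚ.∣p*q∣≡∣p∣*∣q∣ x (qpow x k) ⟩
  ℚ.∣ x ∣ ℚ.* ℚ.∣ qpow x k ∣    ≤⟨ ℚ*-mono ℚ.∣ x ∣ (ℚ.0≤∣p∣ x) (qpow-∣∣ x b le k) ⟩
  ℚ.∣ x ∣ ℚ.* qpow b k          ≤⟨ ℚ.*-monoʳ-≤-nonNeg (qpow b k) {{ℚ.nonNegative (qpow-nonneg (ℚ.≤-trans (ℚ.0≤∣p∣ x) le) k)}} le ⟩
  b ℚ.* qpow b k                ∎
  where open ℚ.≤-Reasoning

T-∣∣ : ∀ {x b} → ℚ.∣ x ∣ ℚ.≤ b → ∀ k → ℚ.∣ T x k ∣ ℚ.≤ T b k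
T-∣∣ {x} {b} le k = begin
  ℚ.∣ qpow x k ℚ.* 1/ k ! ∣          ≡⟨ ℚ.∣p*q∣≡∣p∣*∣q∣ (qpow x k) (1/ k !) ⟩
  ℚ.∣ qpow x k ∣ ℚ.* ℚ.∣ 1/ k ! ∣    ≡⟨ cong (ℚ.∣ qpow x k ∣ ℚ.*_) (ℚ.0≤p⇒∣p∣≡p (0≤1/! k)) ⟩
  ℚ.∣ qpow x k ∣ ℚ.* 1/ k !          ≤⟨ ℚ.*-monoʳ-≤-nonNeg (1/ k !) {{ℚ.nonNegative (0≤1/! k)}} (qpow-∣∣ x b le k) ⟩
  qpow b k ℚ.* 1/ k !                ∎
  where open ℚ.≤-Reasoning

-- Both factors of ι (n + 1) = ι i + ι (n + 1 - i) are absorbed by T-suc.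
T-binomial : ∀ x y n → ∑ (suc n) (λ i → T x i ℚ.* T y (n ℕ.∸ i)) ≡ T (x ℚ.+ y) n
T-binomial x y zero    = refl
T-binomial x y (suc n) = ℚ*-cancel-≡ (ι (suc n)) (0<ι n) (begin
  ι (suc n) ℚ.* ∑ (suc (suc n)) f
    ≡⟨ sym (∑-* (suc (suc n)) (ι (suc n)) f) ⟩
  ∑ (suc (suc n)) (λ i → ι (suc n) ℚ.* f i)
    ≡⟨ ∑-cong (suc (suc n)) (λ i i<2+n → split i (ℕ.≤-pred i<2+n)) ⟩
  ∑ (suc (suc n)) (λ i → g₁ i ℚ.+ g₂ i)
    ≡⟨ ∑-+ (suc (suc n)) g₁ g₂ ⟩
  ∑ (suc (suc n)) g₁ ℚ.+ ∑ (suc (suc n)) g₂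
    ≡⟨ cong₂ ℚ._+_ first second ⟩
  x ℚ.* ∑ (suc n) c ℚ.+ y ℚ.* ∑ (suc n) c
    ≡⟨ sym (ℚ.*-distribʳ-+ (∑ (suc n) c) x y) ⟩
  (x ℚ.+ y) ℚ.* ∑ (suc n) c
    ≡⟨ cong ((x ℚ.+ y) ℚ.*_) (T-binomial x y n) ⟩
  (x ℚ.+ y) ℚ.* T (x ℚ.+ y) n
    ≡⟨ sym (T-suc (x ℚ.+ y) n) ⟩
  ι (suc n) ℚ.* T (x ℚ.+ y) (suc n) ∎)
  where
  open ≡-Reasoning
  f g₁ g₂ c : ℕ → ℚ
  f i  = T x i ℚ.* T y (suc n ℕ.∸ i)
  g₁ i = (ι i ℚ.* T x i) ℚ.* T y (suc n ℕ.∸ i)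
  g₂ i = T x i ℚ.* (ι (suc n ℕ.∸ i) ℚ.* T y (suc n ℕ.∸ i))
  c i  = T x i ℚ.* T y (n ℕ.∸ i)
  split : ∀ i → i ℕ.≤ suc n → ι (suc n) ℚ.* f i ≡ g₁ i ℚ.+ g₂ i
  split i i≤ = trans (cong (ℚ._* f i) (trans (cong ι (sym (ℕ.m+[n∸m]≡n i≤))) (ι-+ i (suc n ℕ.∸ i))))
    (solve 4 (λ a b p q → (a :+ b) :* (p :* q) := (a :* p) :* q :+ p :* (b :* q)) refl (ι i) (ι (suc n ℕ.∸ i)) (T x i) (T y (suc n ℕ.∸ i)))
  first : ∑ (suc (suc n)) g₁ ≡ x ℚ.* ∑ (suc n) c
  first = trans (∑-head (suc n) g₁) (trans (cong₂ ℚ._+_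
      (trans (cong (ℚ._* T y (suc n)) (ℚ.*-zeroˡ (T x 0))) (ℚ.*-zeroˡ (T y (suc n))))
      (trans (∑-cong (suc n) (λ i _ → trans (cong (ℚ._* T y (n ℕ.∸ i)) (T-suc x i)) (ℚ.*-assoc x (T x i) (T y (n ℕ.∸ i)))))
             (∑-* (suc n) x c)))
    (ℚ.+-identityˡ _))
  second : ∑ (suc (suc n)) g₂ ≡ y ℚ.* ∑ (suc n) c
  second = trans (cong₂ ℚ._+_
      (trans (∑-cong (suc n) (λ i i≤n → trans (cong (λ k → T x i ℚ.* (ι k ℚ.* T y k)) (ℕ.+-∸-assoc 1 (ℕ.≤-pred i≤n)))
               (trans (cong (T x i ℚ.*_) (T-suc y (n ℕ.∸ i)))
                 (solve 3 (λ p y q → p :* (y :* q) := y :* (p :* q)) refl (T x i) y (T y (n ℕ.∸ i))))))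
             (∑-* (suc n) y c))
      (trans (cong (λ k → T x (suc n) ℚ.* (ι k ℚ.* T y k)) (ℕ.n∸n≡0 n)) (solve 1 (λ p → p :* (con 0ℚ :* con 1ℚ) := con 0ℚ) refl (T x (suc n)))))
    (ℚ.+-identityʳ _)

-- By the binomial theorem the left side is the sum of all T x i · T y j over the triangle i + j <
-- n; the right side groups the triangle by i.
E-+ : ∀ x y n → E (x ℚ.+ y) n ≡ ∑ n (λ i → T x i ℚ.* E y (n ℕ.∸ i))
E-+ x y zero    = refl
E-+ x y (suc n) = sym (begin
  ∑ n (λ i → T x i ℚ.* E y (suc n ℕ.∸ i)) ℚ.+ T x n ℚ.* E y (suc n ℕ.∸ n)
    ≡⟨ cong₂ ℚ._+_ (∑-cong n (λ i i<n → trans (cong (λ k → T x i ℚ.* E y k) (ℕ.+-∸-assoc 1 (ℕ.<⇒≤ i<n)))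
                      (ℚ.*-distribˡ-+ (T x i) (E y (n ℕ.∸ i)) (T y (n ℕ.∸ i)))))
                   (trans (cong (λ k → T x n ℚ.* E y k) (trans (ℕ.+-∸-assoc 1 (ℕ.≤-refl {n})) (cong suc (ℕ.n∸n≡0 n))))
                      (cong (T x n ℚ.*_) (cong (T y) (sym (ℕ.n∸n≡0 n))))) ⟩
  ∑ n (λ i → a i ℚ.+ b i) ℚ.+ b n
    ≡⟨ cong (ℚ._+ b n) (∑-+ n a b) ⟩
  (∑ n a ℚ.+ ∑ n b) ℚ.+ b n
    ≡⟨ ℚ.+-assoc (∑ n a) (∑ n b) (b n) ⟩
  ∑ n a ℚ.+ ∑ (suc n) b
    ≡⟨ cong₂ ℚ._+_ (sym (E-+ x y n)) (T-binomial x y n) ⟩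
  E (x ℚ.+ y) (suc n) ∎)
  where
  open ≡-Reasoning
  a b : ℕ → ℚ
  a i = T x i ℚ.* E y (n ℕ.∸ i)
  b i = T x i ℚ.* T y (n ℕ.∸ i)

-- The difference consists of the products T x i · T y j with i, j < n outside the triangle i + j <
-- n. They are dominated by the same products at X and Y, and the whole square i, j < n lies inside
-- the triangle of side 2 n, which turns the bound into a tail of the series at X + Y.
E-*-difference : ∀ {x y X Y} n → ℚ.∣ x ∣ ℚ.≤ X → ℚ.∣ y ∣ ℚ.≤ Y →
  ℚ.∣ E x n ℚ.* E y n ℚ.- E (x ℚ.+ y) n ∣ ℚ.≤ E (X ℚ.+ Y) (n ℕ.+ n) ℚ.- E (X ℚ.+ Y) n
E-*-difference {x} {y} {X} {Y} n x≤ y≤ = begin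
  ℚ.∣ E x n ℚ.* E y n ℚ.- E (x ℚ.+ y) n ∣
    ≡⟨ cong ℚ.∣_∣ (expand x y n) ⟩
  ℚ.∣ ∑ n (λ i → T x i ℚ.* (E y n ℚ.- E y (n ℕ.∸ i))) ∣
    ≤⟨ ∑-∣∣ n (λ i → T x i ℚ.* (E y n ℚ.- E y (n ℕ.∸ i))) ⟩
  ∑ n (λ i → ℚ.∣ T x i ℚ.* (E y n ℚ.- E y (n ℕ.∸ i)) ∣)
    ≤⟨ ∑-mono n (λ i i<n → ∣*∣≤ (T-∣∣ x≤ i) (∑-tail-≤ (T-∣∣ y≤) (ℕ.m∸n≤m n i))) ⟩
  ∑ n (λ i → T X i ℚ.* (E Y n ℚ.- E Y (n ℕ.∸ i)))
    ≡⟨ sym (expand X Y n) ⟩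
  E X n ℚ.* E Y n ℚ.- E (X ℚ.+ Y) n
    ≤⟨ ℚ.+-monoˡ-≤ (ℚ.- E (X ℚ.+ Y) n) upper ⟩
  E (X ℚ.+ Y) (n ℕ.+ n) ℚ.- E (X ℚ.+ Y) n ∎
  where
  open ℚ.≤-Reasoning
  0≤X = ℚ.≤-trans (ℚ.0≤∣p∣ x) x≤
  0≤Y = ℚ.≤-trans (ℚ.0≤∣p∣ y) y≤
  ∣*∣≤ : ∀ {a b c d} → ℚ.∣ a ∣ ℚ.≤ c → ℚ.∣ b ∣ ℚ.≤ d → ℚ.∣ a ℚ.* b ∣ ℚ.≤ c ℚ.* d
  ∣*∣≤ {a} {b} {c} {d} a≤ b≤ = ≤-by (ℚ.0≤∣p∣ a ⊠ gap b≤ ⊞ gap a≤ ⊠ ℚ.≤-trans (ℚ.0≤∣p∣ b) b≤)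
    (trans (solve 4 (λ a b c d → c :* d := a :* b :+ (a :* (d :- b) :+ (c :- a) :* d)) refl ℚ.∣ a ∣ ℚ.∣ b ∣ c d)
      (cong (ℚ._+ (ℚ.∣ a ∣ ℚ.* (d ℚ.- ℚ.∣ b ∣) ℚ.+ (c ℚ.- ℚ.∣ a ∣) ℚ.* d)) (sym (ℚ.∣p*q∣≡∣p∣*∣q∣ a b))))
  expand : ∀ x y n → E x n ℚ.* E y n ℚ.- E (x ℚ.+ y) n ≡ ∑ n (λ i → T x i ℚ.* (E y n ℚ.- E y (n ℕ.∸ i)))
  expand x y n = trans (cong₂ (λ u v → u ℚ.- v)
      (trans (ℚ.*-comm (E x n) (E y n)) (sym (∑-* n (E y n) (T x))))
      (E-+ x y n))
    (trans (cong (λ v → ∑ n (λ i → E y n ℚ.* T x i) ℚ.+ v)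
        (trans (solve 1 (λ a → :- a := con (ℚ.- 1ℚ) :* a) refl (∑ n (λ i → T x i ℚ.* E y (n ℕ.∸ i))))
          (sym (∑-* n (ℚ.- 1ℚ) (λ i → T x i ℚ.* E y (n ℕ.∸ i))))))
      (trans (sym (∑-+ n (λ i → E y n ℚ.* T x i) (λ i → ℚ.- 1ℚ ℚ.* (T x i ℚ.* E y (n ℕ.∸ i)))))
        (∑-cong n (λ i _ → solve 3 (λ a t b → a :* t :+ con (ℚ.- 1ℚ) :* (t :* b) := t :* (a :- b)) refl (E y n) (T x i) (E y (n ℕ.∸ i))))))
  upper : E X n ℚ.* E Y n ℚ.≤ E (X ℚ.+ Y) (n ℕ.+ n)
  upper = begin
    E X n ℚ.* E Y n                                    ≡⟨ ℚ.*-comm (E X n) (E Y n) ⟩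
    E Y n ℚ.* E X n                                    ≡⟨ sym (∑-* n (E Y n) (T X)) ⟩
    ∑ n (λ i → E Y n ℚ.* T X i)                        ≡⟨ ∑-cong n (λ i _ → ℚ.*-comm (E Y n) (T X i)) ⟩
    ∑ n (λ i → T X i ℚ.* E Y n)                        ≤⟨ ∑-mono n (λ i i<n → ℚ*-mono (T X i) (T-nonneg 0≤X i)
                                                           (∑-mono-length (T-nonneg 0≤Y) (subst (n ℕ.≤_) (sym (ℕ.+-∸-assoc n (ℕ.<⇒≤ i<n))) (ℕ.m≤m+n n (n ℕ.∸ i))))) ⟩
    ∑ n (λ i → T X i ℚ.* E Y (n ℕ.+ n ℕ.∸ i))          ≤⟨ ∑-mono-length (λ i → T-nonneg 0≤X i ⊠ ∑-nonneg (n ℕ.+ n ℕ.∸ i) (T-nonneg 0≤Y)) (ℕ.m≤m+n n n) ⟩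
    ∑ (n ℕ.+ n) (λ i → T X i ℚ.* E Y (n ℕ.+ n ℕ.∸ i))  ≡⟨ sym (E-+ X Y (n ℕ.+ n)) ⟩
    E (X ℚ.+ Y) (n ℕ.+ n)                              ∎

T-halves : ∀ B k → B ℕ.+ B ℕ.≤ k → T (ι B) (suc k) ℚ.≤ ½ ℚ.* T (ι B) k
T-halves B k 2B≤k = ℚ*-cancel (ι (suc k)) (0<ι k) (≤-by
  (0≤½ ⊠ gap (ι-mono-≤ (ℕ.m≤n⇒m≤1+n 2B≤k)) ⊠ T-nonneg (0≤ι B) k)
  (trans (solve 4 (λ a b s t → a :* (con ½ :* t) := b :* t :+ con ½ :* (a :- s) :* t :+ (con ½ :* s :- b) :* t) refl (ι (suc k)) (ι B) (ι (B ℕ.+ B)) (T (ι B) k))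
    (trans (cong₂ (λ u v → u ℚ.+ ½ ℚ.* (ι (suc k) ℚ.- ι (B ℕ.+ B)) ℚ.* T (ι B) k ℚ.+ v)
        (sym (T-suc (ι B) k))
        (trans (cong (λ s → (½ ℚ.* s ℚ.- ι B) ℚ.* T (ι B) k) (ι-+ B B))
          (solve 2 (λ b t → (con ½ :* (b :+ b) :- b) :* t := con 0ℚ) refl (ι B) (T (ι B) k))))
      (ℚ.+-identityʳ _))))

T-decay : ∀ B j → T (ι B) (B ℕ.+ B ℕ.+ j) ℚ.≤ h j ℚ.* T (ι B) (B ℕ.+ B)
T-decay B zero    = ℚ.≤-reflexive (trans (cong (T (ι B)) (ℕ.+-identityʳ (B ℕ.+ B))) (sym (ℚ.*-identityˡ _)))
T-decay B (suc j) = subst (λ k → T (ι B) k ℚ.≤ h (suc j) ℚ.* T (ι B) (B ℕ.+ B)) (sym (ℕ.+-suc (B ℕ.+ B) j))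
  (ℚ.≤-trans (T-halves B (B ℕ.+ B ℕ.+ j) (ℕ.m≤m+n (B ℕ.+ B) j))
    (ℚ.≤-trans (ℚ*-mono ½ 0≤½ (T-decay B j)) (ℚ.≤-reflexive (sym (ℚ.*-assoc ½ (h j) _)))))

-- Once each term is at most half of its predecessor, the partial sum plus twice the next term can
-- no longer increase. This is the geometric tail bound in a form suited to induction.
E-tail : ∀ B n → B ℕ.+ B ℕ.≤ n → ∀ k → E (ι B) (n ℕ.+ k) ℚ.+ (T (ι B) (n ℕ.+ k) ℚ.+ T (ι B) (n ℕ.+ k)) ℚ.≤ E (ι B) n ℚ.+ (T (ι B) n ℚ.+ T (ι B) n)
E-tail B n le zero    = ℚ.≤-reflexive (cong (λ m → E (ι B) m ℚ.+ (T (ι B) m ℚ.+ T (ι B) m)) (ℕ.+-identityʳ n))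
E-tail B n le (suc k) = subst (λ m → E (ι B) m ℚ.+ (T (ι B) m ℚ.+ T (ι B) m) ℚ.≤ E (ι B) n ℚ.+ (T (ι B) n ℚ.+ T (ι B) n)) (sym (ℕ.+-suc n k))
  (ℚ.≤-trans
    (≤-by (gap a ⊞ gap a) (solve 3 (λ e t u → e :+ (t :+ t) := e :+ t :+ (u :+ u) :+ ((con ½ :* t :- u) :+ (con ½ :* t :- u))) refl
      (E (ι B) (n ℕ.+ k)) (T (ι B) (n ℕ.+ k)) (T (ι B) (suc (n ℕ.+ k)))))
    (E-tail B n le k))
  where
  a = T-halves B (n ℕ.+ k) (ℕ.≤-trans le (ℕ.m≤m+n n k))

E-tail-≤ : ∀ B {m n} → B ℕ.+ B ℕ.≤ m → m ℕ.≤ n → E (ι B) n ℚ.- E (ι B) m ℚ.≤ T (ι B) m ℚ.+ T (ι B) m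
E-tail-≤ B {m} {n} 2B≤m m≤n = subst (λ k → E (ι B) k ℚ.- E (ι B) m ℚ.≤ T (ι B) m ℚ.+ T (ι B) m) (ℕ.m+[n∸m]≡n m≤n)
  (≤-by (gap (E-tail B m 2B≤m k) ⊞ 0≤T ⊞ 0≤T)
    (solve 4 (λ e f t u → t :+ t := f :- e :+ (e :+ (t :+ t) :- (f :+ (u :+ u)) :+ u :+ u)) refl (E (ι B) m) (E (ι B) (m ℕ.+ k)) (T (ι B) m) (T (ι B) (m ℕ.+ k))))
  where
  k = n ℕ.∸ m
  0≤T = T-nonneg (0≤ι B) (m ℕ.+ k)

E-cauchy : ∀ B ε → 0ℚ ℚ.< ε → ∃[ N ] ∀ m n → N ℕ.≤ m → m ℕ.≤ n → E (ι B) n ℚ.- E (ι B) m ℚ.≤ ε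
E-cauchy B ε ε>0 =
  let A , T≤A = archimedean (T (ι B) (B ℕ.+ B))
      δ , δ>0 , _ , Aδ≤ = small A 0 (½ ℚ.* ε) (0<* 0<½ ε>0)
      j , hj≤δ = h-null δ δ>0
  in B ℕ.+ B ℕ.+ j , λ m n N≤m m≤n → ℚ.≤-trans (E-tail-≤ B (ℕ.≤-trans (ℕ.m≤m+n (B ℕ.+ B) j) N≤m) m≤n)
    (let i = m ℕ.∸ (B ℕ.+ B)
         m≡ = ℕ.m+[n∸m]≡n (ℕ.≤-trans (ℕ.m≤m+n (B ℕ.+ B) j) N≤m)
         j≤i = ℕ.m+n≤o⇒m≤o∸n j (subst (ℕ._≤ m) (ℕ.+-comm (B ℕ.+ B) j) N≤m)
         le : T (ι B) m ℚ.≤ ½ ℚ.* ε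
         le = ℚ.≤-trans (subst (λ k → T (ι B) k ℚ.≤ h i ℚ.* T (ι B) (B ℕ.+ B)) m≡ (T-decay B i))
           (ℚ.≤-trans (≤-by (gap (ℚ.≤-trans (h-mono j≤i) hj≤δ) ⊠ T-nonneg (0≤ι B) (B ℕ.+ B) ⊞ ℚ.<⇒≤ δ>0 ⊠ gap T≤A ⊞ ℚ.<⇒≤ δ>0)
              (solve 4 (λ x t d a → (a :+ con 0ℚ :+ con 1ℚ) :* d := x :* t :+ ((d :- x) :* t :+ d :* (a :- t) :+ d)) refl (h i) (T (ι B) (B ℕ.+ B)) δ (ι A)))
             Aδ≤)
     in ≤-by (gap le ⊞ gap le) (solve 2 (λ e t → e := t :+ t :+ ((con ½ :* e :- t) :+ (con ½ :* e :- t))) refl ε (T (ι B) m)))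

E-bounded : ∀ B → ∃[ C ] ∀ n → E (ι B) n ℚ.≤ ι C
E-bounded B =
  let C , le = archimedean (E (ι B) (B ℕ.+ B) ℚ.+ (T (ι B) (B ℕ.+ B) ℚ.+ T (ι B) (B ℕ.+ B)))
  in C , λ n → ℚ.≤-trans (∑-mono-length (T-nonneg (0≤ι B)) (ℕ.m≤n+m n (B ℕ.+ B)))
    (ℚ.≤-trans (≤-by (T-nonneg (0≤ι B) (B ℕ.+ B ℕ.+ n) ⊞ T-nonneg (0≤ι B) (B ℕ.+ B ℕ.+ n)) refl)
      (ℚ.≤-trans (E-tail B (B ℕ.+ B) ℕ.≤-refl n) le))

-- The derivative of T (k + 1) is T k, so this is a mean value bound. It is obtained from the
-- recurrence by splitting u T u k - v T v k into u (T u k - T v k) + (u - v) T v k: the first part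
-- contributes k times and the second once the quantity |u - v| T b k.
T-lipschitz : ∀ {u v b} → ℚ.∣ u ∣ ℚ.≤ b → ℚ.∣ v ∣ ℚ.≤ b → ∀ k → ℚ.∣ T u (suc k) ℚ.- T v (suc k) ∣ ℚ.≤ ℚ.∣ u ℚ.- v ∣ ℚ.* T b k
T-lipschitz {u} {v} {b} u≤ v≤ k = ℚ*-cancel (ι (suc k)) (0<ι k) (begin
  ι (suc k) ℚ.* ℚ.∣ T u (suc k) ℚ.- T v (suc k) ∣
    ≡⟨ cong (ℚ._* ℚ.∣ T u (suc k) ℚ.- T v (suc k) ∣) (sym (ℚ.0≤p⇒∣p∣≡p (0≤ι (suc k)))) ⟩
  ℚ.∣ ι (suc k) ∣ ℚ.* ℚ.∣ T u (suc k) ℚ.- T v (suc k) ∣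
    ≡⟨ sym (ℚ.∣p*q∣≡∣p∣*∣q∣ (ι (suc k)) (T u (suc k) ℚ.- T v (suc k))) ⟩
  ℚ.∣ ι (suc k) ℚ.* (T u (suc k) ℚ.- T v (suc k)) ∣
    ≡⟨ cong ℚ.∣_∣ (trans (solve 3 (λ a x y → a :* (x :- y) := a :* x :- a :* y) refl (ι (suc k)) (T u (suc k)) (T v (suc k)))
         (trans (cong₂ ℚ._-_ (T-suc u k) (T-suc v k))
           (solve 4 (λ u v x y → u :* x :- v :* y := u :* (x :- y) :+ (u :- v) :* y) refl u v (T u k) (T v k)))) ⟩
  ℚ.∣ u ℚ.* (T u k ℚ.- T v k) ℚ.+ (u ℚ.- v) ℚ.* T v k ∣
    ≤⟨ ℚ.∣p+q∣≤∣p∣+∣q∣ (u ℚ.* (T u k ℚ.- T v k)) ((u ℚ.- v) ℚ.* T v k) ⟩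
  ℚ.∣ u ℚ.* (T u k ℚ.- T v k) ∣ ℚ.+ ℚ.∣ (u ℚ.- v) ℚ.* T v k ∣
    ≡⟨ cong₂ ℚ._+_ (ℚ.∣p*q∣≡∣p∣*∣q∣ u (T u k ℚ.- T v k)) (ℚ.∣p*q∣≡∣p∣*∣q∣ (u ℚ.- v) (T v k)) ⟩
  ℚ.∣ u ∣ ℚ.* ℚ.∣ T u k ℚ.- T v k ∣ ℚ.+ d ℚ.* ℚ.∣ T v k ∣
    ≤⟨ ℚ.+-mono-≤ (ℚ.*-monoʳ-≤-nonNeg ℚ.∣ T u k ℚ.- T v k ∣ {{ℚ.∣-∣-nonNeg (T u k ℚ.- T v k)}} u≤)
                  (ℚ*-mono d (ℚ.0≤∣p∣ (u ℚ.- v)) (T-∣∣ v≤ k)) ⟩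
  b ℚ.* ℚ.∣ T u k ℚ.- T v k ∣ ℚ.+ d ℚ.* T b k
    ≤⟨ ℚ.+-monoˡ-≤ (d ℚ.* T b k) (earlier k) ⟩
  d ℚ.* (ι k ℚ.* T b k) ℚ.+ d ℚ.* T b k
    ≡⟨ solve 3 (λ d i t → d :* (i :* t) :+ d :* t := (con 1ℚ :+ i) :* (d :* t)) refl d (ι k) (T b k) ⟩
  (1ℚ ℚ.+ ι k) ℚ.* (d ℚ.* T b k)
    ≡⟨ cong (ℚ._* (d ℚ.* T b k)) (sym (ι-suc k)) ⟩
  ι (suc k) ℚ.* (d ℚ.* T b k) ∎)
  where
  open ℚ.≤-Reasoning
  d = ℚ.∣ u ℚ.- v ∣
  0≤b = ℚ.≤-trans (ℚ.0≤∣p∣ u) u≤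
  earlier : ∀ k → b ℚ.* ℚ.∣ T u k ℚ.- T v k ∣ ℚ.≤ d ℚ.* (ι k ℚ.* T b k)
  earlier zero    = ℚ.≤-reflexive (trans (cong (b ℚ.*_) (cong ℚ.∣_∣ (ℚ.+-inverseʳ 1ℚ)))
    (solve 2 (λ b d → b :* con 0ℚ := d :* (con 0ℚ :* con 1ℚ)) refl b d))
  earlier (suc k) = ℚ.≤-trans (ℚ*-mono b 0≤b (T-lipschitz u≤ v≤ k))
    (ℚ.≤-reflexive (trans (solve 3 (λ b d t → b :* (d :* t) := d :* (b :* t)) refl b d (T b k)) (cong (d ℚ.*_) (sym (T-suc b k)))))

E-lipschitz : ∀ {u v b} → ℚ.∣ u ∣ ℚ.≤ b → ℚ.∣ v ∣ ℚ.≤ b → ∀ n → ℚ.∣ E u n ℚ.- E v n ∣ ℚ.≤ ℚ.∣ u ℚ.- v ∣ ℚ.* E b n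
E-lipschitz {u} {v} {b} u≤ v≤ zero    = ℚ.≤-reflexive (sym (ℚ.*-zeroʳ ℚ.∣ u ℚ.- v ∣))
E-lipschitz {u} {v} {b} u≤ v≤ (suc n) = begin
  ℚ.∣ E u (suc n) ℚ.- E v (suc n) ∣
    ≡⟨ cong ℚ.∣_∣ (trans (cong₂ ℚ._-_ (∑-head n (T u)) (∑-head n (T v)))
        (trans (solve 2 (λ x y → (con 1ℚ :+ x) :- (con 1ℚ :+ y) := x :+ con (ℚ.- 1ℚ) :* y) refl (∑ n (λ i → T u (suc i))) (∑ n (λ i → T v (suc i))))
          (trans (cong (∑ n (λ i → T u (suc i)) ℚ.+_) (sym (∑-* n (ℚ.- 1ℚ) (λ i → T v (suc i)))))
            (trans (sym (∑-+ n (λ i → T u (suc i)) (λ i → ℚ.- 1ℚ ℚ.* T v (suc i))))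
              (∑-cong n (λ i _ → solve 2 (λ x y → x :+ con (ℚ.- 1ℚ) :* y := x :- y) refl (T u (suc i)) (T v (suc i)))))))) ⟩
  ℚ.∣ ∑ n (λ i → T u (suc i) ℚ.- T v (suc i)) ∣
    ≤⟨ ∑-∣∣ n (λ i → T u (suc i) ℚ.- T v (suc i)) ⟩
  ∑ n (λ i → ℚ.∣ T u (suc i) ℚ.- T v (suc i) ∣)
    ≤⟨ ∑-mono n (λ i _ → T-lipschitz u≤ v≤ i) ⟩
  ∑ n (λ i → ℚ.∣ u ℚ.- v ∣ ℚ.* T b i)
    ≡⟨ ∑-* n ℚ.∣ u ℚ.- v ∣ (T b) ⟩
  ℚ.∣ u ℚ.- v ∣ ℚ.* E b n
    ≤⟨ ℚ*-mono ℚ.∣ u ℚ.- v ∣ (ℚ.0≤∣p∣ (u ℚ.- v)) (∑-mono-length (T-nonneg (ℚ.≤-trans (ℚ.0≤∣p∣ u) u≤)) (ℕ.n≤1+n n)) ⟩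
  ℚ.∣ u ℚ.- v ∣ ℚ.* E b (suc n) ∎
  where open ℚ.≤-Reasoning

-- The exponential function on ℝ

seq-pow : ∀ x k n → seq (pow x k) n ≡ qpow (seq x n) k
seq-pow x zero    n = refl
seq-pow x (suc k) n = cong (seq x n ℚ.*_) (seq-pow x k n)

seq-∑ : ∀ x k n → seq (∑< k (λ k → pow x k * fromℚ (ℚ._/_ (+ 1) (k !) {{k ℕ.!≢0}}))) n ≡ E (seq x n) k
seq-∑ x zero    n = refl
seq-∑ x (suc k) n = cong₂ ℚ._+_ (seq-∑ x k n) (cong (ℚ._* 1/ k !) (seq-pow x k n))

E-tail-∣∣ : ∀ B {x N ε} → ℚ.∣ x ∣ ℚ.≤ ι B → (∀ m n → N ℕ.≤ m → m ℕ.≤ n → E (ι B) n ℚ.- E (ι B) m ℚ.≤ ε) →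
  ∀ m n → N ℕ.≤ m → N ℕ.≤ n → ℚ.∣ E x m ℚ.- E x n ∣ ℚ.≤ ε
E-tail-∣∣ B {x} x≤ tail m n N≤m N≤n with ℕ.≤-total m n
... | inj₂ n≤m = ℚ.≤-trans (∑-tail-≤ (T-∣∣ x≤) n≤m) (tail n m N≤n n≤m)
... | inj₁ m≤n = ℚ.≤-trans (ℚ.≤-reflexive (trans (sym (ℚ.∣-p∣≡∣p∣ (E x m ℚ.- E x n)))
    (cong ℚ.∣_∣ (solve 2 (λ a b → :- (a :- b) := b :- a) refl (E x m) (E x n)))))
  (ℚ.≤-trans (∑-tail-≤ (T-∣∣ x≤) m≤n) (tail m n N≤m m≤n))

∣∣-triangle : ∀ a b c d {ε} → ℚ.∣ a ℚ.- b ∣ ℚ.≤ ½ ℚ.* (½ ℚ.* ε) → ℚ.∣ b ℚ.- c ∣ ℚ.≤ ½ ℚ.* ε → ℚ.∣ c ℚ.- d ∣ ℚ.< ½ ℚ.* (½ ℚ.* ε) → ℚ.∣ a ℚ.- d ∣ ℚ.< ε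
∣∣-triangle a b c d {ε} p q r = begin-strict
  ℚ.∣ a ℚ.- d ∣
    ≡⟨ cong ℚ.∣_∣ (solve 4 (λ a b c d → a :- d := (a :- b) :+ ((b :- c) :+ (c :- d))) refl a b c d) ⟩
  ℚ.∣ (a ℚ.- b) ℚ.+ ((b ℚ.- c) ℚ.+ (c ℚ.- d)) ∣
    ≤⟨ ℚ.∣p+q∣≤∣p∣+∣q∣ (a ℚ.- b) _ ⟩
  ℚ.∣ a ℚ.- b ∣ ℚ.+ ℚ.∣ (b ℚ.- c) ℚ.+ (c ℚ.- d) ∣
    ≤⟨ ℚ.+-monoʳ-≤ ℚ.∣ a ℚ.- b ∣ (ℚ.∣p+q∣≤∣p∣+∣q∣ (b ℚ.- c) (c ℚ.- d)) ⟩
  ℚ.∣ a ℚ.- b ∣ ℚ.+ (ℚ.∣ b ℚ.- c ∣ ℚ.+ ℚ.∣ c ℚ.- d ∣)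
    <⟨ ℚ.+-mono-≤-< p (ℚ.+-mono-≤-< q r) ⟩
  ½ ℚ.* (½ ℚ.* ε) ℚ.+ (½ ℚ.* ε ℚ.+ ½ ℚ.* (½ ℚ.* ε))
    ≡⟨ solve 1 (λ e → con ½ :* (con ½ :* e) :+ (con ½ :* e :+ con ½ :* (con ½ :* e)) := e) refl ε ⟩
  ε ∎
  where open ℚ.≤-Reasoning

lip : ∀ C {d δ E′} → E′ ℚ.≤ ι C → d ℚ.≤ δ → 0ℚ ℚ.≤ d → 0ℚ ℚ.≤ δ → d ℚ.* E′ ℚ.≤ (ι C ℚ.+ 0ℚ ℚ.+ 1ℚ) ℚ.* δ
lip C {d} {δ} {E′} a b 0≤d 0≤δ = ≤-by (0≤d ⊠ gap a ⊞ gap b ⊠ 0≤ι C ⊞ 0≤δ)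
  (solve 4 (λ d e f c → (c :+ con 0ℚ :+ con 1ℚ) :* e := d :* f :+ (d :* (c :- f) :+ (e :- d) :* c :+ e)) refl d δ E′ (ι C))

-- A concrete model of Classical.exp, the diagonal of the partial sums.
e : ℝ → ℝ
e x = mkℝ (λ n → E (seq x n) n) λ ε ε>0 →
  let B , L , x≤ = bounded x
      C , E≤C = E-bounded B
      δ , δ>0 , _ , Cδ≤ = small C 0 (½ ℚ.* ε) (0<* 0<½ ε>0)
      M , xx = cauchy x δ δ>0
      η>0 = 0<* 0<½ (0<* 0<½ (0<* 0<½ ε>0))
      N , tail = E-cauchy B (½ ℚ.* (½ ℚ.* (½ ℚ.* ε))) η>0
      η≤ : ½ ℚ.* (½ ℚ.* (½ ℚ.* ε)) ℚ.< ½ ℚ.* (½ ℚ.* ε)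
      η≤ = half< (½ ℚ.* (½ ℚ.* ε)) (0<* 0<½ (0<* 0<½ ε>0))
  in L ℕ.⊔ (M ℕ.⊔ N) , λ m n m≥ n≥ →
    let L≤m = ℕ.m⊔n≤o⇒m≤o L (M ℕ.⊔ N) m≥
        L≤n = ℕ.m⊔n≤o⇒m≤o L (M ℕ.⊔ N) n≥
        M≤m = ℕ.m⊔n≤o⇒m≤o M N (ℕ.m⊔n≤o⇒n≤o L (M ℕ.⊔ N) m≥)
        M≤n = ℕ.m⊔n≤o⇒m≤o M N (ℕ.m⊔n≤o⇒n≤o L (M ℕ.⊔ N) n≥)
        N≤m = ℕ.m⊔n≤o⇒n≤o M N (ℕ.m⊔n≤o⇒n≤o L (M ℕ.⊔ N) m≥)
        N≤n = ℕ.m⊔n≤o⇒n≤o M N (ℕ.m⊔n≤o⇒n≤o L (M ℕ.⊔ N) n≥)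
    -- Both diagonal entries are compared with partial sums of the same length N: the tail bound
    -- pays for the change of length, the Lipschitz bound for the change of argument.
    in ∣∣-triangle (E (seq x m) m) (E (seq x m) N) (E (seq x n) N) (E (seq x n) n)
      (ℚ.≤-trans (E-tail-∣∣ B (x≤ m L≤m) tail m N N≤m ℕ.≤-refl) (ℚ.<⇒≤ η≤))
      (ℚ.≤-trans (E-lipschitz (x≤ m L≤m) (x≤ n L≤n) N)
        (ℚ.≤-trans (lip C (E≤C N) (ℚ.<⇒≤ (xx m n M≤m M≤n)) (ℚ.0≤∣p∣ (seq x m ℚ.- seq x n)) (ℚ.<⇒≤ δ>0)) Cδ≤))
      (ℚ.≤-<-trans (E-tail-∣∣ B (x≤ n L≤n) tail N n ℕ.≤-refl N≤n) η≤)

∑<⇒e : ∀ x → Converges (λ n → ∑< n (λ k → pow x k * fromℚ (ℚ._/_ (+ 1) (k !) {{k ℕ.!≢0}}))) (e x)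
∑<⇒e x ε ε>0 =
  let η , η>0 , η≤ε = <⇒+ε≤ {0ℝ} {ε} ε>0
      B , bd = bounded x
      N , tail = E-cauchy B (½ ℚ.* η) (0<* 0<½ η>0)
  in N , λ n N≤n → <-≤-trans {∣ ∑< n (λ k → pow x k * fromℚ (ℚ._/_ (+ 1) (k !) {{k ℕ.!≢0}})) - e x ∣} {0ℝ + fromℚ η} {ε}
    (½ ℚ.* η , 0<* 0<½ η>0 , ev-map₂ (λ m x≤ N≤m →
      ≤-by (gap (ℚ.≤-trans (ℚ.≤-reflexive (cong (λ z → ℚ.∣ z ℚ.- E (seq x m) m ∣) (seq-∑ x n m))) (E-tail-∣∣ B x≤ tail n m N≤n N≤m)))
        (solve 2 (λ a e → con 0ℚ :+ e := a :+ con ½ :* e :+ (con ½ :* e :- a)) refl ℚ.∣ seq (∑< n (λ k → pow x k * fromℚ (ℚ._/_ (+ 1) (k !) {{k ℕ.!≢0}}))) m ℚ.- E (seq x m) m ∣ η))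
      bd (N , λ m N≤m → N≤m))
    η≤ε

Converges-unique : ∀ {f x y} → Converges f x → Converges f y → x ≈ y
Converges-unique {f} {x} {y} fx fy = ≤-antisym {x} {y} (half x y fx fy) (half y x fy fx)
  where
  half : ∀ x y → Converges f x → Converges f y → x ≤ y
  half x y fx fy = ≤-+ε {x} {y} λ ε ε>0 →
    let η = fromℚ (½ ℚ.* ε)
        η>0 = fromℚ-mono-< (0<* 0<½ ε>0)
        M , p = fx η η>0
        N , q = fy η η>0
        n = M ℕ.⊔ N
        p′ = <⇒≤ {∣ f n - x ∣} {η} (p n (ℕ.m≤m⊔n M N))
        q′ = <⇒≤ {∣ f n - y ∣} {η} (q n (ℕ.m≤n⊔m M N))
        p″ = ≤-trans { - (f n - x)} {∣ f n - x ∣} {η} (-x≤∣x∣ (f n - x)) p′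
        q″ = ≤-trans {f n - y} {∣ f n - y ∣} {η} (x≤∣x∣ (f n - y)) q′
    in ≤-cert {x} {y + fromℚ ε} {(η - (- (f n - x))) + (η - (f n - y))} (0≤-+ {η - (- (f n - x))} {η - (f n - y)} (0≤gap { - (f n - x)} {η} p″) (0≤gap {f n - y} {η} q″))
      λ k → solve 4 (λ x y f e → y :+ e := x :+ ((con ½ :* e :+ :- (:- (f :+ :- x))) :+ (con ½ :* e :+ :- (f :+ :- y)))) refl (seq x k) (seq y k) (seq (f n) k) ε

e-+ : ∀ x y → e (x + y) ≈ e x * e y
e-+ x y = ≈-sym {e x * e y} {e (x + y)} λ ε ε>0 →
  let A , xA = bounded x
      B , yB = bounded y
      N , tail = E-cauchy (A ℕ.+ B) (½ ℚ.* ε) (0<* 0<½ ε>0)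
  in ev-map₂ (λ n (x≤ , y≤) N≤n → ℚ.≤-<-trans (E-*-difference n x≤ y≤)
      (ℚ.≤-<-trans (ℚ.≤-trans (ℚ.≤-reflexive (cong (λ z → E z (n ℕ.+ n) ℚ.- E z n) (sym (ι-+ A B)))) (tail n (n ℕ.+ n) N≤n (ℕ.m≤m+n n n)))
        (half< ε ε>0)))
    (ev-map₂ (λ _ → _,_) xA yB) (N , λ n N≤n → N≤n)

e-cong : ∀ {x y} → x ≈ y → e x ≈ e y
e-cong {x} {y} x≈y ε ε>0 =
  let A , xA = bounded x
      B , yB = bounded y
      C , E≤C = E-bounded (A ℕ.+ B)
      δ , δ>0 , _ , Cδ≤ = small C 0 (½ ℚ.* ε) (0<* 0<½ ε>0)
  in ev-map₂ (λ n (x≤ , y≤) d< → ℚ.≤-<-trans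
      (ℚ.≤-trans (E-lipschitz {b = ι (A ℕ.+ B)} (ℚ.≤-trans x≤ (ι-mono-≤ (ℕ.m≤m+n A B))) (ℚ.≤-trans y≤ (ι-mono-≤ (ℕ.m≤n+m B A))) n)
        (ℚ.≤-trans (lip C (E≤C n) (ℚ.<⇒≤ d<) (ℚ.0≤∣p∣ (seq x n ℚ.- seq y n)) (ℚ.<⇒≤ δ>0)) Cδ≤))
      (half< ε ε>0))
    (ev-map₂ (λ _ → _,_) xA yB) (x≈y δ δ>0)

-- A sequence that represents a nonnegative real may have negative terms, so the estimate by the
-- first two terms of the series is made at |x| and carried over by `e-cong`.
1+x≤e : ∀ {x} → 0ℝ ≤ x → 1ℝ + x ≤ e x
1+x≤e {x} 0≤x = ≤-trans {1ℝ + x} {1ℝ + ∣ x ∣} {e x} (+-mono-≤ {1ℝ} {1ℝ} {x} {∣ x ∣} (≤-refl {1ℝ}) (x≤∣x∣ x))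
  (≤-trans {1ℝ + ∣ x ∣} {e ∣ x ∣} {e x} (ev⇒≤ {1ℝ + ∣ x ∣} {e ∣ x ∣} λ ε ε>0 → 2 , λ n 2≤n →
      ℚ.≤-trans (ℚ.≤-trans (ℚ.≤-reflexive (solve 1 (λ v → con 1ℚ :+ v := con 0ℚ :+ con 1ℚ :* con 1ℚ :+ ((v :* con 1ℚ) :* con 1ℚ)) refl ℚ.∣ seq x n ∣))
        (∑-mono-length (T-nonneg (ℚ.0≤∣p∣ (seq x n))) 2≤n)) (≤-by (ℚ.<⇒≤ ε>0) refl))
    (≈⇒≤ {e ∣ x ∣} {e x} (e-cong {∣ x ∣} {x} (≤-antisym {∣ x ∣} {x}
      (∣∣-least {x} {x} (≤-refl {x}) (≤-cert { - x} {x} {x + x} (0≤-+ {x} {x} 0≤x 0≤x) λ n → solve 1 (λ x → x := :- x :+ (x :+ x)) refl (seq x n)))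
      (x≤∣x∣ x)))))

T-geometric : ∀ {v} → 0ℚ ℚ.≤ v → v ℚ.≤ ½ → ∀ k → T v (suc k) ℚ.≤ v ℚ.* h k
T-geometric {v} 0≤v v≤½ zero    = ℚ.≤-reflexive (solve 1 (λ v → (v :* con 1ℚ) :* con 1ℚ := v :* con 1ℚ) refl v)
T-geometric {v} 0≤v v≤½ (suc k) = ℚ.≤-trans
  (≤-by (0≤ι (suc k) ⊠ T-nonneg 0≤v (suc (suc k)) ⊞ gap v≤½ ⊠ T-nonneg 0≤v (suc k))
    (trans (solve 4 (λ v t u i → con ½ :* t := v :* t :+ (con ½ :- v) :* t) refl v (T v (suc k)) (T v (suc (suc k))) (ι (suc k)))
      (trans (cong (ℚ._+ (½ ℚ.- v) ℚ.* T v (suc k)) (trans (sym (T-suc v (suc k))) (cong (ℚ._* T v (suc (suc k))) (ι-suc (suc k)))))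
        (solve 3 (λ u i r → (con 1ℚ :+ i) :* u :+ r := u :+ (i :* u :+ r)) refl (T v (suc (suc k))) (ι (suc k)) ((½ ℚ.- v) ℚ.* T v (suc k))))))
  (ℚ.≤-trans (ℚ*-mono ½ 0≤½ (T-geometric 0≤v v≤½ k)) (ℚ.≤-reflexive (solve 2 (λ v y → con ½ :* (v :* y) := v :* (con ½ :* y)) refl v (h k))))

-- For v ≤ ½ the terms after the first are at most v, v / 2, v / 4, and so on, with sum at most 2 v.
-- This is the continuity estimate behind the existence of logarithms, and it also yields log 2 ≥ ½.
e≤1+2v : ∀ {v} → 0ℚ ℚ.≤ v → v ℚ.≤ ½ → e (fromℚ v) ≤ fromℚ (1ℚ ℚ.+ (v ℚ.+ v))
e≤1+2v {v} 0≤v v≤½ = pointwise-≤ {e (fromℚ v)} {fromℚ (1ℚ ℚ.+ (v ℚ.+ v))} at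
  where
  go : ∀ n → E v (suc n) ℚ.+ (v ℚ.* h n ℚ.+ v ℚ.* h n) ℚ.≤ 1ℚ ℚ.+ (v ℚ.+ v)
  go zero    = ℚ.≤-reflexive (solve 1 (λ v → con 0ℚ :+ con 1ℚ :+ (v :* con 1ℚ :+ v :* con 1ℚ) := con 1ℚ :+ (v :+ v)) refl v)
  go (suc n) = ℚ.≤-trans (≤-by (gap (T-geometric 0≤v v≤½ n))
    (solve 4 (λ e t v h → e :+ (v :* h :+ v :* h) := e :+ t :+ (v :* (con ½ :* h) :+ v :* (con ½ :* h)) :+ (v :* h :- t)) refl (E v (suc n)) (T v (suc n)) v (h n))) (go n)
  at : ∀ n → E v n ℚ.≤ 1ℚ ℚ.+ (v ℚ.+ v)
  at zero    = 0≤1 ⊞ (0≤v ⊞ 0≤v)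
  at (suc n) = ℚ.≤-trans (≤-by (0≤v ⊠ 0≤h n ⊞ 0≤v ⊠ 0≤h n) refl) (go n)

0≤e : ∀ x → 0ℝ ≤ e x
0≤e x = ≤-trans {0ℝ} {e y * e y} {e x} (pointwise-≤ {0ℝ} {e y * e y} λ n → square (seq (e y) n))
  (≤-trans {e y * e y} {e (y + y)} {e x} (≈⇒≥ {e (y + y)} {e y * e y} (e-+ y y))
    (≈⇒≤ {e (y + y)} {e x} (e-cong {y + y} {x} (pointwise-≈ {y + y} {x} λ n → solve 1 (λ x → con ½ :* x :+ con ½ :* x := x) refl (seq x n)))))
  where
  y = fromℚ ½ * x
  square : ∀ p → 0ℚ ℚ.≤ p ℚ.* p
  square p = subst (0ℚ ℚ.≤_) (trans (sym (ℚ.∣p*q∣≡∣p∣*∣q∣ p p)) (ℚ.0≤p⇒∣p∣≡p (pp p))) (ℚ.0≤∣p∣ p ⊠ ℚ.0≤∣p∣ p)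
    where
    pp : ∀ p → 0ℚ ℚ.≤ p ℚ.* p
    pp p with ℚ.≤-total 0ℚ p
    ... | inj₁ 0≤p = 0≤p ⊠ 0≤p
    ... | inj₂ p≤0 = subst (0ℚ ℚ.≤_) (solve 1 (λ p → (con 0ℚ :- p) :* (con 0ℚ :- p) := p :* p) refl p) (gap p≤0 ⊠ gap p≤0)

-- From e y = e (y - x) e x and e z ≥ 1 + z.
e-growth : ∀ {x y} → x ≤ y → e x + (y - x) * e x ≤ e y
e-growth {x} {y} x≤y = ≤-trans {e x + (y - x) * e x} {(1ℝ + (y - x)) * e x} {e y}
  (≈⇒≤ {e x + (y - x) * e x} {(1ℝ + (y - x)) * e x} (pointwise-≈ {e x + (y - x) * e x} {(1ℝ + (y - x)) * e x} λ n →
    solve 3 (λ x y z → z :+ (y :+ :- x) :* z := (con 1ℚ :+ (y :+ :- x)) :* z) refl (seq x n) (seq y n) (seq (e x) n)))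
  (≤-trans {(1ℝ + (y - x)) * e x} {e (y - x) * e x} {e y} (*-monoʳ-≤ {e x} {1ℝ + (y - x)} {e (y - x)} (0≤e x) (1+x≤e {y - x} (0≤gap {x} {y} x≤y)))
    (≤-trans {e (y - x) * e x} {e ((y - x) + x)} {e y} (≈⇒≥ {e ((y - x) + x)} {e (y - x) * e x} (e-+ (y - x) x))
      (≈⇒≤ {e ((y - x) + x)} {e y} (e-cong {(y - x) + x} {y} (pointwise-≈ {(y - x) + x} {y} λ n → solve 2 (λ x y → y :+ :- x :+ x := y) refl (seq x n) (seq y n))))))

e-mono-≤ : ∀ {x y} → x ≤ y → e x ≤ e y
e-mono-≤ {x} {y} x≤y = ≤-trans {e x} {e x + (y - x) * e x} {e y}
  (≤-cert {e x} {e x + (y - x) * e x} {(y - x) * e x} (0≤-* {y - x} {e x} (0≤gap {x} {y} x≤y) (0≤e x)) λ n → refl)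
  (e-growth {x} {y} x≤y)

e-0 : e 0ℝ ≈ 1ℝ
e-0 = ≤-antisym {e 0ℝ} {1ℝ} (e≤1+2v ℚ.≤-refl 0≤½) (≤-trans {1ℝ} {1ℝ + 0ℝ} {e 0ℝ} (pointwise-≤ {1ℝ} {1ℝ + 0ℝ} λ n → ℚ.≤-refl) (1+x≤e {0ℝ} (≤-refl {0ℝ})))

e-inverse : ∀ x → e x * e (- x) ≈ 1ℝ
e-inverse x = ≈-trans {e x * e (- x)} {e (x - x)} {1ℝ} (≈-sym {e (x - x)} {e x * e (- x)} (e-+ x (- x)))
  (≈-trans {e (x - x)} {e 0ℝ} {1ℝ} (e-cong {x - x} {0ℝ} (pointwise-≈ {x - x} {0ℝ} λ n → ℚ.+-inverseʳ (seq x n))) e-0)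

module _ (em : ∀ {ℓ} → ExcludedMiddle ℓ) where

  -- Children of small forbidden weight

  module Avoidance (ρ : ℕ) (β : ℚ) (0≤β : 0ℚ ℚ.≤ β) (ρβ≡1 : ι ρ ℚ.* β ≡ 1ℚ) (0<ρ : 0 ℕ.< ρ) where

    -- There are 2 ρ children, while dropping a digit multiplies a weight by 1 / β = ρ. This ratio
    -- is the source of the factor ½.
    R : ℕ
    R = ρ ℕ.+ ρ

    -- Words are the base R digits of a forbidden node, relative to the current node.
    Word : Set
    Word = List ℕ

    weight : Word → ℚ
    weight []      = 1ℚ
    weight (_ ∷ w) = β ℚ.* weight w

    potential : List Word → ℚ
    potential []      = 0ℚ
    potential (w ∷ T) = weight w ℚ.+ potential T

    -- The forbidden nodes as seen from child c: words that begin with c lose that digit, the others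
    -- are out of reach. The empty word, which says that the current node is itself forbidden,
    -- weighs 1 and therefore does not occur while the total is below 1.
    step : ℕ → List Word → List Word
    step c []            = []
    step c ([] ∷ T)      = step c T
    step c ((d ∷ w) ∷ T) = if c ℕ.≡ᵇ d then w ∷ step c T else step c T

    hit : ℕ → Word → ℚ
    hit c []      = 0ℚ
    hit c (d ∷ w) = if c ℕ.≡ᵇ d then weight w else 0ℚ

    0≤weight : ∀ w → 0ℚ ℚ.≤ weight w
    0≤weight []      = 0≤1
    0≤weight (_ ∷ w) = 0≤β ⊠ 0≤weight w

    0≤potential : ∀ T → 0ℚ ℚ.≤ potential T
    0≤potential []      = ℚ.≤-refl
    0≤potential (w ∷ T) = 0≤weight w ⊞ 0≤potential T

    potential-step : ∀ c w T → potential (step c (w ∷ T)) ≡ hit c w ℚ.+ potential (step c T)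
    potential-step c []      T = sym (ℚ.+-identityˡ _)
    potential-step c (d ∷ w) T with c ℕ.≡ᵇ d
    ... | true  = refl
    ... | false = sym (ℚ.+-identityˡ _)

    ≡ᵇ-refl : ∀ c → (c ℕ.≡ᵇ c) ≡ true
    ≡ᵇ-refl zero    = refl
    ≡ᵇ-refl (suc c) = ≡ᵇ-refl c

    ≢⇒≡ᵇ-false : ∀ c d → c ≢ d → (c ℕ.≡ᵇ d) ≡ false
    ≢⇒≡ᵇ-false zero    zero    c≢d = ⊥-elim (c≢d refl)
    ≢⇒≡ᵇ-false zero    (suc d) _   = refl
    ≢⇒≡ᵇ-false (suc c) zero    _   = refl
    ≢⇒≡ᵇ-false (suc c) (suc d) c≢d = ≢⇒≡ᵇ-false c d (λ c≡d → c≢d (cong suc c≡d))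

    -- The second half strengthens the induction on n: the sum is still 0 when n arrives at d, so
    -- `weight w` enters only once. The first half is an inequality because d may lie beyond every
    -- child.
    hits : ∀ n d w → ∑ n (λ c → hit c (d ∷ w)) ℚ.≤ weight w × (n ℕ.≤ d → ∑ n (λ c → hit c (d ∷ w)) ≡ 0ℚ)
    hits zero    d w = 0≤weight w , λ _ → refl
    hits (suc n) d w with n ℕ.≟ d | hits n d w
    ... | yes refl | le , eq rewrite ≡ᵇ-refl n = ℚ.≤-reflexive (trans (cong (ℚ._+ weight w) (eq ℕ.≤-refl)) (ℚ.+-identityˡ (weight w))) ,
                               λ d<d → ⊥-elim (ℕ.<-irrefl refl d<d)
    ... | no n≢d   | le , eq rewrite ≢⇒≡ᵇ-false n d n≢d = ℚ.≤-trans (ℚ.≤-reflexive (ℚ.+-identityʳ _)) le ,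
                               λ n<d → trans (ℚ.+-identityʳ _) (eq (ℕ.<⇒≤ n<d))

    ∑-hit : ∀ w → ∑ R (λ c → hit c w) ℚ.≤ ι ρ ℚ.* weight w
    ∑-hit []      = ℚ.≤-trans (ℚ.≤-reflexive (zeros R)) (0≤ι ρ ⊠ 0≤1)
      where
      zeros : ∀ n → ∑ n (λ _ → 0ℚ) ≡ 0ℚ
      zeros zero    = refl
      zeros (suc n) = trans (ℚ.+-identityʳ _) (zeros n)
    ∑-hit (d ∷ w) = ℚ.≤-trans (proj₁ (hits R d w)) (ℚ.≤-reflexive
      (sym (trans (sym (ℚ.*-assoc (ι ρ) β (weight w))) (trans (cong (ℚ._* weight w) ρβ≡1) (ℚ.*-identityˡ (weight w))))))

    ∑-step : ∀ T → ∑ R (λ c → potential (step c T)) ℚ.≤ ι ρ ℚ.* potential T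
    ∑-step []      = ∑-hit-[]
      where
      zeros : ∀ n → ∑ n (λ _ → 0ℚ) ≡ 0ℚ
      zeros zero    = refl
      zeros (suc n) = trans (ℚ.+-identityʳ _) (zeros n)
      ∑-hit-[] = ℚ.≤-reflexive (trans (zeros R) (sym (ℚ.*-zeroʳ (ι ρ))))
    ∑-step (w ∷ T) = begin
      ∑ R (λ c → potential (step c (w ∷ T)))                   ≡⟨ ∑-cong R (λ c _ → potential-step c w T) ⟩
      ∑ R (λ c → hit c w ℚ.+ potential (step c T))             ≡⟨ ∑-+ R (λ c → hit c w) (λ c → potential (step c T)) ⟩
      ∑ R (λ c → hit c w) ℚ.+ ∑ R (λ c → potential (step c T)) ≤⟨ ℚ.+-mono-≤ (∑-hit w) (∑-step T) ⟩
      ι ρ ℚ.* weight w ℚ.+ ι ρ ℚ.* potential T                 ≡⟨ sym (ℚ.*-distribˡ-+ (ι ρ) (weight w) (potential T)) ⟩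
      ι ρ ℚ.* potential (w ∷ T)                                ∎
      where open ℚ.≤-Reasoning

    Family : Set
    Family = ℕ → List Word

    total : Family → ℕ → ℚ
    total 𝒯 N = ∑ N (λ i → potential (𝒯 i))

    ∑-total : ∀ 𝒯 N → ∑ R (λ c → total (λ i → step c (𝒯 i)) N) ℚ.≤ ι ρ ℚ.* total 𝒯 N
    ∑-total 𝒯 zero    = ∑-step []
    ∑-total 𝒯 (suc N) = ℚ.≤-trans
      (ℚ.≤-reflexive (∑-+ R (λ c → total (λ i → step c (𝒯 i)) N) (λ c → potential (step c (𝒯 N)))))
      (ℚ.≤-trans (ℚ.+-mono-≤ (∑-total 𝒯 N) (∑-step (𝒯 N)))
        (ℚ.≤-reflexive (sym (ℚ.*-distribˡ-+ (ι ρ) (total 𝒯 N) (potential (𝒯 N))))))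

    total-mono : ∀ 𝒯 {M N} → M ℕ.≤ N → total 𝒯 M ℚ.≤ total 𝒯 N
    total-mono 𝒯 = ∑-mono-length (λ i → 0≤potential (𝒯 i))

    ∑-½ : ∀ n → ∑ n (λ _ → ½) ≡ ι n ℚ.* ½
    ∑-½ zero    = refl
    ∑-½ (suc n) = trans (cong (ℚ._+ ½) (∑-½ n)) (trans (solve 1 (λ n → n :* con ½ :+ con ½ := (con 1ℚ :+ n) :* con ½) refl (ι n)) (cong (ℚ._* ½) (sym (ι-suc n))))

    Light : Family → Set
    Light 𝒯 = ∀ N → total 𝒯 N ℚ.< 1ℚ

    -- Otherwise each child has a partial total of at least ½. Partial totals grow with N and there
    -- are finitely many children, so one N serves them all. Their sum at this N is then at least R
    -- / 2 = ρ, whereas `∑-total` and lightness keep it below ρ.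
    light-child : ∀ 𝒯 → Light 𝒯 → ∃[ c ] c ℕ.< R × (∀ N → total (λ i → step c (𝒯 i)) N ℚ.≤ ½)
    light-child 𝒯 light with em {P = ∃[ c ] c ℕ.< R × (∀ N → total (λ i → step c (𝒯 i)) N ℚ.≤ ½)}
    ... | yes found = found
    ... | no none   = ⊥-elim (ℚ.<-irrefl refl (ℚ.≤-<-trans heavy (ℚ*-mono-< (ι ρ) (ι-mono-< {0} 0<ρ) (light N))))
      where
      F : ℕ → ℕ → ℚ
      F c N = total (λ i → step c (𝒯 i)) N
      witness : ∀ c → c ℕ.< R → ∃[ N ] ½ ℚ.≤ F c N
      witness c c<R with em {P = ∃[ N ] ½ ℚ.≤ F c N}
      ... | yes w = w
      ... | no ¬w = ⊥-elim (none (c , c<R , λ N → ℚ.<⇒≤ (ℚ.≰⇒> λ le → ¬w (N , le))))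
      common : ∀ n → n ℕ.≤ R → ∃[ N ] ∀ c → c ℕ.< n → ½ ℚ.≤ F c N
      common zero    _   = 0 , λ _ ()
      common (suc n) n<R =
        let M , p = common n (ℕ.<⇒≤ n<R)
            N , q = witness n n<R
        in M ℕ.⊔ N , λ c c<1+n → from c M N p q (ℕ.m≤n⇒m<n∨m≡n (ℕ.≤-pred c<1+n))
        where
        from : ∀ c M N → (∀ c → c ℕ.< n → ½ ℚ.≤ F c M) → ½ ℚ.≤ F n N → c ℕ.< n ⊎ c ≡ n → ½ ℚ.≤ F c (M ℕ.⊔ N)
        from c M N p q (inj₁ c<n)  = ℚ.≤-trans (p c c<n) (total-mono (λ i → step c (𝒯 i)) (ℕ.m≤m⊔n M N))
        from c M N p q (inj₂ refl) = ℚ.≤-trans q (total-mono (λ i → step c (𝒯 i)) (ℕ.m≤n⊔m M N))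
      N = proj₁ (common R ℕ.≤-refl)
      heavy : ι ρ ℚ.* 1ℚ ℚ.≤ ι ρ ℚ.* total 𝒯 N
      heavy = ℚ.≤-trans (ℚ.≤-reflexive (trans (solve 1 (λ r → r :* con 1ℚ := (r :+ r) :* con ½) refl (ι ρ))
          (trans (cong (ℚ._* ½) (sym (ι-+ ρ ρ))) (sym (∑-½ R)))))
        (ℚ.≤-trans (∑-mono R (λ c c<R → proj₂ (common R ℕ.≤-refl) c c<R)) (∑-total 𝒯 N))

    R^≢0 : ∀ t → ℕ.NonZero (R ℕ.^ t)
    R^≢0 t = ℕ.m^n≢0 R t {{ℕ.>-nonZero (ℕ.≤-trans 0<ρ (ℕ.m≤m+n ρ ρ))}}

    digits : ℕ → ℕ → Word
    digits zero    r = []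
    digits (suc t) r = ℕ._/_ r (R ℕ.^ t) {{R^≢0 t}} ∷ digits t (ℕ._%_ r (R ℕ.^ t) {{R^≢0 t}})

    weight-digits : ∀ t r → weight (digits t r) ≡ qpow β t
    weight-digits zero    r = refl
    weight-digits (suc t) r = cong (β ℚ.*_) (weight-digits t (ℕ._%_ r (R ℕ.^ t) {{R^≢0 t}}))

    -- The entries are indices of nodes at depth t below the node J. An entry outside J does no
    -- harm: it costs the same weight and forbids at worst one more word.
    words : ℕ → ℕ → List ℕ → List Word
    words t J = List.map (λ y → digits t (y ℕ.∸ J ℕ.* R ℕ.^ t))

    potential-words : ∀ t J ys → potential (words t J ys) ≡ ι (length ys) ℚ.* qpow β t
    potential-words t J []       = sym (ℚ.*-zeroˡ (qpow β t))
    potential-words t J (y ∷ ys) = trans (cong₂ ℚ._+_ (weight-digits t (y ℕ.∸ J ℕ.* R ℕ.^ t)) (potential-words t J ys))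
      (trans (solve 2 (λ w n → w :+ n :* w := (con 1ℚ :+ n) :* w) refl (qpow β t) (ι (length ys))) (cong (ℚ._* qpow β t) (sym (ι-suc (length ys)))))

    -- The path through light children

    module Path (depth : ℕ → ℕ) (forbid : ℕ → ℕ → List ℕ) (few : ∀ n J → ι (length (forbid n J)) ℚ.* qpow β (depth n) ℚ.< ½)
      (level : ℕ → ℕ) (cover : ℕ → List ℕ) (thin : ∀ N → ∑ N (λ i → ι (length (cover i)) ℚ.* qpow β (level i)) ℚ.< 1ℚ) where

      record State : Set where
        field
          family : Family
          node   : ℕ
          light  : Light family

      open State

      start : State
      start = record
        { family = λ i → words (level i) 1 (cover i)
        ; node   = 1
        ; light  = λ N → ℚ.≤-<-trans (ℚ.≤-reflexive (∑-cong N (λ i _ → potential-words (level i) 1 (cover i)))) (thin N) }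

      child : State → ℕ
      child s = proj₁ (light-child (family s) (light s))

      -- New words go in front, so list i of one level becomes list i + 1 of the next. The lists of
      -- the initial family stay separate throughout, as there are infinitely many of them.
      new-family : ℕ → ℕ → ℕ → Family → Family
      new-family n J c 𝒯 zero    = words (depth n) J (forbid n J)
      new-family n J c 𝒯 (suc i) = step c (𝒯 i)

      next : ℕ → State → State
      next n s = record
        { family = new-family n J c (family s)
        ; node   = J
        ; light  = light′ }
        where
        c = child s
        J = R ℕ.* node s ℕ.+ c
        light′ : Light (new-family n J c (family s))
        light′ zero    = 0<1
        light′ (suc N) = ℚ.≤-<-trans (ℚ.≤-reflexive (∑-head N (λ i → potential (new-family n J c (family s) i))))
          (ℚ.+-mono-<-≤ (ℚ.≤-<-trans (ℚ.≤-reflexive (potential-words (depth n) J (forbid n J))) (few n J))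
            (proj₂ (proj₂ (light-child (family s) (light s))) N))

      state : ℕ → State
      state zero    = start
      state (suc n) = next (suc n) (state n)

      J : ℕ → ℕ
      J n = node (state n)

      digit : ℕ → ℕ
      digit n = child (state n)

      digit<R : ∀ n → digit n ℕ.< R
      digit<R n = proj₁ (proj₂ (light-child (family (state n)) (light (state n))))

      prefix : ℕ → ℕ → Word
      prefix j zero    = []
      prefix j (suc t) = digit j ∷ prefix (suc j) t

      []∈⇒1≤ : ∀ T → [] ∈ T → 1ℚ ℚ.≤ potential T
      []∈⇒1≤ (.[] ∷ T) (here refl) = ≤-by (0≤potential T) refl
      []∈⇒1≤ (w ∷ T)   (there x)   = ℚ.≤-trans ([]∈⇒1≤ T x) (≤-by (0≤weight w) (ℚ.+-comm (weight w) (potential T)))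

      ∈-step : ∀ d w T → (d ∷ w) ∈ T → w ∈ step d T
      ∈-step d w (_ ∷ T)         (here refl) rewrite ≡ᵇ-refl d = here refl
      ∈-step d w ([] ∷ T)        (there x) = ∈-step d w T x
      ∈-step d w ((d′ ∷ w′) ∷ T) (there x) with d ℕ.≡ᵇ d′
      ... | true  = there (∈-step d w T x)
      ... | false = ∈-step d w T x

      -- Were the next t digits of the path a forbidden word, each step would strip one of them and
      -- move the word to the following list. After t steps it is empty and alone weighs 1, against
      -- lightness.
      avoid : ∀ t j i → prefix j t ∉ family (state j) i
      avoid zero    j i x = ℚ.<-irrefl refl (ℚ.<-≤-trans (light (state j) (suc i))
        (ℚ.≤-trans ([]∈⇒1≤ (family (state j) i) x)
          (≤-by (∑-nonneg i (λ i → 0≤potential (family (state j) i))) (ℚ.+-comm (total (family (state j)) i) (potential (family (state j) i))))))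
      avoid (suc t) j i x = avoid t (suc j) (suc i) (∈-step (digit j) (prefix (suc j) t) (family (state j) i) x)

      value : ℕ → ℕ → ℕ
      value j zero    = 0
      value j (suc t) = value (suc j) t ℕ.+ digit j ℕ.* R ℕ.^ t

      value<R^ : ∀ t j → value j t ℕ.< R ℕ.^ t
      value<R^ zero    j = ℕ.s≤s ℕ.z≤n
      value<R^ (suc t) j = ℕ.<-≤-trans (ℕ.+-monoˡ-< (digit j ℕ.* R ℕ.^ t) (value<R^ t (suc j))) (ℕ.*-monoˡ-≤ (R ℕ.^ t) (digit<R j))

      digits-value : ∀ t j → digits t (value j t) ≡ prefix j t
      digits-value zero    j = refl
      digits-value (suc t) j = cong₂ _∷_
        (trans (+-distrib-/-∣ʳ (value (suc j) t) {digit j ℕ.* R ℕ.^ t} {R ℕ.^ t} {{R^≢0 t}} (divides-refl (digit j)))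
          (cong₂ ℕ._+_ (m<n⇒m/n≡0 {{R^≢0 t}} (value<R^ t (suc j))) (m*n/n≡m (digit j) (R ℕ.^ t) {{R^≢0 t}})))
        (trans (cong (digits t) (trans ([m+kn]%n≡m%n (value (suc j) t) (digit j) (R ℕ.^ t) {{R^≢0 t}}) (m<n⇒m%n≡m {{R^≢0 t}} (value<R^ t (suc j))))) (digits-value t (suc j)))

      J-value : ∀ t j → J (j ℕ.+ t) ≡ value j t ℕ.+ J j ℕ.* R ℕ.^ t
      J-value zero    j = trans (cong J (ℕ.+-identityʳ j)) (sym (ℕ.*-identityʳ (J j)))
      J-value (suc t) j = trans (cong J (ℕ.+-suc j t)) (trans (J-value t (suc j))
        (trans (cong (value (suc j) t ℕ.+_) (trans (ℕ.*-distribʳ-+ (R ℕ.^ t) (R ℕ.* J j) (digit j))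
            (trans (ℕ.+-comm (R ℕ.* J j ℕ.* R ℕ.^ t) _) (cong (digit j ℕ.* R ℕ.^ t ℕ.+_) (trans (cong (ℕ._* R ℕ.^ t) (ℕ.*-comm R (J j))) (ℕ.*-assoc (J j) R (R ℕ.^ t)))))))
          (sym (ℕ.+-assoc (value (suc j) t) _ _))))

      J∉ : ∀ t j i ys → family (state j) i ≡ words t (J j) ys → J (j ℕ.+ t) ∉ ys
      J∉ t j i ys eq y∈ = avoid t j i (subst (prefix j t ∈_) (sym eq) (subst (_∈ words t (J j) ys)
        (trans (cong (digits t) (trans (cong (ℕ._∸ J j ℕ.* R ℕ.^ t) (J-value t j)) (ℕ.m+n∸n≡m (value j t) (J j ℕ.* R ℕ.^ t)))) (digits-value t j))
        (∈-map⁺ (λ y → digits t (y ℕ.∸ J j ℕ.* R ℕ.^ t)) y∈)))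

      J-bounds : ∀ t j → J j ℕ.* R ℕ.^ t ℕ.≤ J (j ℕ.+ t) × J (j ℕ.+ t) ℕ.< suc (J j) ℕ.* R ℕ.^ t
      J-bounds t j = subst (J j ℕ.* R ℕ.^ t ℕ.≤_) (sym (J-value t j)) (ℕ.m≤n+m _ (value j t)) ,
        subst (ℕ._< suc (J j) ℕ.* R ℕ.^ t) (sym (J-value t j)) (ℕ.+-monoˡ-< (J j ℕ.* R ℕ.^ t) (value<R^ t j))

      avoids-forbidden : ∀ n → J (suc n ℕ.+ depth (suc n)) ∉ forbid (suc n) (J (suc n))
      avoids-forbidden n = J∉ (depth (suc n)) (suc n) 0 (forbid (suc n) (J (suc n))) refl

      avoids-cover : ∀ i → J (level i) ∉ cover i
      avoids-cover i = J∉ (level i) 0 i (cover i) refl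

  -- The exponent is an index of a data type, so that unification recovers it, as the inferred
  -- underscore below requires.
  data PowerDivides (p q k : ℕ) : Set where
    divides-by : p ℕ.^ k ∣ q → PowerDivides p q k

  -- Abstracting suc r separates the two roles of q in the local search of val,
  -- which is then inferred for the underscore.
  mutual
    val-divides : ∀ p q → PowerDivides p q (val p q)
    val-divides p zero = divides-by (_ ∣0)
    val-divides p (suc r) with p ℕ.^ suc r ∣? suc r
    ... | yes d = divides-by d
    ... | no _ with suc r
    ... | w = search-divides p w r

    search-divides : ∀ p w r → PowerDivides p w _
    search-divides p w zero    = divides-by (1∣ w)
    search-divides p w (suc r) with p ℕ.^ suc r ∣? w
    ... | yes d = divides-by d
    ... | no _  = search-divides p w r

  -- The search descends from N and stops at the first failure. For P that is not monotone the
  -- result may fail to be the least index, but P does fail at its predecessor, and this is what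
  -- later arguments use.
  least-index : ∀ {P : ℕ → Set} → (∀ n → Dec (P n)) → ∀ N → P N → ∃[ n ] P n × (∀ m → n ≡ suc m → ¬ P m)
  least-index P? zero    p = 0 , p , λ _ ()
  least-index P? (suc N) p with P? N
  ... | yes p′ = least-index P? N p′
  ... | no ¬p  = suc N , p , λ { _ refl → ¬p }

  ι*h<1 : ∀ {a b} → a ℕ.< 2 ℕ.^ b → ι a ℚ.* h b ℚ.< 1ℚ
  ι*h<1 {a} {b} lt = ℚ.<-≤-trans (ℚ.*-monoˡ-<-pos (h b) {{ℚ.positive (0<h b)}} (ι-mono-< lt)) (ℚ.≤-reflexive (2^*h b))

  qpow-h : ∀ u t → qpow (h u) t ≡ h (u ℕ.* t)
  qpow-h u zero    = cong h (sym (ℕ.*-zeroʳ u))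
  qpow-h u (suc t) = trans (cong (h u ℚ.*_) (qpow-h u t)) (trans (sym (h-+ u (u ℕ.* t))) (cong h (sym (ℕ.*-suc u t))))

  -- Forbidden nodes around fractions

  module Construction (u-1 p : ℕ) (pr : Prime p) where

    u v : ℕ
    u = suc u-1
    v = suc u

    0<2^u : 0 ℕ.< 2 ℕ.^ u
    0<2^u = ℕ.m^n>0 2 u

    open Avoidance (2 ℕ.^ u) (h u) (0≤h u) (2^*h u) 0<2^u public

    R≡2^v : R ≡ 2 ℕ.^ v
    R≡2^v = cong (2 ℕ.^ u ℕ.+_) (sym (ℕ.+-identityʳ (2 ℕ.^ u)))

    R^≡2^ : ∀ t → R ℕ.^ t ≡ 2 ℕ.^ (v ℕ.* t)
    R^≡2^ t = trans (cong (ℕ._^ t) R≡2^v) (ℕ.^-*-assoc 2 v t)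

    R^*h : ∀ t → ι (R ℕ.^ t) ℚ.* h (v ℕ.* t) ≡ 1ℚ
    R^*h t = trans (cong (λ z → ι z ℚ.* h (v ℕ.* t)) (R^≡2^ t)) (2^*h (v ℕ.* t))

    0<R^ : ∀ t → 0 ℕ.< R ℕ.^ t
    0<R^ t = subst (0 ℕ.<_) (sym (R^≡2^ t)) (ℕ.m^n>0 2 (v ℕ.* t))

    0<p^ : ∀ k → 0 ℕ.< p ℕ.^ k
    0<p^ k = ℕ.m^n>0 p {{prime⇒nonZero pr}} k

    2≤p : 2 ℕ.≤ p
    2≤p = ℕ.nonTrivial⇒n>1 p {{prime⇒nonTrivial pr}}

    -- Each of the v n exponents k forbids at most three nodes of weight 2 ^ (- u t); the constant 6
    -- makes the sum 3 v n 2 ^ (- u t) less than ½. Failure at t - 1 gives 2 ^ (u (t - 1)) ≤ 6 v n,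
    -- which later bounds the loss by a power of log q.
    depth-spec : ∀ n → ∃[ t ] 6 ℕ.* (v ℕ.* n) ℕ.< 2 ℕ.^ (u ℕ.* t) × (∀ w → t ≡ suc w → ¬ 6 ℕ.* (v ℕ.* n) ℕ.< 2 ℕ.^ (u ℕ.* w))
    depth-spec n = least-index (λ t → 6 ℕ.* (v ℕ.* n) ℕ.<? 2 ℕ.^ (u ℕ.* t)) (suc K)
      (ℕ.≤-trans (n≤2^n (suc K)) (ℕ.^-monoʳ-≤ 2 (ℕ.m≤n*m (suc K) u)))
      where K = 6 ℕ.* (v ℕ.* n)

    depth : ℕ → ℕ
    depth n = proj₁ (depth-spec n)

    -- The fraction x / (m p ^ k) lies strictly between (J - 1) / R ^ n and (J + 2) / R ^ n, that
    -- is, in the node J or within one node length of it. Denominators are cleared and the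
    -- subtraction is moved to the other side.
    record Near (n J k m x : ℕ) : Set where
      field
        m>0   : 0 ℕ.< m
        scale : 4 ℕ.* (m ℕ.* (m ℕ.* p ℕ.^ k)) ℕ.≤ R ℕ.^ n
        left  : J ℕ.* (m ℕ.* p ℕ.^ k) ℕ.< x ℕ.* R ℕ.^ n ℕ.+ m ℕ.* p ℕ.^ k
        right : x ℕ.* R ℕ.^ n ℕ.< (J ℕ.+ 2) ℕ.* (m ℕ.* p ℕ.^ k)

    -- Distinct fractions with denominators m p ^ k and m′ p ^ k differ by at least 1 / (m m′ p ^ k)
    -- ≥ 4 R ^ (- n), since the common p ^ k counts only once; but both lie in an open interval of
    -- length 3 R ^ (- n). Applied in both directions, this shows that near fractions with the same
    -- k are equal.
    near-≤ : ∀ {n J k m x m′ x′} → Near n J k m x → Near n J k m′ x′ → x ℕ.* m′ ℕ.≤ x′ ℕ.* m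
    near-≤ {n} {J} {k} {m} {x} {m′} {x′} a b = ℕ.≮⇒≥ λ lt → ℕ.<-irrefl refl (begin-strict
      x ℕ.* m′ ℕ.* N
        ≡⟨ ℕS.solve 3 (λ x m N → x ℕS.:* m ℕS.:* N ℕS.:= x ℕS.:* N ℕS.:* m) refl x m′ N ⟩
      x ℕ.* N ℕ.* m′
        <⟨ ℕ.*-monoˡ-< m′ {{ℕ.>-nonZero b.m>0}} a.right ⟩
      (J ℕ.+ 2) ℕ.* (m ℕ.* P) ℕ.* m′
        ≡⟨ ℕS.solve 4 (λ J m P m′ → (J ℕS.:+ ℕS.con 2) ℕS.:* (m ℕS.:* P) ℕS.:* m′ ℕS.:= J ℕS.:* (m′ ℕS.:* P) ℕS.:* m ℕS.:+ ℕS.con 2 ℕS.:* (m ℕS.:* (m′ ℕS.:* P))) refl J m P m′ ⟩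
      J ℕ.* (m′ ℕ.* P) ℕ.* m ℕ.+ 2 ℕ.* W
        ≤⟨ ℕ.+-monoˡ-≤ (2 ℕ.* W) (ℕ.*-monoˡ-≤ m (ℕ.<⇒≤ b.left)) ⟩
      (x′ ℕ.* N ℕ.+ m′ ℕ.* P) ℕ.* m ℕ.+ 2 ℕ.* W
        ≡⟨ ℕS.solve 5 (λ x′ N m′ P m → (x′ ℕS.:* N ℕS.:+ m′ ℕS.:* P) ℕS.:* m ℕS.:+ ℕS.con 2 ℕS.:* (m ℕS.:* (m′ ℕS.:* P)) ℕS.:= x′ ℕS.:* m ℕS.:* N ℕS.:+ ℕS.con 3 ℕS.:* (m ℕS.:* (m′ ℕS.:* P))) refl x′ N m′ P m ⟩
      x′ ℕ.* m ℕ.* N ℕ.+ 3 ℕ.* W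
        ≤⟨ ℕ.+-monoʳ-≤ (x′ ℕ.* m ℕ.* N) (ℕ.≤-trans (ℕ.*-monoˡ-≤ W {3} {4} (ℕ.s≤s (ℕ.s≤s (ℕ.s≤s ℕ.z≤n)))) 4W≤N) ⟩
      x′ ℕ.* m ℕ.* N ℕ.+ N
        ≡⟨ ℕ.+-comm (x′ ℕ.* m ℕ.* N) N ⟩
      suc (x′ ℕ.* m) ℕ.* N
        ≤⟨ ℕ.*-monoˡ-≤ N lt ⟩
      x ℕ.* m′ ℕ.* N ∎)
      where
      open ℕ.≤-Reasoning
      module a = Near a
      module b = Near b
      N = R ℕ.^ n
      P = p ℕ.^ k
      W = m ℕ.* (m′ ℕ.* P)
      4W≤N : 4 ℕ.* W ℕ.≤ N
      4W≤N with ℕ.≤-total m m′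
      ... | inj₁ m≤m′ = ℕ.≤-trans (ℕ.*-monoʳ-≤ 4 (ℕ.*-monoˡ-≤ (m′ ℕ.* P) m≤m′)) b.scale
      ... | inj₂ m′≤m = ℕ.≤-trans (ℕ.*-monoʳ-≤ 4 (ℕ.*-monoʳ-≤ m (ℕ.*-monoˡ-≤ P m′≤m))) a.scale

    around : ℕ → List ℕ
    around y = (y ℕ.∸ 1) ∷ y ∷ suc y ∷ []

    ∈-around : ∀ {y z} → y ℕ.≤ suc z → z ℕ.≤ suc y → z ∈ around y
    ∈-around {y} {z} a b with ℕ.m≤n⇒m<n∨m≡n b
    ... | inj₂ refl = there (there (here refl))
    ... | inj₁ z<1+y with ℕ.m≤n⇒m<n∨m≡n (ℕ.≤-pred z<1+y)
    ...   | inj₂ refl = there (here refl)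
    ...   | inj₁ z<y  = here (ℕ.suc-injective (trans (ℕ.≤-antisym z<y a) (sym (ℕ.m+[n∸m]≡n (ℕ.≤-trans (ℕ.s≤s ℕ.z≤n) z<y)))))

    mp^≢0 : ∀ {m} k → 0 ℕ.< m → ℕ.NonZero (m ℕ.* p ℕ.^ k)
    mp^≢0 k m>0 = ℕ.>-nonZero (ℕ.*-mono-< m>0 (0<p^ k))

    -- One near fraction stands for all, since by `near-≤` they have the same value. The quotient is
    -- the index of the node of level n + `depth n` that contains it. The decision is an argument so
    -- that proofs can analyse it.
    targets-at : ∀ n J k → Dec (∃[ m ] ∃[ x ] Near n J k m x) → List ℕ
    targets-at n J k (no _)              = []
    targets-at n J k (yes (m , x , near)) = around (ℕ._/_ (x ℕ.* R ℕ.^ (n ℕ.+ depth n)) (m ℕ.* p ℕ.^ k) {{mp^≢0 k (Near.m>0 near)}})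

    targets : ℕ → ℕ → ℕ → List ℕ
    targets n J k = targets-at n J k em

    length-targets : ∀ n J k → length (targets n J k) ℕ.≤ 3
    length-targets n J k with em {P = ∃[ m ] ∃[ x ] Near n J k m x}
    ... | yes _ = ℕ.≤-refl
    ... | no _  = ℕ.z≤n

    targets-< : ℕ → ℕ → ℕ → List ℕ
    targets-< n J zero    = []
    targets-< n J (suc k) = targets n J k ++ targets-< n J k

    length-targets-< : ∀ n J k → length (targets-< n J k) ℕ.≤ 3 ℕ.* k
    length-targets-< n J zero    = ℕ.z≤n
    length-targets-< n J (suc k) = subst₂ ℕ._≤_ (sym (List.length-++ (targets n J k))) (sym (ℕ.*-suc 3 k))
      (ℕ.+-mono-≤ (length-targets n J k) (length-targets-< n J k))

    ∈-targets-< : ∀ {n J k K y} → k ℕ.< K → y ∈ targets n J k → y ∈ targets-< n J K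
    ∈-targets-< {n} {J} {k} {suc K} k<1+K y∈ with ℕ.m≤n⇒m<n∨m≡n (ℕ.≤-pred k<1+K)
    ... | inj₁ k<K  = ∈-++⁺ʳ (targets n J K) (∈-targets-< k<K y∈)
    ... | inj₂ refl = ∈-++⁺ˡ y∈

    -- The range k < v n is enough, because 2 ^ k ≤ p ^ k ≤ q < R ^ n = 2 ^ (v n) for every q of
    -- level n.
    forbid : ℕ → ℕ → List ℕ
    forbid n J = targets-< n J (v ℕ.* n)

    few : ∀ n J → ι (length (forbid n J)) ℚ.* qpow (h u) (depth n) ℚ.< ½
    few n J = ℚ.≤-<-trans (ℚ.≤-trans
        (ℚ.*-monoʳ-≤-nonNeg H {{ℚ.nonNegative 0≤H}} (ι-mono-≤ (length-targets-< n J K)))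
        (ℚ.≤-reflexive (trans (cong (ι (3 ℕ.* K) ℚ.*_) (qpow-h u (depth n)))
          (trans (solve 2 (λ a b → a :* b := con ½ :* ((a :+ a) :* b)) refl (ι (3 ℕ.* K)) (h (u ℕ.* depth n)))
            (cong (λ z → ½ ℚ.* (z ℚ.* h (u ℕ.* depth n))) (trans (sym (ι-+ (3 ℕ.* K) (3 ℕ.* K))) (cong ι (ℕS.solve 1 (λ k → ℕS.con 3 ℕS.:* k ℕS.:+ ℕS.con 3 ℕS.:* k ℕS.:= ℕS.con 6 ℕS.:* k) refl K))))))))
      (ℚ.<-≤-trans (ℚ*-mono-< ½ 0<½ (ι*h<1 {6 ℕ.* K} {u ℕ.* depth n} (proj₁ (proj₂ (depth-spec n))))) (ℚ.≤-reflexive (ℚ.*-identityʳ ½)))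
      where
      K = v ℕ.* n
      H = qpow (h u) (depth n)
      0≤H = qpow-nonneg (0≤h u) (depth n)

    -- The chosen fraction x′ / (m′ p ^ k) equals x / (m p ^ k), so the bounds for the latter are
    -- multiplied by m′, rewritten with x m′ = x′ m, and divided by m. A fraction strictly between
    -- the nodes y - 1 and y + 2, counted by left endpoints, lies in one of the three nodes around
    -- y.
    target-hit : ∀ {n J k m x m′ x′ y} → Near n J k m x → (near′ : Near n J k m′ x′) →
      y ℕ.* (m ℕ.* p ℕ.^ k) ℕ.< x ℕ.* R ℕ.^ (n ℕ.+ depth n) ℕ.+ m ℕ.* p ℕ.^ k →
      x ℕ.* R ℕ.^ (n ℕ.+ depth n) ℕ.< (y ℕ.+ 2) ℕ.* (m ℕ.* p ℕ.^ k) → y ∈ around (ℕ._/_ (x′ ℕ.* R ℕ.^ (n ℕ.+ depth n)) (m′ ℕ.* p ℕ.^ k) {{mp^≢0 k (Near.m>0 near′)}})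
    target-hit {n} {J} {k} {m} {x} {m′} {x′} {y} near near′ l r = ∈-around
      (ℕ.≤-pred (subst (y₀ ℕ.<_) (ℕ.+-comm y 2) (ℕ.*-cancelʳ-< Q y₀ (y ℕ.+ 2) (ℕ.≤-<-trans y₀Q≤ r′))))
      (ℕ.≤-pred (ℕ.*-cancelʳ-< Q y (2 ℕ.+ y₀) (ℕ.<-≤-trans l′ (ℕ.≤-trans (ℕ.+-monoˡ-≤ Q (ℕ.<⇒≤ <y₀Q)) (ℕ.≤-reflexive (ℕ.+-comm (suc y₀ ℕ.* Q) Q))))))
      where
      module N = Near near
      module N′ = Near near′
      P = p ℕ.^ k
      Q = m′ ℕ.* P
      S = R ℕ.^ (n ℕ.+ depth n)
      instance
        Q≢0 : ℕ.NonZero Q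
        Q≢0 = mp^≢0 k N′.m>0
      y₀ = (x′ ℕ.* S) ℕ./ Q
      xm′≡x′m : x ℕ.* m′ ≡ x′ ℕ.* m
      xm′≡x′m = ℕ.≤-antisym (near-≤ near near′) (near-≤ near′ near)
      y₀Q≤ : y₀ ℕ.* Q ℕ.≤ x′ ℕ.* S
      y₀Q≤ = subst (y₀ ℕ.* Q ℕ.≤_) (sym (m≡m%n+[m/n]*n (x′ ℕ.* S) Q)) (ℕ.m≤n+m (y₀ ℕ.* Q) _)
      <y₀Q : x′ ℕ.* S ℕ.< suc y₀ ℕ.* Q
      <y₀Q = subst (ℕ._< suc y₀ ℕ.* Q) (sym (m≡m%n+[m/n]*n (x′ ℕ.* S) Q)) (ℕ.+-monoˡ-< (y₀ ℕ.* Q) (m%n<n (x′ ℕ.* S) Q))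
      xSm′ : x ℕ.* S ℕ.* m′ ≡ x′ ℕ.* S ℕ.* m
      xSm′ = trans (ℕS.solve 3 (λ x S m → x ℕS.:* S ℕS.:* m ℕS.:= x ℕS.:* m ℕS.:* S) refl x S m′) (trans (cong (ℕ._* S) xm′≡x′m)
        (ℕS.solve 3 (λ x m S → x ℕS.:* m ℕS.:* S ℕS.:= x ℕS.:* S ℕS.:* m) refl x′ m S))
      l′ : y ℕ.* Q ℕ.< x′ ℕ.* S ℕ.+ Q
      l′ = ℕ.*-cancelʳ-< m (y ℕ.* Q) (x′ ℕ.* S ℕ.+ Q) (subst₂ ℕ._<_
        (ℕS.solve 4 (λ y m P m′ → y ℕS.:* (m ℕS.:* P) ℕS.:* m′ ℕS.:= y ℕS.:* (m′ ℕS.:* P) ℕS.:* m) refl y m P m′)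
        (trans (ℕ.*-distribʳ-+ m′ (x ℕ.* S) (m ℕ.* P)) (trans (cong₂ ℕ._+_ xSm′ (ℕS.solve 3 (λ m P m′ → m ℕS.:* P ℕS.:* m′ ℕS.:= m′ ℕS.:* P ℕS.:* m) refl m P m′)) (sym (ℕ.*-distribʳ-+ m (x′ ℕ.* S) Q))))
        (ℕ.*-monoˡ-< m′ {{ℕ.>-nonZero N′.m>0}} l))
      r′ : x′ ℕ.* S ℕ.< (y ℕ.+ 2) ℕ.* Q
      r′ = ℕ.*-cancelʳ-< m (x′ ℕ.* S) ((y ℕ.+ 2) ℕ.* Q) (subst₂ ℕ._<_ xSm′
        (ℕS.solve 4 (λ y m P m′ → y ℕS.:* (m ℕS.:* P) ℕS.:* m′ ℕS.:= y ℕS.:* (m′ ℕS.:* P) ℕS.:* m) refl (y ℕ.+ 2) m P m′)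
        (ℕ.*-monoˡ-< m′ {{ℕ.>-nonZero N′.m>0}} r))

    targets-hit : ∀ {n J k m x y} → Near n J k m x →
      y ℕ.* (m ℕ.* p ℕ.^ k) ℕ.< x ℕ.* R ℕ.^ (n ℕ.+ depth n) ℕ.+ m ℕ.* p ℕ.^ k →
      x ℕ.* R ℕ.^ (n ℕ.+ depth n) ℕ.< (y ℕ.+ 2) ℕ.* (m ℕ.* p ℕ.^ k) → y ∈ targets n J k
    targets-hit {n} {J} {k} {m} {x} {y} near l r = at em
      where
      at : ∀ d → y ∈ targets-at n J k d
      at (no none)              = ⊥-elim (none (m , x , near))
      at (yes (m′ , x′ , near′)) = target-hit near near′ l r

  -- Distance from the limit point to fractions

  module _ (u-1 p : ℕ) (pr : Prime p) where

    open Construction u-1 p pr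

    -- The level of q = m p ^ k is the n with R ^ (n - 1) < 4 m q ≤ R ^ n.
    Estimate : ℝ → ℕ → Set
    Estimate α q = ∃[ n ] 0 ℕ.< n × 2 ℕ.^ n ℕ.≤ q ℕ.* q ×
      (∀ z → fromℚ (ι q ℚ.* h (v ℕ.* (n ℕ.+ depth n))) ≤ ∣ fromℕ q * α - fromℤ z ∣) ×
      h (v ℕ.* suc (depth n) ℕ.+ 2) ℚ.≤ ι q ℚ.* (ι q ℚ.* h (v ℕ.* (n ℕ.+ depth n))) ℚ.* padicAbs p pr q

  module _ (u-1 p : ℕ) (pr : Prime p) (J : ℕ → ℕ) (J₀ : J 0 ≡ 1)
    (bounds : ∀ t j → J j ℕ.* Construction.R u-1 p pr ℕ.^ t ℕ.≤ J (j ℕ.+ t) × J (j ℕ.+ t) ℕ.< suc (J j) ℕ.* Construction.R u-1 p pr ℕ.^ t)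
    (avoid : ∀ n → J (suc n ℕ.+ Construction.depth u-1 p pr (suc n)) ∉ Construction.forbid u-1 p pr (suc n) (J (suc n))) where

    open Construction u-1 p pr

    approximant : ℕ → ℚ
    approximant n = ι (J n) ℚ.* h (v ℕ.* n)

    R^-shift : ∀ a L t → ι (a ℕ.* R ℕ.^ t) ℚ.* h (v ℕ.* (L ℕ.+ t)) ≡ ι a ℚ.* h (v ℕ.* L)
    R^-shift a L t = begin
      ι (a ℕ.* R ℕ.^ t) ℚ.* h (v ℕ.* (L ℕ.+ t))
        ≡⟨ cong₂ ℚ._*_ (ι-* a (R ℕ.^ t)) (trans (cong h (ℕ.*-distribˡ-+ v L t)) (h-+ (v ℕ.* L) (v ℕ.* t))) ⟩
      (ι a ℚ.* ι (R ℕ.^ t)) ℚ.* (h (v ℕ.* L) ℚ.* h (v ℕ.* t))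
        ≡⟨ solve 4 (λ a b c d → (a :* b) :* (c :* d) := (a :* c) :* (b :* d)) refl (ι a) (ι (R ℕ.^ t)) (h (v ℕ.* L)) (h (v ℕ.* t)) ⟩
      (ι a ℚ.* h (v ℕ.* L)) ℚ.* (ι (R ℕ.^ t) ℚ.* h (v ℕ.* t))
        ≡⟨ cong ((ι a ℚ.* h (v ℕ.* L)) ℚ.*_) (R^*h t) ⟩
      (ι a ℚ.* h (v ℕ.* L)) ℚ.* 1ℚ
        ≡⟨ ℚ.*-identityʳ (ι a ℚ.* h (v ℕ.* L)) ⟩
      ι a ℚ.* h (v ℕ.* L) ∎
      where open ≡-Reasoning

    approximant-bounds : ∀ {L n} → L ℕ.≤ n → approximant L ℚ.≤ approximant n × approximant n ℚ.≤ approximant L ℚ.+ h (v ℕ.* L)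
    approximant-bounds {L} {n} L≤n = subst (λ n → approximant L ℚ.≤ approximant n × approximant n ℚ.≤ approximant L ℚ.+ h (v ℕ.* L))
      (ℕ.m+[n∸m]≡n L≤n)
      ( ℚ.≤-trans (ℚ.≤-reflexive (sym (R^-shift (J L) L t))) (mono (proj₁ (bounds t L)))
      , ℚ.≤-trans (mono (ℕ.<⇒≤ (proj₂ (bounds t L)))) (ℚ.≤-reflexive (trans (R^-shift (suc (J L)) L t)
          (trans (cong (ℚ._* h (v ℕ.* L)) (ι-suc (J L))) (solve 2 (λ j h → (con 1ℚ :+ j) :* h := j :* h :+ h) refl (ι (J L)) (h (v ℕ.* L)))))))
      where
      t = n ℕ.∸ L
      mono : ∀ {a b} → a ℕ.≤ b → ι a ℚ.* h (v ℕ.* (L ℕ.+ t)) ℚ.≤ ι b ℚ.* h (v ℕ.* (L ℕ.+ t))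
      mono a≤b = ℚ.*-monoʳ-≤-nonNeg (h (v ℕ.* (L ℕ.+ t))) {{ℚ.nonNegative (0≤h (v ℕ.* (L ℕ.+ t)))}} (ι-mono-≤ a≤b)

    α : ℝ
    α = mkℝ approximant λ ε ε>0 →
      let N , hN≤ = h-null (½ ℚ.* ε) (0<* 0<½ ε>0)
          hvN≤ = ℚ.≤-trans (h-mono (ℕ.m≤n*m N v)) hN≤
          near : ∀ m n → N ℕ.≤ m → N ℕ.≤ n → approximant m ℚ.≤ approximant n ℚ.+ ½ ℚ.* ε
          near m n N≤m N≤n = ≤-by (gap (proj₂ (approximant-bounds N≤m)) ⊞ gap (proj₁ (approximant-bounds N≤n)) ⊞ gap hvN≤)
            (solve 5 (λ m n N w e → n :+ e := m :+ ((N :+ w :- m) :+ (n :- N) :+ (e :- w))) refl (approximant m) (approximant n) (approximant N) (h (v ℕ.* N)) (½ ℚ.* ε))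
      in N , λ m n N≤m N≤n → ℚ.≤-<-trans (⇒∣∣≤ {approximant m} {approximant n} (near m n N≤m N≤n) (near n m N≤n N≤m)) (half< ε ε>0)

    approximant≤α : ∀ L → fromℚ (approximant L) ≤ α
    approximant≤α L = ev⇒≤ {fromℚ (approximant L)} {α} λ ε ε>0 → L , λ n L≤n →
      ℚ.≤-trans (proj₁ (approximant-bounds L≤n)) (≤-by (ℚ.<⇒≤ ε>0) refl)

    α≤approximant : ∀ L → α ≤ fromℚ (approximant L ℚ.+ h (v ℕ.* L))
    α≤approximant L = ev⇒≤ {α} {fromℚ (approximant L ℚ.+ h (v ℕ.* L))} λ ε ε>0 → L , λ n L≤n →
      ℚ.≤-trans (proj₂ (approximant-bounds L≤n)) (≤-by (ℚ.<⇒≤ ε>0) refl)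

    0<J : ∀ L → 0 ℕ.< J L
    0<J L = ℕ.<-≤-trans (0<R^ L) (subst (ℕ._≤ J L) (trans (cong (ℕ._* R ℕ.^ L) J₀) (ℕ.*-identityˡ (R ℕ.^ L))) (proj₁ (bounds L 0)))

    -- As α lies between J L / R ^ L and (J L + 1) / R ^ L, an integer z with |q α - z| < q R ^ (-
    -- L) puts z / q less than one node length outside this interval. These are the inequalities of
    -- `Near`, at level L.
    close⇒ : ∀ q L z → 0 ℕ.< q → ∣ fromℕ q * α - fromℤ z ∣ < fromℚ (ι q ℚ.* h (v ℕ.* L)) →
      ∃[ x ] J L ℕ.* q ℕ.< x ℕ.* R ℕ.^ L ℕ.+ q × x ℕ.* R ℕ.^ L ℕ.< (J L ℕ.+ 2) ℕ.* q
    close⇒ q L z 0<q close = conclude z lower upper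
      where
      r = h (v ℕ.* L)
      S = ι (R ℕ.^ L)
      Q = fromℕ q
      0≤Q : 0ℝ ≤ Q
      0≤Q = fromℚ-mono-≤ {0ℚ} {ι q} (0≤ι q)
      D = Q * α - fromℤ z
      scale : ∀ {a b} → a ℚ.< b → S ℚ.* a ℚ.< S ℚ.* b
      scale = ℚ*-mono-< S (ι-mono-< {0} (0<R^ L))
      lower₀ : ι q ℚ.* approximant L ℚ.- κ z ℚ.< ι q ℚ.* r
      lower₀ = fromℚ-cancel-< (≤-<-trans {fromℚ (ι q ℚ.* approximant L ℚ.- κ z)} {D} {fromℚ (ι q ℚ.* r)}
        (≤-cert {fromℚ (ι q ℚ.* approximant L ℚ.- κ z)} {D} {Q * (α - fromℚ (approximant L))}
          (0≤-* {Q} {α - fromℚ (approximant L)} 0≤Q (0≤gap {fromℚ (approximant L)} {α} (approximant≤α L)))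
          λ n → solve 4 (λ q a l z → q :* a :+ :- z := (q :* l :- z) :+ q :* (a :+ :- l)) refl (ι q) (seq α n) (approximant L) (κ z))
        (≤-<-trans {D} {∣ D ∣} {fromℚ (ι q ℚ.* r)} (x≤∣x∣ D) close))
      lower : S ℚ.* (ι q ℚ.* approximant L) ℚ.< S ℚ.* (κ z ℚ.+ ι q ℚ.* r)
      lower = scale (<-by (gap< lower₀) (solve 3 (λ a z b → z :+ b := a :+ (b :- (a :- z))) refl (ι q ℚ.* approximant L) (κ z) (ι q ℚ.* r)))
      upper₀ : κ z ℚ.- ι q ℚ.* (approximant L ℚ.+ r) ℚ.< ι q ℚ.* r
      upper₀ = fromℚ-cancel-< (≤-<-trans {fromℚ (κ z ℚ.- ι q ℚ.* (approximant L ℚ.+ r))} { - D} {fromℚ (ι q ℚ.* r)}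
        (≤-cert {fromℚ (κ z ℚ.- ι q ℚ.* (approximant L ℚ.+ r))} { - D} {Q * (fromℚ (approximant L ℚ.+ r) - α)}
          (0≤-* {Q} {fromℚ (approximant L ℚ.+ r) - α} 0≤Q (0≤gap {α} {fromℚ (approximant L ℚ.+ r)} (α≤approximant L)))
          λ n → solve 4 (λ q a l z → :- (q :* a :+ :- z) := (z :- q :* l) :+ q :* (l :+ :- a)) refl (ι q) (seq α n) (approximant L ℚ.+ r) (κ z))
        (≤-<-trans { - D} {∣ D ∣} {fromℚ (ι q ℚ.* r)} (-x≤∣x∣ D) close))
      upper : S ℚ.* κ z ℚ.< S ℚ.* (ι q ℚ.* (approximant L ℚ.+ r) ℚ.+ ι q ℚ.* r)
      upper = scale (<-by (gap< upper₀) (solve 3 (λ z a b → a :+ b := z :+ (b :- (z :- a))) refl (κ z) (ι q ℚ.* (approximant L ℚ.+ r)) (ι q ℚ.* r)))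
      Sr : ∀ a → S ℚ.* (a ℚ.* r) ≡ a
      Sr a = trans (solve 3 (λ s a r → s :* (a :* r) := a :* (s :* r)) refl S a r) (trans (cong (a ℚ.*_) (R^*h L)) (ℚ.*-identityʳ a))
      lhs : S ℚ.* (ι q ℚ.* approximant L) ≡ ι (J L ℕ.* q)
      lhs = trans (cong (S ℚ.*_) (solve 3 (λ q j r → q :* (j :* r) := (j :* q) :* r) refl (ι q) (ι (J L)) r)) (trans (Sr (ι (J L) ℚ.* ι q)) (sym (ι-* (J L) q)))
      rhs : ∀ z → S ℚ.* (κ z ℚ.+ ι q ℚ.* r) ≡ κ z ℚ.* S ℚ.+ ι q
      rhs z = trans (ℚ.*-distribˡ-+ S (κ z) (ι q ℚ.* r)) (cong₂ ℚ._+_ (ℚ.*-comm S (κ z)) (Sr (ι q)))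
      rhs′ : S ℚ.* (ι q ℚ.* (approximant L ℚ.+ r) ℚ.+ ι q ℚ.* r) ≡ ι ((J L ℕ.+ 2) ℕ.* q)
      rhs′ = trans (cong (S ℚ.*_) (solve 3 (λ q j r → q :* (j :* r :+ r) :+ q :* r := ((j :+ con (ι 2)) :* q) :* r) refl (ι q) (ι (J L)) r))
        (trans (Sr ((ι (J L) ℚ.+ ι 2) ℚ.* ι q)) (trans (cong (ℚ._* ι q) (sym (ι-+ (J L) 2))) (sym (ι-* (J L ℕ.+ 2) q))))
      conclude : ∀ z → S ℚ.* (ι q ℚ.* approximant L) ℚ.< S ℚ.* (κ z ℚ.+ ι q ℚ.* r) →
        S ℚ.* κ z ℚ.< S ℚ.* (ι q ℚ.* (approximant L ℚ.+ r) ℚ.+ ι q ℚ.* r) →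
        ∃[ x ] J L ℕ.* q ℕ.< x ℕ.* R ℕ.^ L ℕ.+ q × x ℕ.* R ℕ.^ L ℕ.< (J L ℕ.+ 2) ℕ.* q
      conclude (+ x) l g = x ,
        ι-cancel-< (subst₂ ℚ._<_ lhs (trans (rhs (+ x)) (trans (cong (ℚ._+ ι q) (sym (ι-* x (R ℕ.^ L)))) (sym (ι-+ (x ℕ.* R ℕ.^ L) q)))) l) ,
        ι-cancel-< (subst₂ ℚ._<_ (trans (ℚ.*-comm S (ι x)) (sym (ι-* x (R ℕ.^ L)))) rhs′ g)
      -- A negative z would give J L · q < q, but the path starts from node 1, which makes J L
      -- positive.
      conclude -[1+ k ] l g = ⊥-elim (ℕ.<-irrefl refl (ℕ.<-≤-trans
        (ι-cancel-< {J L ℕ.* q} {q} (ℚ.<-≤-trans (subst₂ ℚ._<_ lhs (rhs -[1+ k ]) l)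
          (≤-by (ℚ.<⇒≤ (gap< (κ-mono-< {ℤ.-[1+ k ]} {+ 0} ℤ.-<+)) ⊠ 0≤ι (R ℕ.^ L)) (solve 3 (λ q z s → q := (z :* s :+ q) :+ (con 0ℚ :- z) :* s) refl (ι q) (κ -[1+ k ]) S))))
        (ℕ.m≤n*m q (J L) {{ℕ.>-nonZero (0<J L)}})))

    estimate-at : ∀ q → R ℕ.^ 4 ℕ.≤ q → ∀ m → q ≡ m ℕ.* p ℕ.^ val p q → Estimate u-1 p pr α q
    estimate-at q R⁴≤q m q≡ = go (least-index (λ n → M ℕ.≤? R ℕ.^ n) M (ℕ.≤-trans (n≤2^n M) (subst (2 ℕ.^ M ℕ.≤_) (sym (R^≡2^ M)) (ℕ.^-monoʳ-≤ 2 (ℕ.m≤n*m M v)))))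
      where
      k = val p q
      M = 4 ℕ.* (m ℕ.* q)
      q>0 : 0 ℕ.< q
      q>0 = ℕ.<-≤-trans (0<R^ 4) R⁴≤q
      m>0 : 0 ℕ.< m
      m>0 = positive m q≡
        where
        positive : ∀ m → q ≡ m ℕ.* p ℕ.^ k → 0 ℕ.< m
        positive zero    e = ⊥-elim (ℕ.<-irrefl (sym e) q>0)
        positive (suc _) _ = ℕ.s≤s ℕ.z≤n
      m≤q : m ℕ.≤ q
      m≤q = subst (m ℕ.≤_) (sym q≡) (ℕ.m≤m*n m (p ℕ.^ k) {{ℕ.>-nonZero (0<p^ k)}})
      q≤mq : q ℕ.≤ m ℕ.* q
      q≤mq = ℕ.m≤n*m q m {{ℕ.>-nonZero m>0}}
      4q≤M : 4 ℕ.* q ℕ.≤ M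
      4q≤M = ℕ.*-monoʳ-≤ 4 q≤mq
      π = padicAbs p pr q
      qπ≡m : ι q ℚ.* π ≡ ι m
      qπ≡m = trans (cong (λ z → ι z ℚ.* π) q≡) (trans (cong (ℚ._* π) (ι-* m (p ℕ.^ k)))
        (trans (ℚ.*-assoc (ι m) (ι (p ℕ.^ k)) π) (trans (cong (ι m ℚ.*_) (*-inverse-/ (p ℕ.^ k) {{ℕ.m^n≢0 p k {{prime⇒nonZero pr}}}})) (ℚ.*-identityʳ (ι m)))))
      go : (∃[ n ] M ℕ.≤ R ℕ.^ n × (∀ n′ → n ≡ suc n′ → ¬ M ℕ.≤ R ℕ.^ n′)) → Estimate u-1 p pr α q
      go (zero , M≤1 , _) = ⊥-elim (ℕ.<-irrefl refl (ℕ.≤-trans (ℕ.s≤s (ℕ.s≤s ℕ.z≤n)) (ℕ.≤-trans (ℕ.≤-trans (ℕ.*-monoʳ-≤ 4 q>0) 4q≤M) M≤1)))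
      go (suc n′ , M≤R^n , ¬M≤) = n , ℕ.s≤s ℕ.z≤n , large , far , bound
        where
        n = suc n′
        t = depth n
        L = n ℕ.+ t
        R^n′<M : R ℕ.^ n′ ℕ.< M
        R^n′<M = ℕ.≰⇒> (¬M≤ n′ refl)
        R^-cancel-< : ∀ {a b} → R ℕ.^ a ℕ.< R ℕ.^ b → a ℕ.< b
        R^-cancel-< {a} {b} lt = ℕ.≰⇒> λ b≤a → ℕ.<-irrefl refl (ℕ.<-≤-trans lt
          (ℕ.^-monoʳ-≤ R {{ℕ.>-nonZero (subst (0 ℕ.<_) (ℕ.*-identityʳ R) (0<R^ 1))}} b≤a))
        4≤n′ : 4 ℕ.≤ n′
        4≤n′ = ℕ.≤-pred (R^-cancel-< {4} {n} (ℕ.≤-<-trans R⁴≤q (ℕ.<-≤-trans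
          (subst (q ℕ.<_) (ℕ.*-comm q 4) (ℕ.m<m*n q 4 {{ℕ.>-nonZero q>0}} (ℕ.s≤s (ℕ.s≤s ℕ.z≤n)))) (ℕ.≤-trans 4q≤M M≤R^n))))
        -- From 4 · 2 ^ n ≤ 2 ^ (v n′) = R ^ n′ < 4 m q ≤ 4 q². The first inequality needs n′ + 3 ≤
        -- v n′, for which n′ ≥ 3 suffices; the lower bound R ^ 4 on q provides n′ ≥ 4. The purpose
        -- is n log 2 ≤ 2 log q.
        large : 2 ℕ.^ n ℕ.≤ q ℕ.* q
        large = ℕ.*-cancelˡ-≤ 4 (ℕ.≤-trans (ℕ.≤-reflexive (sym (ℕ.^-distribˡ-+-* 2 2 n)))
          (ℕ.≤-trans (ℕ.^-monoʳ-≤ 2 exponent) (ℕ.≤-trans (ℕ.≤-reflexive (sym (R^≡2^ n′)))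
            (ℕ.≤-trans (ℕ.<⇒≤ R^n′<M) (ℕ.*-monoʳ-≤ 4 (ℕ.*-monoˡ-≤ q m≤q))))))
          where
          exponent : 2 ℕ.+ n ℕ.≤ v ℕ.* n′
          exponent = ℕ.≤-trans (ℕ.+-monoˡ-≤ n′ {3} {n′} (ℕ.≤-trans (ℕ.n≤1+n 3) 4≤n′))
            (ℕ.+-monoʳ-≤ n′ (ℕ.m≤n*m n′ u))
        k<vn : k ℕ.< v ℕ.* n
        k<vn = ℕ.≰⇒> λ vn≤k → ℕ.<-irrefl refl (begin-strict
          R ℕ.^ n             ≡⟨ R^≡2^ n ⟩
          2 ℕ.^ (v ℕ.* n)     ≤⟨ ℕ.^-monoʳ-≤ 2 vn≤k ⟩
          2 ℕ.^ k             ≤⟨ ℕ.^-monoˡ-≤ k 2≤p ⟩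
          p ℕ.^ k             ≤⟨ ℕ.m≤n*m (p ℕ.^ k) m {{ℕ.>-nonZero m>0}} ⟩
          m ℕ.* p ℕ.^ k       ≡⟨ sym q≡ ⟩
          q                   <⟨ ℕ.m<m*n q 4 {{ℕ.>-nonZero q>0}} (ℕ.s≤s (ℕ.s≤s ℕ.z≤n)) ⟩
          q ℕ.* 4             ≡⟨ ℕ.*-comm q 4 ⟩
          4 ℕ.* q             ≤⟨ 4q≤M ⟩
          M                   ≤⟨ M≤R^n ⟩
          R ℕ.^ n             ∎)
          where open ℕ.≤-Reasoning
        JL = J L
        -- Nearness to a node of level L passes to its ancestor of level n, because the ancestor
        -- contains the node and the margin of one node length only grows.
        near : ∀ x → JL ℕ.* q ℕ.< x ℕ.* R ℕ.^ L ℕ.+ q → x ℕ.* R ℕ.^ L ℕ.< (JL ℕ.+ 2) ℕ.* q → Near n (J n) k m x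
        near x l g = record
          { m>0 = m>0
          ; scale = subst (λ z → 4 ℕ.* (m ℕ.* z) ℕ.≤ R ℕ.^ n) q≡ M≤R^n
          ; left = subst (λ z → J n ℕ.* z ℕ.< x ℕ.* R ℕ.^ n ℕ.+ z) q≡ left
          ; right = subst (λ z → x ℕ.* R ℕ.^ n ℕ.< (J n ℕ.+ 2) ℕ.* z) q≡ right }
          where
          open ℕ.≤-Reasoning
          Rt = R ℕ.^ t
          R^L≡ : R ℕ.^ L ≡ R ℕ.^ n ℕ.* Rt
          R^L≡ = ℕ.^-distribˡ-+-* R n t
          q≤qRt : q ℕ.≤ q ℕ.* Rt
          q≤qRt = ℕ.m≤m*n q Rt {{ℕ.>-nonZero (0<R^ t)}}
          left : J n ℕ.* q ℕ.< x ℕ.* R ℕ.^ n ℕ.+ q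
          left = ℕ.*-cancelʳ-< Rt (J n ℕ.* q) (x ℕ.* R ℕ.^ n ℕ.+ q) (begin-strict
            J n ℕ.* q ℕ.* Rt               ≡⟨ ℕS.solve 3 (λ j q r → j ℕS.:* q ℕS.:* r ℕS.:= j ℕS.:* r ℕS.:* q) refl (J n) q Rt ⟩
            J n ℕ.* Rt ℕ.* q               ≤⟨ ℕ.*-monoˡ-≤ q (proj₁ (bounds t n)) ⟩
            JL ℕ.* q                       <⟨ l ⟩
            x ℕ.* R ℕ.^ L ℕ.+ q            ≤⟨ ℕ.+-monoʳ-≤ (x ℕ.* R ℕ.^ L) q≤qRt ⟩
            x ℕ.* R ℕ.^ L ℕ.+ q ℕ.* Rt     ≡⟨ cong (ℕ._+ q ℕ.* Rt) (trans (cong (x ℕ.*_) R^L≡) (sym (ℕ.*-assoc x (R ℕ.^ n) Rt))) ⟩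
            x ℕ.* R ℕ.^ n ℕ.* Rt ℕ.+ q ℕ.* Rt ≡⟨ sym (ℕ.*-distribʳ-+ Rt (x ℕ.* R ℕ.^ n) q) ⟩
            (x ℕ.* R ℕ.^ n ℕ.+ q) ℕ.* Rt   ∎)
          right : x ℕ.* R ℕ.^ n ℕ.< (J n ℕ.+ 2) ℕ.* q
          right = ℕ.*-cancelʳ-< Rt (x ℕ.* R ℕ.^ n) ((J n ℕ.+ 2) ℕ.* q) (begin-strict
            x ℕ.* R ℕ.^ n ℕ.* Rt           ≡⟨ trans (ℕ.*-assoc x (R ℕ.^ n) Rt) (cong (x ℕ.*_) (sym R^L≡)) ⟩
            x ℕ.* R ℕ.^ L                  <⟨ g ⟩
            (JL ℕ.+ 2) ℕ.* q               ≡⟨ ℕS.solve 2 (λ j q → (j ℕS.:+ ℕS.con 2) ℕS.:* q ℕS.:= (ℕS.con 1 ℕS.:+ j) ℕS.:* q ℕS.:+ q) refl JL q ⟩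
            suc JL ℕ.* q ℕ.+ q             ≤⟨ ℕ.+-mono-≤ (ℕ.*-monoˡ-≤ q (proj₂ (bounds t n))) q≤qRt ⟩
            suc (J n) ℕ.* Rt ℕ.* q ℕ.+ q ℕ.* Rt ≡⟨ ℕS.solve 3 (λ j q r → (ℕS.con 1 ℕS.:+ j) ℕS.:* r ℕS.:* q ℕS.:+ q ℕS.:* r ℕS.:= (j ℕS.:+ ℕS.con 2) ℕS.:* q ℕS.:* r) refl (J n) q Rt ⟩
            (J n ℕ.+ 2) ℕ.* q ℕ.* Rt       ∎)
        far : ∀ z → fromℚ (ι q ℚ.* h (v ℕ.* L)) ≤ ∣ fromℕ q * α - fromℤ z ∣
        far z close = let x , l , g = close⇒ q L z q>0 close in
          avoid n′ (∈-targets-< k<vn (targets-hit (near x l g)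
            (subst (λ z → JL ℕ.* z ℕ.< x ℕ.* R ℕ.^ L ℕ.+ z) q≡ l)
            (subst (λ z → x ℕ.* R ℕ.^ L ℕ.< (JL ℕ.+ 2) ℕ.* z) q≡ g)))
        -- As q |q|_p = m, the right side is m q R ^ (- L) with L = n + t, and 4 m q > R ^ (n - 1)
        -- leaves R ^ (- t - 1) / 4.
        bound : h (v ℕ.* suc t ℕ.+ 2) ℚ.≤ ι q ℚ.* (ι q ℚ.* h (v ℕ.* L)) ℚ.* π
        bound = begin
          h (v ℕ.* suc t ℕ.+ 2)
            ≡⟨ h-+ (v ℕ.* suc t) 2 ⟩
          h (v ℕ.* suc t) ℚ.* h 2
            ≡⟨ cong (ℚ._* h 2) (trans (sym (ℚ.*-identityˡ (h (v ℕ.* suc t)))) (cong (ℚ._* h (v ℕ.* suc t)) (sym (R^*h n′)))) ⟩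
          ι (R ℕ.^ n′) ℚ.* h (v ℕ.* n′) ℚ.* h (v ℕ.* suc t) ℚ.* h 2
            ≤⟨ ≤-by (gap (ι-mono-≤ (ℕ.<⇒≤ R^n′<M)) ⊠ 0≤h (v ℕ.* n′) ⊠ 0≤h (v ℕ.* suc t) ⊠ 0≤h 2)
                (solve 4 (λ a b c d → b :* c :* d :* con (h 2) := a :* c :* d :* con (h 2) :+ (b :- a) :* c :* d :* con (h 2)) refl (ι (R ℕ.^ n′)) (ι M) (h (v ℕ.* n′)) (h (v ℕ.* suc t))) ⟩
          ι M ℚ.* h (v ℕ.* n′) ℚ.* h (v ℕ.* suc t) ℚ.* h 2
            ≡⟨ trans (cong (λ z → z ℚ.* h (v ℕ.* n′) ℚ.* h (v ℕ.* suc t) ℚ.* h 2) (trans (ι-* 4 (m ℕ.* q)) (cong (ι 4 ℚ.*_) (ι-* m q))))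
                (solve 4 (λ m q c d → (con (ι 4) :* (m :* q)) :* c :* d :* con (h 2) := m :* (q :* (c :* d))) refl (ι m) (ι q) (h (v ℕ.* n′)) (h (v ℕ.* suc t))) ⟩
          ι m ℚ.* (ι q ℚ.* (h (v ℕ.* n′) ℚ.* h (v ℕ.* suc t)))
            ≡⟨ cong₂ (λ a b → a ℚ.* (ι q ℚ.* b)) (sym qπ≡m) (trans (sym (h-+ (v ℕ.* n′) (v ℕ.* suc t)))
                (cong h (trans (sym (ℕ.*-distribˡ-+ v n′ (suc t))) (cong (v ℕ.*_) (ℕ.+-suc n′ t))))) ⟩
          ι q ℚ.* π ℚ.* (ι q ℚ.* h (v ℕ.* L))
            ≡⟨ solve 3 (λ q π h → q :* π :* (q :* h) := q :* (q :* h) :* π) refl (ι q) π (h (v ℕ.* L)) ⟩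
          ι q ℚ.* (ι q ℚ.* h (v ℕ.* L)) ℚ.* π ∎
          where open ℚ.≤-Reasoning

    estimate : ∀ q → R ℕ.^ 4 ℕ.≤ q → Estimate u-1 p pr α q
    estimate q R⁴≤q = quotient (val-divides p q)
      where
      quotient : PowerDivides p q (val p q) → Estimate u-1 p pr α q
      quotient (divides-by (divides m q≡)) = estimate-at q R⁴≤q m q≡

  -- Existence of suprema and infima

  ≰⇒> : ∀ {x y} → ¬ (x ≤ y) → y < x
  ≰⇒> {x} {y} x≰y with em {P = y < x}
  ... | yes y<x = y<x
  ... | no y≮x  = ⊥-elim (x≰y y≮x)

  ≤-or-> : ∀ x y → x ≤ y ⊎ y < x
  ≤-or-> x y with em {P = y < x}
  ... | yes y<x = inj₂ y<x
  ... | no y≮x  = inj₁ y≮x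

  -- The chosen object appears as a variable z with an equation, so that the type checker does not
  -- unfold it. The hypotheses of the form z ≡ ... in later lemmas serve the same end.
  choose-spec : ∀ {a ℓ} {A : Set a} (d : A) (P : A → Set ℓ) z → z ≡ Classical.choose em d P → ∃ P → P z
  choose-spec d P z eq ∃P with em {P = ∃ P}
  ... | yes (y , Py) = subst P (sym eq) Py
  ... | no ∄P        = ⊥-elim (∄P ∃P)

  -- Suprema by bisection
  module Bisection {ℓ} (UB : ℚ → Set ℓ) (mono : ∀ {p q} → p ℚ.≤ q → UB p → UB q)
    (lo₀ hi₀ : ℚ) (¬lo₀ : ¬ UB lo₀) (UBhi₀ : UB hi₀) where

    next : ℚ × ℚ → ℚ × ℚ
    next (l , u) with em {P = UB (½ ℚ.* (l ℚ.+ u))}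
    ... | yes _ = l , ½ ℚ.* (l ℚ.+ u)
    ... | no _  = ½ ℚ.* (l ℚ.+ u) , u

    bisect : ℕ → ℚ × ℚ
    bisect zero    = lo₀ , hi₀
    bisect (suc n) = next (bisect n)

    lo hi : ℕ → ℚ
    lo n = proj₁ (bisect n)
    hi n = proj₂ (bisect n)

    width : ℚ
    width = hi₀ ℚ.- lo₀

    below : ∀ {p q} → ¬ UB p → UB q → p ℚ.≤ q
    below {p} {q} ¬p uq with ℚ.≤-total p q
    ... | inj₁ p≤q = p≤q
    ... | inj₂ q≤p = ⊥-elim (¬p (mono q≤p uq))

    Invariant : ℚ → ℚ × ℚ → Set ℓ
    Invariant w (l , u) = (¬ UB l) × UB u × u ℚ.- l ≡ w

    next-invariant : ∀ {w} s → Invariant w s → Invariant (½ ℚ.* w) (next s) × proj₁ s ℚ.≤ proj₁ (next s) × proj₂ (next s) ℚ.≤ proj₂ s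
    next-invariant (l , u) (¬l , Uu , eq) with em {P = UB (½ ℚ.* (l ℚ.+ u))}
    ... | yes y = (¬l , y , trans (solve 2 (λ l u → con ½ :* (l :+ u) :- l := con ½ :* (u :- l)) refl l u) (cong (½ ℚ.*_) eq)) ,
                  ℚ.≤-refl ,
                  ≤-by (0≤½ ⊠ gap (below ¬l Uu)) (solve 2 (λ l u → u := con ½ :* (l :+ u) :+ con ½ :* (u :- l)) refl l u)
    ... | no n  = (n , Uu , trans (solve 2 (λ l u → u :- con ½ :* (l :+ u) := con ½ :* (u :- l)) refl l u) (cong (½ ℚ.*_) eq)) ,
                  ≤-by (0≤½ ⊠ gap (below ¬l Uu)) (solve 2 (λ l u → con ½ :* (l :+ u) := l :+ con ½ :* (u :- l)) refl l u) ,
                  ℚ.≤-refl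

    invariant : ∀ n → Invariant (h n ℚ.* width) (bisect n)
    invariant zero    = ¬lo₀ , UBhi₀ , sym (ℚ.*-identityˡ width)
    invariant (suc n) = subst (λ w → Invariant w (bisect (suc n))) (sym (ℚ.*-assoc ½ (h n) width))
      (proj₁ (next-invariant (bisect n) (invariant n)))

    hi-antitone : ∀ m k → hi (m ℕ.+ k) ℚ.≤ hi m
    hi-antitone m zero    = ℚ.≤-reflexive (cong hi (ℕ.+-identityʳ m))
    hi-antitone m (suc k) = ℚ.≤-trans (ℚ.≤-reflexive (cong hi (ℕ.+-suc m k)))
      (ℚ.≤-trans (proj₂ (proj₂ (next-invariant (bisect (m ℕ.+ k)) (invariant (m ℕ.+ k))))) (hi-antitone m k))

    hi-between : ∀ {m n} → m ℕ.≤ n → hi n ℚ.≤ hi m × hi m ℚ.≤ hi n ℚ.+ h m ℚ.* width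
    hi-between {m} {n} m≤n = subst (λ k → hi k ℚ.≤ hi m) (ℕ.m+[n∸m]≡n m≤n) (hi-antitone m (n ℕ.∸ m)) ,
      ≤-by (gap (below (proj₁ (invariant m)) (proj₁ (proj₂ (invariant n)))))
        (trans (cong (hi n ℚ.+_) (sym (proj₂ (proj₂ (invariant m))))) (solve 3 (λ l u v → v :+ (u :- l) := u :+ (v :- l)) refl (lo m) (hi m) (hi n)))

    0≤width : 0ℚ ℚ.≤ width
    0≤width = gap (below ¬lo₀ UBhi₀)

    thin : ∀ ε → 0ℚ ℚ.< ε → ∃[ n ] h n ℚ.* width ℚ.≤ ε
    thin ε ε>0 =
      let A , w≤A = archimedean width
          δ , δ>0 , _ , Aδ≤ε = small A 0 ε ε>0
          n , hn≤δ = h-null δ δ>0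
      in n , ℚ.≤-trans (≤-by (gap hn≤δ ⊠ 0≤width ⊞ ℚ.<⇒≤ δ>0 ⊠ gap w≤A ⊞ ℚ.<⇒≤ δ>0)
        (solve 4 (λ x w d a → (a :+ con 0ℚ :+ con 1ℚ) :* d := x :* w :+ ((d :- x) :* w :+ d :* (a :- w) :+ d)) refl (h n) width δ (ι A))) Aδ≤ε

    limit : ℝ
    limit = mkℝ hi λ ε ε>0 →
      let N , le = thin (½ ℚ.* ε) (0<* 0<½ ε>0)
          w = h N ℚ.* width
          near : ∀ m n → N ℕ.≤ m → N ℕ.≤ n → hi m ℚ.≤ hi n ℚ.+ ½ ℚ.* ε
          near m n N≤m N≤n = ≤-by (gap (proj₁ (hi-between N≤m)) ⊞ gap (proj₂ (hi-between N≤n)) ⊞ gap le)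
            (solve 5 (λ a b c w v → b :+ v := a :+ ((c :- a) :+ (b :+ w :- c) :+ (v :- w))) refl (hi m) (hi n) (hi N) w (½ ℚ.* ε))
      in N , λ m n N≤m N≤n → ℚ.≤-<-trans (⇒∣∣≤ {hi m} {hi n} (near m n N≤m N≤n) (near n m N≤n N≤m)) (half< ε ε>0)

    limit≥ : ∀ x → (∀ q → UB q → x ≤ fromℚ q) → x ≤ limit
    limit≥ x bound = ≤-+ε {x} {limit} λ ε ε>0 →
      let N , le = thin ε ε>0 in ≤-trans {x} {fromℚ (hi N)} {limit + fromℚ ε} (bound (hi N) (proj₁ (proj₂ (invariant N))))
        (ev⇒≤ {fromℚ (hi N)} {limit + fromℚ ε} λ η η>0 → N , λ n N≤n → ≤-by (gap (proj₂ (hi-between N≤n)) ⊞ gap le ⊞ ℚ.<⇒≤ η>0)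
          (solve 5 (λ a b w e f → b :+ e :+ f := a :+ ((b :+ w :- a) :+ (e :- w) :+ f)) refl (hi N) (hi n) (h N ℚ.* width) ε η))

    limit≤ : ∀ y → (∀ q → ¬ UB q → fromℚ q ≤ y) → limit ≤ y
    limit≤ y bound = ≤-+ε {limit} {y} λ ε ε>0 →
      let N , le = thin ε ε>0 in ≤-trans {limit} {fromℚ (lo N ℚ.+ ε)} {y + fromℚ ε}
        (ev⇒≤ {limit} {fromℚ (lo N ℚ.+ ε)} λ η η>0 → N , λ n N≤n → ≤-by (gap (proj₁ (hi-between N≤n)) ⊞ gap le ⊞ ℚ.<⇒≤ η>0)
          (trans (solve 4 (λ l u e f → l :+ e :+ f := u :+ (e :- (u :- l)) :+ f) refl (lo N) (hi N) ε η)
            (trans (cong (λ w → hi N ℚ.+ (ε ℚ.- w) ℚ.+ η) (proj₂ (proj₂ (invariant N))))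
              (solve 5 (λ a b w e f → a :+ (e :- w) :+ f := b :+ ((a :- b) :+ (e :- w) :+ f)) refl (hi N) (hi n) (h N ℚ.* width) ε η))))
        (+-mono-≤ {fromℚ (lo N)} {y} {fromℚ ε} {fromℚ ε} (bound (lo N) (proj₁ (invariant N))) (≤-refl {fromℚ ε}))

  ≤∞-trans-fin : ∀ {x y z} → x ≤∞ fin y → y ≤ z → x ≤∞ fin z
  ≤∞-trans-fin { -∞}        _   _   = tt
  ≤∞-trans-fin {fin x} {y} {z} x≤y y≤z = ≤-trans {x} {y} {z} x≤y y≤z

  -- If no rational bounds g, the supremum is +∞; if all do, it is -∞; in between, bisection starts
  -- from a rational that is a bound and one that is not. Rational bounds decide the matter because
  -- every real lies between two integers.
  sup-exists : ∀ {ℓ} {I : Set ℓ} (g : I → ℝ∞) → ∃ (IsSup g)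
  sup-exists {ℓ} {I} g with em {P = ∃ λ r → ∀ i → g i ≤∞ fin (fromℚ r)}
  ... | no unbounded = +∞ , (λ i → top (g i)) , least
    where
    top : ∀ x → x ≤∞ +∞
    top -∞      = tt
    top +∞      = tt
    top (fin _) = tt
    least : ∀ b → (∀ i → g i ≤∞ b) → +∞ ≤∞ b
    least +∞      _  = tt
    least (fin y) ub = unbounded (let B , y≤B = upper-bound y in ι B , λ i → ≤∞-trans-fin {g i} {y} {fromℕ B} (ub i) y≤B)
    least -∞      ub = unbounded (0ℚ , λ i → bot (g i) (ub i))
      where
      bot : ∀ x → x ≤∞ -∞ → x ≤∞ fin (fromℚ 0ℚ)
      bot -∞ _ = tt
  ... | yes (hi₀ , UBhi₀) with em {P = ∃ λ r → ¬ (∀ i → g i ≤∞ fin (fromℚ r))}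
  ...   | no all = -∞ , (λ i → bottom (g i) (λ r → everywhere r i)) , λ b _ → tt
    where
    everywhere : ∀ r i → g i ≤∞ fin (fromℚ r)
    everywhere r with em {P = ∀ i → g i ≤∞ fin (fromℚ r)}
    ... | yes ub = ub
    ... | no ¬ub = ⊥-elim (all (r , ¬ub))
    bottom : ∀ x → (∀ r → x ≤∞ fin (fromℚ r)) → x ≤∞ -∞
    bottom -∞      _  = tt
    bottom +∞      le = le 0ℚ
    bottom (fin x) le = let B , -B≤x = lower-bound x in
      le (ℚ.- (1ℚ ℚ.+ ι B)) (<-≤-trans {fromℚ (ℚ.- (1ℚ ℚ.+ ι B))} { - fromℕ B} {x}
        (fromℚ-mono-< {ℚ.- (1ℚ ℚ.+ ι B)} {ℚ.- ι B} (<-by 0<1 (solve 1 (λ b → :- b := :- (con 1ℚ :+ b) :+ con 1ℚ) refl (ι B)))) -B≤x)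
  ...   | yes (lo₀ , ¬lo₀) = fin limit , (λ i → above (g i) (λ q ub → ub i)) , least
    where
    open Bisection (λ r → ∀ i → g i ≤∞ fin (fromℚ r))
      (λ {p} {q} p≤q ub i → ≤∞-trans-fin {g i} {fromℚ p} {fromℚ q} (ub i) (fromℚ-mono-≤ p≤q)) lo₀ hi₀ ¬lo₀ UBhi₀
    above : ∀ x → (∀ q → (∀ i → g i ≤∞ fin (fromℚ q)) → x ≤∞ fin (fromℚ q)) → x ≤∞ fin limit
    above -∞      _  = tt
    above +∞      le = le hi₀ UBhi₀
    above (fin x) le = limit≥ x le
    least : ∀ b → (∀ i → g i ≤∞ b) → fin limit ≤∞ b
    least +∞      _  = tt
    least -∞      ub = ¬lo₀ λ i → bot (g i) (ub i)
      where
      bot : ∀ x → x ≤∞ -∞ → x ≤∞ fin (fromℚ lo₀)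
      bot -∞ _ = tt
    least (fin y) ub = limit≤ y λ q ¬q y<q → ¬q λ i → ≤∞-trans-fin {g i} {y} {fromℚ q} (ub i) (<⇒≤ {y} {fromℚ q} y<q)

  neg∞ : ℝ∞ → ℝ∞
  neg∞ -∞      = +∞
  neg∞ +∞      = -∞
  neg∞ (fin x) = fin (- x)

  neg∞-swapˡ : ∀ {x y} → neg∞ x ≤∞ y → neg∞ y ≤∞ x
  neg∞-swapˡ { -∞}   { +∞}   _  = tt
  neg∞-swapˡ { +∞}   { -∞}   _  = tt
  neg∞-swapˡ { +∞}   { +∞}   _  = tt
  neg∞-swapˡ { +∞}   {fin y} _  = tt
  neg∞-swapˡ {fin x} { +∞}   _  = tt
  neg∞-swapˡ {fin x} {fin y} le = ≤-cert { - y} {x} {y - (- x)} (0≤gap { - x} {y} le) λ n → solve 2 (λ x y → x := :- y :+ (y :+ :- (:- x))) refl (seq x n) (seq y n)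

  neg∞-swapʳ : ∀ {x y} → x ≤∞ neg∞ y → y ≤∞ neg∞ x
  neg∞-swapʳ { -∞}   { -∞}   _  = tt
  neg∞-swapʳ { -∞}   { +∞}   _  = tt
  neg∞-swapʳ { -∞}   {fin y} _  = tt
  neg∞-swapʳ { +∞}   { -∞}   _  = tt
  neg∞-swapʳ {fin x} { -∞}   _  = tt
  neg∞-swapʳ {fin x} {fin y} le = ≤-cert {y} { - x} { - y - x} (0≤gap {x} { - y} le) λ n → solve 2 (λ x y → :- x := y :+ (:- y :+ :- x)) refl (seq x n) (seq y n)

  neg∞-anti : ∀ {x y} → x ≤∞ y → neg∞ y ≤∞ neg∞ x
  neg∞-anti { -∞}   { -∞}   _  = tt
  neg∞-anti { -∞}   { +∞}   _  = tt
  neg∞-anti { -∞}   {fin y} _  = tt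
  neg∞-anti { +∞}   { +∞}   _  = tt
  neg∞-anti {fin x} { +∞}   _  = tt
  neg∞-anti {fin x} {fin y} le = neg-mono-≤ {x} {y} le

  inf-exists : ∀ {ℓ} {I : Set ℓ} (g : I → ℝ∞) → ∃ (IsInf g)
  inf-exists g with sup-exists (λ i → neg∞ (g i))
  ... | s , ub , least = neg∞ s , (λ i → neg∞-swapˡ {g i} {s} (ub i)) , λ b lb → neg∞-swapʳ {s} {b} (least (neg∞ b) (λ i → neg∞-anti {b} {g i} (lb i)))

  sup-spec : ∀ {ℓ} {I : Set ℓ} (g : I → ℝ∞) z → z ≡ Classical.sup em g → IsSup g z
  sup-spec g z eq = choose-spec +∞ (IsSup g) z eq (sup-exists g)

  inf-spec : ∀ {ℓ} {I : Set ℓ} (g : I → ℝ∞) z → z ≡ Classical.inf em g → IsInf g z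
  inf-spec g z eq = choose-spec -∞ (IsInf g) z eq (inf-exists g)

  -- Exponential, logarithm and real powers

  lim-spec : ∀ {f x} z → z ≡ Classical.lim em f → Converges f x → z ≈ x
  lim-spec {f} {x} z eq fx = Converges-unique {f} {z} {x} (choose-spec 0ℝ (Converges f) z eq (x , fx)) fx

  exp≈e : ∀ x z → z ≡ Classical.exp em x → z ≈ e x
  exp≈e x z eq = lim-spec {λ n → ∑< n λ k → pow x k * fromℚ (ℚ._/_ (+ 1) (k !) {{k ℕ.!≢0}})} {e x} z eq (∑<⇒e x)

  0<1ℝ : 0ℝ < 1ℝ
  0<1ℝ = fromℚ-mono-< {0ℚ} {1ℚ} 0<1

  0<e : ∀ x → 0ℝ < e x
  0<e x = ≰⇒> {e x} {0ℝ} λ ex≤0 → <-irrefl {0ℝ} (<-≤-trans {0ℝ} {1ℝ} {0ℝ} 0<1ℝ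
    (≤-trans {1ℝ} {e x * e (- x)} {0ℝ} (≈⇒≥ {e x * e (- x)} {1ℝ} (e-inverse x))
      (≤-trans {e x * e (- x)} {0ℝ * e (- x)} {0ℝ} (*-monoʳ-≤ {e (- x)} {e x} {0ℝ} (0≤e (- x)) ex≤0)
        (pointwise-≤ {0ℝ * e (- x)} {0ℝ} λ n → ℚ.≤-reflexive (ℚ.*-zeroˡ (seq (e (- x)) n))))))

  e-mono-< : ∀ {x y} → x < y → e x < e y
  e-mono-< {x} {y} x<y = <-≤-trans {e x} {e x + (y - x) * e x} {e y}
    (<-cert {e x} {e x + (y - x) * e x} {(y - x) * e x} (0<-* {y - x} {e x} (0<gap {x} {y} x<y) (0<e x)) λ n → refl)
    (e-growth {x} {y} (<⇒≤ {x} {y} x<y))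

  e-cancel-≤ : ∀ {x y} → e x ≤ e y → x ≤ y
  e-cancel-≤ {x} {y} ex≤ey y<x = ex≤ey (e-mono-< {y} {x} y<x)

  -- Otherwise 1 = e n · e (-n) ≥ (1 + n) e (-n) > n η ≥ 1.
  e-neg-≤ : ∀ x η n → fromℚ η ≤ x → 1ℚ ℚ.≤ η ℚ.* ι n → e (- fromℕ n) ≤ x
  e-neg-≤ x η n η≤x 1≤ηn x<a = <-irrefl {1ℝ} (<-≤-trans {1ℝ} {(1ℝ + N) * a} {1ℝ}
    (<-cert {1ℝ} {(1ℝ + N) * a} {a + (N * (a - fromℚ η) + (fromℚ (η ℚ.* ι n) - 1ℝ))}
      (0<-+ {a} {N * (a - fromℚ η) + (fromℚ (η ℚ.* ι n) - 1ℝ)} (0<e (- N))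
        (0≤-+ {N * (a - fromℚ η)} {fromℚ (η ℚ.* ι n) - 1ℝ}
          (0≤-* {N} {a - fromℚ η} 0≤N (0≤gap {fromℚ η} {a} (≤-trans {fromℚ η} {x} {a} η≤x (<⇒≤ {x} {a} x<a))))
          (0≤gap {1ℝ} {fromℚ (η ℚ.* ι n)} (fromℚ-mono-≤ {1ℚ} {η ℚ.* ι n} 1≤ηn))))
      λ k → solve 3 (λ a n h → (con 1ℚ :+ n) :* a := con 1ℚ :+ (a :+ (n :* (a :+ :- h) :+ (h :* n :+ :- con 1ℚ)))) refl (seq a k) (ι n) η)
    (≤-trans {(1ℝ + N) * a} {e N * a} {1ℝ} (*-monoʳ-≤ {a} {1ℝ + N} {e N} (0≤e (- N)) (1+x≤e {N} 0≤N))
      (≈⇒≤ {e N * a} {1ℝ} (e-inverse N))))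
    where
    N = fromℕ n
    a = e (- N)
    0≤N : 0ℝ ≤ N
    0≤N = fromℚ-mono-≤ {0ℚ} {ι n} (0≤ι n)

  private
    -- The logarithm is the supremum s of all r with e r ≤ x. If e s were below x by η, continuity
    -- would let some s + v qualify too; if e s were above x by η, some s - v would already be an
    -- upper bound. The increment v is chosen so that `e-step` changes e by at most η / 2.
    module Log (x : ℝ) (0<x : 0ℝ < x) where

      Below : Set
      Below = Σ ℝ λ r → e r ≤ x

      value : Below → ℝ∞
      value (r , _) = fin r

      nonempty : Below
      nonempty =
        let η , η>0 , η≤x = <⇒+ε≤ {0ℝ} {x} 0<x
            r , _ , ηr≡1 = reciprocal η η>0
            n , r≤n = archimedean r
        in - fromℕ n , e-neg-≤ x η n
          (≤-trans {fromℚ η} {0ℝ + fromℚ η} {x} (pointwise-≤ {fromℚ η} {0ℝ + fromℚ η} λ _ → ℚ.≤-reflexive (sym (ℚ.+-identityˡ η))) η≤x)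
          (ℚ.≤-trans (ℚ.≤-reflexive (sym ηr≡1)) (ℚ*-mono η (ℚ.<⇒≤ η>0) r≤n))

      B = proj₁ (upper-bound x)

      bounded-above : ∀ r → e r ≤ x → r ≤ fromℕ B
      bounded-above r er≤x B<r = <-irrefl {r} (≤-<-trans {r} {fromℕ B} {r}
        (≤-trans {r} {e r} {fromℕ B}
          (≤-trans {r} {1ℝ + r} {e r} (≤-cert {r} {1ℝ + r} {1ℝ} (<⇒≤ {0ℝ} {1ℝ} 0<1ℝ) λ n → ℚ.+-comm 1ℚ (seq r n))
            (1+x≤e {r} (≤-trans {0ℝ} {fromℕ B} {r} (fromℚ-mono-≤ (0≤ι B)) (<⇒≤ {fromℕ B} {r} B<r))))
          (≤-trans {e r} {x} {fromℕ B} er≤x (proj₂ (upper-bound x)))) B<r)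

      finite : ∀ s → IsSup value s → ∃ λ s → IsSup value (fin s)
      finite -∞      (ub , _)    = ⊥-elim (ub nonempty)
      finite +∞      (_ , least) = ⊥-elim (least (fin (fromℕ B)) λ (r , er≤x) → bounded-above r er≤x)
      finite (fin s) spec        = s , spec

      s∞ : ∃ λ s → IsSup value (fin s)
      s∞ = finite _ (sup-spec value _ refl)

      s = proj₁ s∞

      C = proj₁ (upper-bound (e s))

      step : ∀ A η → 0ℚ ℚ.< η → ∃[ v ] 0ℚ ℚ.< v × v ℚ.≤ ½ × (v ℚ.+ v) ℚ.* ι A ℚ.≤ ½ ℚ.* η
      step A η η>0 =
        let w , w>0 , w≤1 , Aw≤ = small A 0 (½ ℚ.* η) (0<* 0<½ η>0)
        in ½ ℚ.* w , 0<* 0<½ w>0 , ℚ.≤-trans (ℚ*-mono ½ 0≤½ w≤1) (ℚ.≤-reflexive (ℚ.*-identityʳ ½)) ,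
           ℚ.≤-trans (≤-by (ℚ.<⇒≤ w>0) (solve 2 (λ w a → (a :+ con 0ℚ :+ con 1ℚ) :* w := (con ½ :* w :+ con ½ :* w) :* a :+ w) refl w (ι A))) Aw≤

      e-step : ∀ y A {η v} → 0ℚ ℚ.≤ v → v ℚ.≤ ½ → e y ≤ fromℕ A → (v ℚ.+ v) ℚ.* ι A ℚ.≤ ½ ℚ.* η → e (y + fromℚ v) ≤ e y + fromℚ (½ ℚ.* η)
      e-step y A {η} {v} 0≤v v≤½ ey≤A le = ≤-trans {e (y + V)} {e y * e V} {e y + H} (≈⇒≤ {e (y + V)} {e y * e V} (e-+ y V))
        (≤-trans {e y * e V} {e y * fromℚ (1ℚ ℚ.+ (v ℚ.+ v))} {e y + H} (*-monoˡ-≤ {e y} {e V} {fromℚ (1ℚ ℚ.+ (v ℚ.+ v))} (0≤e y) (e≤1+2v 0≤v v≤½))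
          (≤-cert {e y * fromℚ (1ℚ ℚ.+ (v ℚ.+ v))} {e y + H} {fromℚ (v ℚ.+ v) * (fromℕ A - e y) + (H - fromℚ ((v ℚ.+ v) ℚ.* ι A))}
            (0≤-+ {fromℚ (v ℚ.+ v) * (fromℕ A - e y)} {H - fromℚ ((v ℚ.+ v) ℚ.* ι A)}
              (0≤-* {fromℚ (v ℚ.+ v)} {fromℕ A - e y} (fromℚ-mono-≤ {0ℚ} (0≤v ⊞ 0≤v)) (0≤gap {e y} {fromℕ A} ey≤A))
              (0≤gap {fromℚ ((v ℚ.+ v) ℚ.* ι A)} {H} (fromℚ-mono-≤ le)))
            λ n → solve 4 (λ y v a h → y :+ h := y :* (con 1ℚ :+ (v :+ v)) :+ ((v :+ v) :* (a :+ :- y) :+ (h :+ :- ((v :+ v) :* a)))) refl (seq (e y) n) v (ι A) (½ ℚ.* η)))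
        where
        V = fromℚ v
        H = fromℚ (½ ℚ.* η)

      s+v≰s : ∀ {v} → 0ℚ ℚ.< v → ¬ (s + fromℚ v ≤ s)
      s+v≰s {v} v>0 le = le (<-cert {s} {s + fromℚ v} {fromℚ v} (fromℚ-mono-< {0ℚ} v>0) λ n → refl)

      s≤s-v : ∀ {v} → 0ℚ ℚ.< v → ¬ (s ≤ s - fromℚ v)
      s≤s-v {v} v>0 le = le (<-cert {s - fromℚ v} {s} {fromℚ v} (fromℚ-mono-< {0ℚ} v>0) λ n → solve 2 (λ s v → s := s :+ :- v :+ v) refl (seq s n) v)

      not-below : x ≤ e s
      not-below es<x =
        let η , η>0 , le = <⇒+ε≤ {e s} {x} es<x
            v , v>0 , v≤½ , small = step C η η>0
            H≤η = +-mono-≤ {e s} {e s} {fromℚ (½ ℚ.* η)} {fromℚ η} (≤-refl {e s}) (fromℚ-mono-≤ (ℚ.<⇒≤ (half< η η>0)))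
        in s+v≰s v>0 (proj₁ (proj₂ s∞) (s + fromℚ v , ≤-trans {e (s + fromℚ v)} {e s + fromℚ (½ ℚ.* η)} {x}
             (e-step s C {η} (ℚ.<⇒≤ v>0) v≤½ (proj₂ (upper-bound (e s))) small)
             (≤-trans {e s + fromℚ (½ ℚ.* η)} {e s + fromℚ η} {x} H≤η le)))

      not-above : e s ≤ x
      not-above x<es =
        let η , η>0 , le = <⇒+ε≤ {x} {e s} x<es
            v , v>0 , v≤½ , small = step B η η>0
            y = s - fromℚ v
            upper : ∀ r → e r ≤ x → r ≤ y
            upper r er≤x y<r =
              let ey≤x = ≤-trans {e y} {e r} {x} (e-mono-≤ {y} {r} (<⇒≤ {y} {r} y<r)) er≤x
                  H = fromℚ (½ ℚ.* η)
              in <-irrefl {x + fromℚ η} (≤-<-trans {x + fromℚ η} {x + H} {x + fromℚ η}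
                (≤-trans {x + fromℚ η} {e s} {x + H} le
                  (≤-trans {e s} {e (y + fromℚ v)} {x + H}
                    (≈⇒≤ {e s} {e (y + fromℚ v)} (e-cong {s} {y + fromℚ v} (pointwise-≈ {s} {y + fromℚ v} λ n → solve 2 (λ s v → s := s :+ :- v :+ v) refl (seq s n) v)))
                    (≤-trans {e (y + fromℚ v)} {e y + H} {x + H}
                      (e-step y B {η} (ℚ.<⇒≤ v>0) v≤½ (≤-trans {e y} {x} {fromℕ B} ey≤x (proj₂ (upper-bound x))) small)
                      (+-mono-≤ {e y} {x} {H} {H} ey≤x (≤-refl {H})))))
                (<-cert {x + H} {x + fromℚ η} {fromℚ (½ ℚ.* η)} (fromℚ-mono-< {0ℚ} (0<* 0<½ η>0)) λ n → solve 2 (λ x e → x :+ e := x :+ con ½ :* e :+ con ½ :* e) refl (seq x n) η))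
        in s≤s-v v>0 (proj₂ (proj₂ s∞) (fin y) λ (r , er≤x) → upper r er≤x)

  e-surjective : ∀ {x} → 0ℝ < x → ∃[ y ] e y ≈ x
  e-surjective {x} 0<x = s , ≤-antisym {e s} {x} not-above not-below
    where open Log x 0<x

  -- Conversion checking gets stuck unfolding the functions of Classical, hence the
  -- abstract copies, and the equations that are proved by matching on refl.
  abstract
    exp-copy : ∃ λ (f : ℝ → ℝ) → f ≡ Classical.exp em
    exp-copy = _ , refl

    log-copy : ∃ λ (f : ℝ → ℝ) → f ≡ Classical.log em
    log-copy = _ , refl

    pow-copy : ∃ λ (f : ℝ → ℝ → ℝ) → f ≡ Classical._^_ em
    pow-copy = _ , refl

  Exp Log : ℝ → ℝ
  Exp = proj₁ exp-copy
  Log = proj₁ log-copy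

  Pow : ℝ → ℝ → ℝ
  Pow = proj₁ pow-copy

  Exp≈e : ∀ x → Exp x ≈ e x
  Exp≈e x = exp≈e x (Exp x) (cong-app (proj₂ exp-copy) x)

  log-choose : ∀ f l → f ≡ Classical.exp em → l ≡ Classical.log em → ∀ x → l x ≡ Classical.choose em 0ℝ λ y → f y ≈ x
  log-choose f l refl refl x = refl

  e-log : ∀ {x} → 0ℝ < x → e (Log x) ≈ x
  e-log {x} 0<x = ≈-trans {e (Log x)} {Exp (Log x)} {x} (≈-sym {Exp (Log x)} {e (Log x)} (Exp≈e (Log x)))
    (choose-spec 0ℝ (λ y → Exp y ≈ x) (Log x) (log-choose Exp Log (proj₂ exp-copy) (proj₂ log-copy) x) (preimage (e-surjective {x} 0<x)))
    where
    preimage : (∃[ y ] e y ≈ x) → ∃[ y ] Exp y ≈ x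
    preimage (y , ey≈x) = y , ≈-trans {Exp y} {e y} {x} (Exp≈e y) ey≈x

  ≤-log : ∀ {x y} → e y ≤ x → y ≤ Log x
  ≤-log {x} {y} ey≤x = e-cancel-≤ {y} {Log x} (≤-trans {e y} {x} {e (Log x)} ey≤x
    (≈⇒≥ {e (Log x)} {x} (e-log {x} (<-≤-trans {0ℝ} {e y} {x} (0<e y) ey≤x))))

  log-≤ : ∀ {x y} → 0ℝ < x → x ≤ e y → Log x ≤ y
  log-≤ {x} {y} 0<x x≤ey = e-cancel-≤ {Log x} {y} (≤-trans {e (Log x)} {x} {e y} (≈⇒≤ {e (Log x)} {x} (e-log {x} 0<x)) x≤ey)

  ifEM : Set → ℝ → ℝ → ℝ
  ifEM P u v = if does (em {P = P}) then u else v

  ifEM-yes : ∀ P u v → P → ifEM P u v ≡ u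
  ifEM-yes P u v p with em {P = P}
  ... | yes _ = refl
  ... | no ¬p = ⊥-elim (¬p p)

  ifEM-no : ∀ P u v → ¬ P → ifEM P u v ≡ v
  ifEM-no P u v ¬p with em {P = P}
  ... | yes p = ⊥-elim (¬p p)
  ... | no _  = refl

  power : ℝ → ℝ → ℝ → ℝ
  power x c y = ifEM (0ℝ < x) y (ifEM (c ≈ 0ℝ) 1ℝ 0ℝ)

  power-pos : ∀ {x} c y → 0ℝ < x → power x c y ≡ y
  power-pos {x} c y = ifEM-yes (0ℝ < x) y (ifEM (c ≈ 0ℝ) 1ℝ 0ℝ)

  power-nonpos : ∀ {x} c y → ¬ (0ℝ < x) → ¬ (c ≈ 0ℝ) → power x c y ≡ 0ℝ
  power-nonpos {x} c y 0≮x c≉0 = trans (ifEM-no (0ℝ < x) y (ifEM (c ≈ 0ℝ) 1ℝ 0ℝ) 0≮x) (ifEM-no (c ≈ 0ℝ) 1ℝ 0ℝ c≉0)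

  power-0 : ∀ {x} c y → ¬ (0ℝ < x) → c ≈ 0ℝ → power x c y ≡ 1ℝ
  power-0 {x} c y 0≮x c≈0 = trans (ifEM-no (0ℝ < x) y (ifEM (c ≈ 0ℝ) 1ℝ 0ℝ) 0≮x) (ifEM-yes (c ≈ 0ℝ) 1ℝ 0ℝ c≈0)

  Pow-def : ∀ f l g → f ≡ Classical.exp em → l ≡ Classical.log em → g ≡ Classical._^_ em → ∀ x c → g x c ≡ power x c (f (c * l x))
  Pow-def f l g refl refl refl x c = refl

  Pow≡power : ∀ x c → Pow x c ≡ power x c (Exp (c * Log x))
  Pow≡power = Pow-def Exp Log Pow (proj₂ exp-copy) (proj₂ log-copy) (proj₂ pow-copy)

  Pow-pos : ∀ {x} c → 0ℝ < x → Pow x c ≈ e (c * Log x)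
  Pow-pos {x} c 0<x = subst (_≈ e (c * Log x)) (sym (trans (Pow≡power x c) (power-pos {x} c (Exp (c * Log x)) 0<x))) (Exp≈e (c * Log x))

  Pow-nonpos : ∀ {x} c → ¬ (0ℝ < x) → ¬ (c ≈ 0ℝ) → Pow x c ≡ 0ℝ
  Pow-nonpos {x} c 0≮x c≉0 = trans (Pow≡power x c) (power-nonpos {x} c (Exp (c * Log x)) 0≮x c≉0)

  Pow-0 : ∀ {x} c → ¬ (0ℝ < x) → c ≈ 0ℝ → Pow x c ≡ 1ℝ
  Pow-0 {x} c 0≮x c≈0 = trans (Pow≡power x c) (power-0 {x} c (Exp (c * Log x)) 0≮x c≈0)

  Pow-nonneg : ∀ x c → 0ℝ ≤ Pow x c
  Pow-nonneg x c with em {P = 0ℝ < x}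
  ... | yes 0<x = ≤-trans {0ℝ} {e (c * Log x)} {Pow x c} (0≤e (c * Log x)) (≈⇒≥ {Pow x c} {e (c * Log x)} (Pow-pos {x} c 0<x))
  ... | no 0≮x with em {P = c ≈ 0ℝ}
  ...   | yes c≈0 = subst (0ℝ ≤_) (sym (Pow-0 {x} c 0≮x c≈0)) (<⇒≤ {0ℝ} {1ℝ} 0<1ℝ)
  ...   | no c≉0  = subst (0ℝ ≤_) (sym (Pow-nonpos {x} c 0≮x c≉0)) (≤-refl {0ℝ})

  e≤Pow : ∀ {x y c} → 0ℝ ≤ c → e y ≤ x → e (c * y) ≤ Pow x c
  e≤Pow {x} {y} {c} 0≤c ey≤x = ≤-trans {e (c * y)} {e (c * Log x)} {Pow x c}
    (e-mono-≤ {c * y} {c * Log x} (*-monoˡ-≤ {c} {y} {Log x} 0≤c (≤-log {x} {y} ey≤x)))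
    (≈⇒≥ {Pow x c} {e (c * Log x)} (Pow-pos {x} c (<-≤-trans {0ℝ} {e y} {x} (0<e y) ey≤x)))

  Pow≤e : ∀ {x y c} → 0ℝ < c → x ≤ e y → Pow x c ≤ e (c * y)
  Pow≤e {x} {y} {c} 0<c x≤ey with em {P = 0ℝ < x}
  ... | yes 0<x = ≤-trans {Pow x c} {e (c * Log x)} {e (c * y)} (≈⇒≤ {Pow x c} {e (c * Log x)} (Pow-pos {x} c 0<x))
    (e-mono-≤ {c * Log x} {c * y} (*-monoˡ-≤ {c} {Log x} {y} (<⇒≤ {0ℝ} {c} 0<c) (log-≤ {x} {y} 0<x x≤ey)))
  -- For x without 0 < x the power is 0, since c > 0 rules out the convention 0 ^ 0 = 1.
  ... | no 0≮x = subst (_≤ e (c * y)) (sym (Pow-nonpos {x} c 0≮x λ c≈0 → ≈⇒≤ {c} {0ℝ} c≈0 0<c)) (0≤e (c * y))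

  -- Lower bounds for limits inferior and for distances to ℤ

  inf-lower : ∀ {ℓ} {I : Set ℓ} (g : I → ℝ∞) {z} c → z ≡ Classical.inf em g → (∀ i → fin c ≤∞ g i) → fin c ≤∞ z
  inf-lower g {z} c eq le = proj₂ (inf-spec g z eq) (fin c) le

  inf-upper : ∀ {ℓ} {I : Set ℓ} (g : I → ℝ∞) {z} i → z ≡ Classical.inf em g → z ≤∞ g i
  inf-upper g {z} i eq = proj₁ (inf-spec g z eq) i

  ≤∞-trans : ∀ {x y z} → x ≤∞ y → y ≤∞ z → x ≤∞ z
  ≤∞-trans { -∞}                     _ _ = tt
  ≤∞-trans { +∞}   { +∞}  { +∞}      _ _ = tt
  ≤∞-trans {fin x} { +∞}  { +∞}      _ _ = tt
  ≤∞-trans {fin x} {fin y} { +∞}     _ _ = tt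
  ≤∞-trans {fin x} {fin y} {fin z}   p q = ≤-trans {x} {y} {z} p q

  liminf-def : ∀ f G → G ≡ (λ N → Classical.inf em λ k → fin (f (N ℕ.+ k))) → Classical.liminf em f ≡ Classical.sup em G
  liminf-def f G refl = refl

  liminf-lower : ∀ f c N → (∀ n → N ℕ.≤ n → c ≤ f n) → ∀ z → z ≡ Classical.liminf em f → fin c ≤∞ z
  liminf-lower f c N le z z≡ = via _ refl
    where
    via : ∀ G → G ≡ (λ N → Classical.inf em λ k → fin (f (N ℕ.+ k))) → fin c ≤∞ z
    via G G≡ = ≤∞-trans {fin c} {G N} {z}
      (inf-lower (λ k → fin (f (N ℕ.+ k))) c (cong-app G≡ N) (λ k → le (N ℕ.+ k) (ℕ.m≤m+n N k)))
      (proj₁ (sup-spec G z (trans z≡ (liminf-def f G G≡))) N)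

  distℤ-def : ∀ x y → y ≡ Classical.inf em (λ (k : ℤ) → fin ∣ x - fromℤ k ∣) → Classical.distℤ em x ≡ Classical.real em y
  distℤ-def x y refl = refl

  distℤ-lower : ∀ x c → (∀ k → c ≤ ∣ x - fromℤ k ∣) → ∀ z → z ≡ Classical.distℤ em x → c ≤ z
  distℤ-lower x c le z z≡ = via _ refl
    where
    g : ℤ → ℝ∞
    g k = fin ∣ x - fromℤ k ∣
    finite : ∀ y → IsInf g y → z ≡ Classical.real em y → c ≤ z
    -- The infimum is finite, so `real` returns it: it is not -∞ because c bounds the distances
    -- below, and not +∞ because the distance to 0 is one of them.
    finite -∞      (_ , greatest) _    = ⊥-elim (greatest (fin c) le)
    finite +∞      (lb , _)       _    = ⊥-elim (lb (+ 0))
    finite (fin d) (_ , greatest) refl = greatest (fin c) le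
    via : ∀ y → y ≡ Classical.inf em (λ (k : ℤ) → fin ∣ x - fromℤ k ∣) → c ≤ z
    via y y≡ = finite y (inf-spec g y y≡) (trans z≡ (distℤ-def x y y≡))

  abstract
    dist-copy : ∃ λ (f : ℝ → ℝ) → f ≡ Classical.distℤ em
    dist-copy = _ , refl

  Dist : ℝ → ℝ
  Dist = proj₁ dist-copy

  Dist-lower : ∀ x c → (∀ k → c ≤ ∣ x - fromℤ k ∣) → c ≤ Dist x
  Dist-lower x c le = distℤ-lower x c le (Dist x) (cong-app (proj₂ dist-copy) x)

  littlewoodProduct-def : ∀ l g d → l ≡ Classical.log em → g ≡ Classical._^_ em → d ≡ Classical.distℤ em → ∀ a p pr α q →
    Classical.littlewoodProduct em a p pr α q ≡
    fromℕ q * g (l (fromℕ q)) (fromℕ 2 - a) * d (fromℕ q * α) * fromℚ (padicAbs p pr q) * g (l (fromℚ (2/padicAbs p pr q))) a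
  littlewoodProduct-def l g d refl refl refl a p pr α q = refl

  littlewoodProduct≡ : ∀ a p pr α q → Classical.littlewoodProduct em a p pr α q ≡
    fromℕ q * Pow (Log (fromℕ q)) (fromℕ 2 - a) * Dist (fromℕ q * α) * fromℚ (padicAbs p pr q) * Pow (Log (fromℚ (2/padicAbs p pr q))) a
  littlewoodProduct≡ = littlewoodProduct-def Log Pow Dist (proj₂ log-copy) (proj₂ pow-copy) (proj₂ dist-copy)

  -- Covers and Hausdorff measure

  diam-spec : ∀ U z → z ≡ Classical.diam em U → fin 0ℝ ≤∞ z × (∀ x y → U x → U y → fin ∣ x - y ∣ ≤∞ z) ×
    (∀ b → fin 0ℝ ≤∞ b → (∀ x y → U x → U y → fin ∣ x - y ∣ ≤∞ b) → z ≤∞ b)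
  diam-spec U z z≡ = split (sup-spec _ z z≡)
    where
    split : _ → _
    split (ub , least) = ub (inj₁ tt) , (λ x y x∈U y∈U → ub (inj₂ ((x , y) , x∈U , y∈U))) ,
      λ b 0≤b le → least b λ { (inj₁ _) → 0≤b ; (inj₂ ((x , y) , x∈U , y∈U)) → le x y x∈U y∈U }

  cost-def : ∀ g → g ≡ Classical._^_ em → ∀ {δ S} s (𝒰 : Classical.Cover em δ S) d → d ≡ (λ i → Classical.real em (Classical.diam em (Classical.Cover.piece 𝒰 i))) →
    Classical.cost em s 𝒰 ≡ Classical.sup em (λ n → fin (∑< n λ i → g (d i) s))
  cost-def g refl s 𝒰 d refl = refl

  Diameter : Pred ℝ 0ℓ → ℝ → Set
  Diameter U d = 0ℝ ≤ d × (∀ x y → U x → U y → ∣ x - y ∣ ≤ d)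

  diameter : ∀ U δ z d → z ≡ Classical.diam em U → z ≤∞ fin δ → d ≡ Classical.real em z → Diameter U d × d ≤ δ
  diameter U δ z d z≡ = finite z (diam-spec U z z≡)
    where
    finite : ∀ z → (fin 0ℝ ≤∞ z × (∀ x y → U x → U y → fin ∣ x - y ∣ ≤∞ z) ×
      (∀ b → fin 0ℝ ≤∞ b → (∀ x y → U x → U y → fin ∣ x - y ∣ ≤∞ b) → z ≤∞ b)) → z ≤∞ fin δ → d ≡ Classical.real em z → Diameter U d × d ≤ δ
    finite -∞      (0≤z , _)      _   _    = ⊥-elim 0≤z
    finite +∞      _              z≤δ _    = ⊥-elim z≤δ
    finite (fin z) (0≤z , le , _) z≤δ refl = (0≤z , le) , z≤δ

  diameter-≤ : ∀ U y → (∀ x x′ → U x → U x′ → ∣ x - x′ ∣ ≤ y) → 0ℝ ≤ y → ∀ z → z ≡ Classical.diam em U → z ≤∞ fin y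
  diameter-≤ U y le 0≤y z z≡ = proj₂ (proj₂ (diam-spec U z z≡)) (fin y) 0≤y le

  hausdorffMeasure-def : ∀ s S P → P ≡ (λ δ → Classical.premeasure em s δ S) →
    Classical.hausdorffMeasure em s S ≡ Classical.sup em (λ ((δ , _) : Σ ℝ (0ℝ <_)) → P δ)
  hausdorffMeasure-def s S P refl = refl

  premeasure-def : ∀ s δ S C → C ≡ Classical.cost em {δ} {S} s → Classical.premeasure em s δ S ≡ Classical.inf em C
  premeasure-def s δ S C refl = refl

  dimH-def : ∀ S H → H ≡ (λ s → Classical.hausdorffMeasure em s S) →
    Classical.dimH em S ≡ Classical.inf em (λ ((s , _) : Σ ℝ λ s → 0ℝ ≤ s × H s ≈∞ fin 0ℝ) → fin s)
  dimH-def S H refl = refl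

  ≰∞⇒≥ : ∀ x y → ¬ (x ≤∞ fin y) → fin y ≤∞ x
  ≰∞⇒≥ -∞      y x≰y = ⊥-elim (x≰y tt)
  ≰∞⇒≥ +∞      y x≰y = tt
  ≰∞⇒≥ (fin x) y x≰y = <⇒≤ {y} {x} (≰⇒> {x} {y} x≰y)

  ≤∞-ε : ∀ z y → (∀ ε → 0ℚ ℚ.< ε → z ≤∞ fin (y + fromℚ ε)) → z ≤∞ fin y
  ≤∞-ε -∞      y le = tt
  ≤∞-ε +∞      y le = le 1ℚ 0<1
  ≤∞-ε (fin x) y le = ≤-+ε {x} {y} le

  -- What a cover of cost at most κ by pieces of diameter at most 1 provides, with diameters as real
  -- numbers and the supremum in the cost replaced by bounds on its partial sums.
  record SmallCover (s κ : ℝ) (S : Pred ℝ 0ℓ) : Set₁ where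
    field
      piece    : ℕ → Pred ℝ 0ℓ
      size     : ℕ → ℝ
      measure  : ∀ i → Diameter (piece i) (size i)
      size≤1   : ∀ i → size i ≤ 1ℝ
      covers   : ∀ x → S x → ∃[ i ] piece i x
      cost≤    : ∀ n → ∑< n (λ i → Pow (size i) s) ≤ κ

  Cover⇒SmallCover : ∀ s κ {S} (𝒰 : Classical.Cover em 1ℝ S) z → z ≡ Classical.cost em s 𝒰 → z ≤∞ fin κ → SmallCover s κ S
  Cover⇒SmallCover s κ {S} 𝒰 z z≡ cost≤κ = viaD _ refl
    where
    viaD : ∀ d → d ≡ (λ i → Classical.real em (Classical.diam em (Classical.Cover.piece 𝒰 i))) → SmallCover s κ S
    viaD d d≡ = record
      { piece = Classical.Cover.piece 𝒰
      ; size = d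
      ; measure = λ i → proj₁ (sizes i _ refl)
      ; size≤1 = λ i → proj₂ (sizes i _ refl)
      ; covers = Classical.Cover.covers 𝒰
      ; cost≤ = λ n → ≤∞-trans {fin (∑< n (λ i → Pow (d i) s))} {z} {fin κ}
          (proj₁ (sup-spec (λ n → fin (∑< n λ i → Pow (d i) s)) z (trans z≡ (cost-def Pow (proj₂ pow-copy) s 𝒰 d d≡))) n) cost≤κ }
      where
      sizes : ∀ i z → z ≡ Classical.diam em (Classical.Cover.piece 𝒰 i) → Diameter (Classical.Cover.piece 𝒰 i) (d i) × d i ≤ 1ℝ
      sizes i z z≡ = diameter (Classical.Cover.piece 𝒰 i) 1ℝ z (d i) z≡ (subst (_≤∞ fin 1ℝ) (sym z≡) (Classical.Cover.small 𝒰 i))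
        (trans (cong-app d≡ i) (cong (Classical.real em) (sym z≡)))

  -- The measure is a supremum over scales, so measure zero forces the premeasure at scale 1 to be
  -- at most 0. This is an infimum of costs; were every cost above κ > 0, then κ would be a lower
  -- bound.
  null⇒SmallCover : ∀ s S κ → 0ℝ < κ → ∀ z → z ≡ Classical.hausdorffMeasure em s S → z ≤∞ fin 0ℝ → SmallCover s κ S
  null⇒SmallCover s S κ 0<κ z z≡ z≤0 = viaP _ refl
    where
    viaP : ∀ P → P ≡ (λ δ → Classical.premeasure em s δ S) → SmallCover s κ S
    viaP P P≡ = viaC _ refl
      where
      P1≤0 : P 1ℝ ≤∞ fin 0ℝ
      P1≤0 = ≤∞-trans {P 1ℝ} {z} {fin 0ℝ} (proj₁ (sup-spec (λ ((δ , _) : Σ ℝ (0ℝ <_)) → P δ) z (trans z≡ (hausdorffMeasure-def s S P P≡))) (1ℝ , 0<1ℝ)) z≤0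
      viaC : ∀ C → C ≡ Classical.cost em {1ℝ} {S} s → SmallCover s κ S
      viaC C C≡ = decide em
        where
        decide : Dec (∃ λ 𝒰 → C 𝒰 ≤∞ fin κ) → SmallCover s κ S
        decide (no none)          = ⊥-elim (≤∞-trans {fin κ} {P 1ℝ} {fin 0ℝ}
          (inf-lower C κ (trans (cong-app P≡ 1ℝ) (premeasure-def s 1ℝ S C C≡)) (λ 𝒰 → ≰∞⇒≥ (C 𝒰) κ λ le → none (𝒰 , le))) P1≤0 0<κ)
        decide (yes (𝒰 , cost≤κ)) = Cover⇒SmallCover s κ 𝒰 (C 𝒰) (cong-app C≡ 𝒰) cost≤κ

  -- The recipe for an upper bound on the measure. A diameter enters only through the bound `size`,
  -- so `priced` speaks of the powers of all d up to it.
  record PricedCover (s δ κ : ℝ) (S : Pred ℝ 0ℓ) : Set₁ where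
    field
      piece  : ℕ → Pred ℝ 0ℓ
      size   : ℕ → ℝ
      price  : ℕ → ℝ
      0≤size : ∀ i → 0ℝ ≤ size i
      short  : ∀ i x x′ → piece i x → piece i x′ → ∣ x - x′ ∣ ≤ size i
      size≤δ : ∀ i → size i ≤ δ
      covers : ∀ x → S x → ∃[ i ] piece i x
      priced : ∀ i d → d ≤ size i → Pow d s ≤ price i
      cost≤  : ∀ n → ∑< n price ≤ κ

  ∑<-mono : ∀ n f g → (∀ i → f i ≤ g i) → ∑< n f ≤ ∑< n g
  ∑<-mono zero    f g le = ≤-refl {0ℝ}
  ∑<-mono (suc n) f g le = +-mono-≤ {∑< n f} {∑< n g} {f n} {g n} (∑<-mono n f g le) (le n)

  abstract
    diam-copy : ∃ λ (f : Pred ℝ 0ℓ → ℝ∞) → f ≡ Classical.diam em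
    diam-copy = _ , refl

  Diam : Pred ℝ 0ℓ → ℝ∞
  Diam = proj₁ diam-copy

  make-Cover : ∀ {δ S} (piece : ℕ → Pred ℝ 0ℓ) (d : ℕ → ℝ∞) → (∀ i → d i ≡ Classical.diam em (piece i)) → (∀ i → d i ≤∞ fin δ) →
    (∀ x → S x → ∃[ i ] piece i x) → Classical.Cover em δ S
  make-Cover {δ} piece d d≡ small covers = record { piece = piece ; small = λ i → subst (λ z → z ≤∞ fin δ) (d≡ i) (small i) ; covers = covers }

  Diam≡ : ∀ f → f ≡ Classical.diam em → ∀ U → f U ≡ Classical.diam em U
  Diam≡ f refl U = refl

  cover-of : ∀ {s δ κ S} → PricedCover s δ κ S → Classical.Cover em δ S
  cover-of {s} {δ} 𝒱 = make-Cover piece (λ i → Diam (piece i)) (λ i → Diam≡ Diam (proj₂ diam-copy) (piece i))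
    (λ i → diameter-≤ (piece i) δ (λ x x′ a b → ≤-trans {∣ x - x′ ∣} {size i} {δ} (short i x x′ a b) (size≤δ i))
        (≤-trans {0ℝ} {size i} {δ} (0≤size i) (size≤δ i)) (Diam (piece i)) (Diam≡ Diam (proj₂ diam-copy) (piece i)))
    covers
    where open PricedCover 𝒱

  cover-of-piece : ∀ {s δ κ S} (𝒱 : PricedCover s δ κ S) → Classical.Cover.piece (cover-of 𝒱) ≡ PricedCover.piece 𝒱
  cover-of-piece 𝒱 = refl

  real-diam : ∀ f → f ≡ Classical.diam em → ∀ {δ S} (𝒰 : Classical.Cover em δ S) piece → Classical.Cover.piece 𝒰 ≡ piece →
    ∀ d → d ≡ (λ i → Classical.real em (Classical.diam em (Classical.Cover.piece 𝒰 i))) → ∀ i → d i ≡ Classical.real em (f (piece i))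
  real-diam f refl 𝒰 piece refl d refl i = refl

  cover-cost : ∀ {s δ κ S} (𝒱 : PricedCover s δ κ S) → (𝒰 : Classical.Cover em δ S) → Classical.Cover.piece 𝒰 ≡ PricedCover.piece 𝒱 →
    ∀ z → z ≡ Classical.cost em s 𝒰 → z ≤∞ fin κ
  cover-cost {s} {δ} {κ} 𝒱 𝒰 piece≡ z z≡ = viaD _ refl
    where
    open PricedCover 𝒱
    viaD : ∀ d → d ≡ (λ i → Classical.real em (Classical.diam em (Classical.Cover.piece 𝒰 i))) → z ≤∞ fin κ
    viaD d d≡ = proj₂ (sup-spec (λ n → fin (∑< n λ i → Pow (d i) s)) z (trans z≡ (cost-def Pow (proj₂ pow-copy) s 𝒰 d d≡))) (fin κ)
      λ n → ≤-trans {∑< n (λ i → Pow (d i) s)} {∑< n price} {κ}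
        (∑<-mono n (λ i → Pow (d i) s) price (λ i → priced i (d i) (size≤ i))) (cost≤ n)
      where
      size≤ : ∀ i → d i ≤ size i
      size≤ i = proj₂ (diameter (piece i) (size i) (Diam (piece i)) (d i) (Diam≡ Diam (proj₂ diam-copy) (piece i))
        (diameter-≤ (piece i) (size i) (short i) (0≤size i) (Diam (piece i)) (Diam≡ Diam (proj₂ diam-copy) (piece i)))
        (real-diam Diam (proj₂ diam-copy) 𝒰 piece piece≡ d d≡ i))

  cost-nonneg : ∀ {δ S} s (𝒰 : Classical.Cover em δ S) z → z ≡ Classical.cost em s 𝒰 → fin 0ℝ ≤∞ z
  cost-nonneg s 𝒰 z z≡ = viaD _ refl
    where
    viaD : ∀ d → d ≡ (λ i → Classical.real em (Classical.diam em (Classical.Cover.piece 𝒰 i))) → fin 0ℝ ≤∞ z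
    viaD d d≡ = proj₁ (sup-spec (λ n → fin (∑< n λ i → Pow (d i) s)) z (trans z≡ (cost-def Pow (proj₂ pow-copy) s 𝒰 d d≡))) 0

  PricedCover⇒null : ∀ s S → (∀ δ ε → 0ℝ < δ → 0ℚ ℚ.< ε → PricedCover s δ (0ℝ + fromℚ ε) S) →
    ∀ z → z ≡ Classical.hausdorffMeasure em s S → z ≈∞ fin 0ℝ
  PricedCover⇒null s S cover z z≡ = viaP _ refl
    where
    viaP : ∀ P → P ≡ (λ δ → Classical.premeasure em s δ S) → z ≈∞ fin 0ℝ
    viaP P P≡ = proj₂ spec (fin 0ℝ) (λ (δ , 0<δ) → ≤∞-ε (P δ) 0ℝ (λ ε ε>0 → upper δ 0<δ ε ε>0 _ refl)) ,
      ≤∞-trans {fin 0ℝ} {P 1ℝ} {z} (lower _ refl) (proj₁ spec (1ℝ , 0<1ℝ))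
      where
      spec = sup-spec (λ ((δ , _) : Σ ℝ (0ℝ <_)) → P δ) z (trans z≡ (hausdorffMeasure-def s S P P≡))
      upper : ∀ δ → 0ℝ < δ → ∀ ε → 0ℚ ℚ.< ε → ∀ C → C ≡ Classical.cost em {δ} {S} s → P δ ≤∞ fin (0ℝ + fromℚ ε)
      upper δ 0<δ ε ε>0 C C≡ = ≤∞-trans {P δ} {C 𝒰} {fin (0ℝ + fromℚ ε)}
        (inf-upper C {P δ} 𝒰 (trans (cong-app P≡ δ) (premeasure-def s δ S C C≡)))
        (cover-cost 𝒱 𝒰 (cover-of-piece 𝒱) (C 𝒰) (cong-app C≡ 𝒰))
        where
        𝒱 = cover δ ε 0<δ ε>0
        𝒰 = cover-of 𝒱
      lower : ∀ C → C ≡ Classical.cost em {1ℝ} {S} s → fin 0ℝ ≤∞ P 1ℝ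
      lower C C≡ = inf-lower C {P 1ℝ} 0ℝ (trans (cong-app P≡ 1ℝ) (premeasure-def s 1ℝ S C C≡)) λ 𝒰 → cost-nonneg s 𝒰 (C 𝒰) (cong-app C≡ 𝒰)

  dimH≈1 : ∀ S → (∀ s → 1ℝ < s → ∀ z → z ≡ Classical.hausdorffMeasure em s S → z ≈∞ fin 0ℝ) →
    (∀ s → 0ℝ ≤ s → s < 1ℝ → ∀ z → z ≡ Classical.hausdorffMeasure em s S → ¬ (z ≤∞ fin 0ℝ)) →
    ∀ z → z ≡ Classical.dimH em S → z ≈∞ fin 1ℝ
  dimH≈1 S above below z z≡ = viaH _ refl
    where
    viaH : ∀ H → H ≡ (λ s → Classical.hausdorffMeasure em s S) → z ≈∞ fin 1ℝ
    viaH H H≡ = ≤∞-ε z 1ℝ (λ ε ε>0 → upper (1ℝ + fromℚ ε) (<-cert {1ℝ} {1ℝ + fromℚ ε} {fromℚ ε} (fromℚ-mono-< {0ℚ} {ε} ε>0) (λ n → refl))) ,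
      proj₂ spec (fin 1ℝ) λ (s , 0≤s , null , _) s<1 → below s 0≤s s<1 (H s) (cong-app H≡ s) null
      where
      spec = inf-spec (λ ((s , _) : Σ ℝ λ s → 0ℝ ≤ s × H s ≈∞ fin 0ℝ) → fin s) z (trans z≡ (dimH-def S H H≡))
      upper : ∀ s → 1ℝ < s → z ≤∞ fin s
      upper s 1<s = proj₁ spec (s , <⇒≤ {0ℝ} {s} (<-≤-trans {0ℝ} {1ℝ} {s} 0<1ℝ (<⇒≤ {1ℝ} {s} 1<s)) , above s 1<s (H s) (cong-app H≡ s))

  product : ℝ → ∀ p → Prime p → ℝ → ℕ → ℝ
  product a p pr α q = fromℕ q * Pow (Log (fromℕ q)) (fromℕ 2 - a) * Dist (fromℕ q * α) * fromℚ (padicAbs p pr q) * Pow (Log (fromℚ (2/padicAbs p pr q))) a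

  positive-liminf : ∀ f c N → 0ℝ < c → (∀ n → N ℕ.≤ n → c ≤ f n) → fin 0ℝ <∞ Classical.liminf em f
  positive-liminf f c N 0<c le = via _ refl
    where
    via : ∀ z → z ≡ Classical.liminf em f → ¬ (z ≤∞ fin 0ℝ)
    via z z≡ z≤0 = ≤∞-trans {fin c} {z} {fin 0ℝ} (liminf-lower f c N le z z≡) z≤0 0<c

  abstract
    littlewoodProduct-copy : ∃ λ (f : ℝ → ∀ p → Prime p → ℝ → ℕ → ℝ) → f ≡ Classical.littlewoodProduct em
    littlewoodProduct-copy = _ , refl

    dimH-copy : ∃ λ (D : Pred ℝ 0ℓ → ℝ∞) → D ≡ Classical.dimH em
    dimH-copy = _ , refl

    exceptional-copy : ∀ a p pr → ∃ λ (S : Pred ℝ 0ℓ) → S ≡ (λ α → fin 0ℝ <∞ Classical.liminf em (λ n → Classical.littlewoodProduct em a p pr α (suc n)))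
    exceptional-copy a p pr = _ , refl

  LP : ℝ → ∀ p → Prime p → ℝ → ℕ → ℝ
  LP = proj₁ littlewoodProduct-copy

  LP≡ : ∀ f → f ≡ Classical.littlewoodProduct em → ∀ a p pr α q → f a p pr α q ≡
    product a p pr α q
  LP≡ f refl = littlewoodProduct≡

  exceptional : ∀ f → f ≡ Classical.littlewoodProduct em → ∀ a p pr S →
    S ≡ (λ α → fin 0ℝ <∞ Classical.liminf em (λ n → Classical.littlewoodProduct em a p pr α (suc n))) →
    ∀ x → fin 0ℝ <∞ Classical.liminf em (λ n → f a p pr x (suc n)) → S x
  exceptional f refl a p pr S refl x x∈ = x∈

  dimH-transport : ∀ D → D ≡ Classical.dimH em → ∀ a p pr S →
    S ≡ (λ α → fin 0ℝ <∞ Classical.liminf em (λ n → Classical.littlewoodProduct em a p pr α (suc n))) → D S ≈∞ fin 1ℝ →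
    Classical.dimH em (λ α → fin 0ℝ <∞ Classical.liminf em (λ n → Classical.littlewoodProduct em a p pr α (suc n))) ≈∞ fin 1ℝ
  dimH-transport D refl a p pr S refl eq = eq

  dimH≡ : ∀ D → D ≡ Classical.dimH em → ∀ S → D S ≡ Classical.dimH em S
  dimH≡ D refl S = refl

  Exceptional : ℝ → ∀ p → Prime p → Pred ℝ 0ℓ
  Exceptional a p pr = proj₁ (exceptional-copy a p pr)

  product-bounded⇒Exceptional : ∀ a p pr x c N → 0ℝ < c → (∀ q → N ℕ.≤ q → c ≤ product a p pr x q) → Exceptional a p pr x
  product-bounded⇒Exceptional a p pr x c N 0<c le = exceptional LP (proj₂ littlewoodProduct-copy) a p pr _ (proj₂ (exceptional-copy a p pr)) x
    (positive-liminf (λ n → LP a p pr x (suc n)) c N 0<c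
      λ n N≤n → subst (c ≤_) (sym (LP≡ LP (proj₂ littlewoodProduct-copy) a p pr x (suc n))) (le (suc n) (ℕ.m≤n⇒m≤1+n N≤n)))

  dimH-Exceptional : ∀ a p pr → (∀ s → 1ℝ < s → ∀ δ ε → 0ℝ < δ → 0ℚ ℚ.< ε → PricedCover s δ (0ℝ + fromℚ ε) (Exceptional a p pr)) →
    (∀ s → 0ℝ ≤ s → s < 1ℝ → ∃[ κ ] 0ℝ < κ × ¬ SmallCover s κ (Exceptional a p pr)) →
    Classical.dimH em (λ α → fin 0ℝ <∞ Classical.liminf em (λ n → Classical.littlewoodProduct em a p pr α (suc n))) ≈∞ fin 1ℝ
  dimH-Exceptional a p pr above below = dimH-transport (proj₁ dimH-copy) (proj₂ dimH-copy) a p pr S (proj₂ (exceptional-copy a p pr))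
    (dimH≈1 S (λ s 1<s → PricedCover⇒null s S (above s 1<s))
      (λ s 0≤s s<1 z z≡ z≤0 → let κ , 0<κ , none = below s 0≤s s<1 in none (null⇒SmallCover s S κ 0<κ z z≡ z≤0))
      (proj₁ dimH-copy S) (dimH≡ (proj₁ dimH-copy) (proj₂ dimH-copy) S))
    where S = Exceptional a p pr

  -- Logarithms of powers of two

  log2 : ℝ
  log2 = Log (fromℕ 2)

  0<2ℝ : 0ℝ < fromℕ 2
  0<2ℝ = fromℚ-mono-< {0ℚ} {ι 2} (0<ι 1)

  e-log2 : e log2 ≈ fromℕ 2
  e-log2 = e-log {fromℕ 2} 0<2ℝ

  -- The bound 1 + 2 v for e v is exactly 2 at v = ½.
  ½≤log2 : fromℚ ½ ≤ log2
  ½≤log2 = ≤-log {fromℕ 2} {fromℚ ½} (e≤1+2v {½} 0≤½ ℚ.≤-refl)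

  0≤log2 : 0ℝ ≤ log2
  0≤log2 = ≤-trans {0ℝ} {fromℚ ½} {log2} (fromℚ-mono-≤ {0ℚ} {½} 0≤½) ½≤log2

  *-congˡ : ∀ {z x y} → 0ℝ ≤ z → x ≈ y → z * x ≈ z * y
  *-congˡ {z} {x} {y} 0≤z eq = ≤-antisym {z * x} {z * y} (*-monoˡ-≤ {z} {x} {y} 0≤z (≈⇒≤ {x} {y} eq)) (*-monoˡ-≤ {z} {y} {x} 0≤z (≈⇒≥ {x} {y} eq))

  *-congʳ : ∀ {z x y} → 0ℝ ≤ z → x ≈ y → x * z ≈ y * z
  *-congʳ {z} {x} {y} 0≤z eq = ≤-antisym {x * z} {y * z} (*-monoʳ-≤ {z} {x} {y} 0≤z (≈⇒≤ {x} {y} eq)) (*-monoʳ-≤ {z} {y} {x} 0≤z (≈⇒≥ {x} {y} eq))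

  0≤fromℕ : ∀ n → 0ℝ ≤ fromℕ n
  0≤fromℕ n = fromℚ-mono-≤ {0ℚ} {ι n} (0≤ι n)

  e-2^ : ∀ n → e (fromℕ n * log2) ≈ fromℕ (2 ℕ.^ n)
  e-2^ zero    = ≈-trans {e (fromℕ 0 * log2)} {e 0ℝ} {1ℝ}
    (e-cong {fromℕ 0 * log2} {0ℝ} (pointwise-≈ {fromℕ 0 * log2} {0ℝ} λ n → ℚ.*-zeroˡ (seq log2 n))) e-0
  e-2^ (suc n) = ≈-trans {e (fromℕ (suc n) * log2)} {e (log2 + N)} {fromℕ (2 ℕ.^ suc n)}
    (e-cong {fromℕ (suc n) * log2} {log2 + N} (pointwise-≈ {fromℕ (suc n) * log2} {log2 + N} λ k →
      trans (cong (ℚ._* seq log2 k) (ι-suc n)) (solve 2 (λ n l → (con 1ℚ :+ n) :* l := l :+ n :* l) refl (ι n) (seq log2 k))))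
    (≈-trans {e (log2 + N)} {e log2 * e N} {fromℕ (2 ℕ.^ suc n)} (e-+ log2 N)
      (≈-trans {e log2 * e N} {fromℕ 2 * e N} {fromℕ (2 ℕ.^ suc n)} (*-congʳ {e N} {e log2} {fromℕ 2} (0≤e N) e-log2)
        (≈-trans {fromℕ 2 * e N} {fromℕ 2 * fromℕ (2 ℕ.^ n)} {fromℕ (2 ℕ.^ suc n)} (*-congˡ {fromℕ 2} {e N} {fromℕ (2 ℕ.^ n)} (0≤fromℕ 2) (e-2^ n))
          (pointwise-≈ {fromℕ 2 * fromℕ (2 ℕ.^ n)} {fromℕ (2 ℕ.^ suc n)} λ _ → sym (ι-* 2 (2 ℕ.^ n))))))
    where N = fromℕ n * log2

  e-h : ∀ n → e (- (fromℕ n * log2)) ≈ fromℚ (h n)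
  e-h n = ≈-trans {y} {H * (fromℕ (2 ℕ.^ n) * y)} {H}
    (pointwise-≈ {y} {H * (fromℕ (2 ℕ.^ n) * y)} λ k → sym (trans (solve 3 (λ h t y → h :* (t :* y) := (t :* h) :* y) refl (h n) (ι (2 ℕ.^ n)) (seq y k))
      (trans (cong (ℚ._* seq y k) (2^*h n)) (ℚ.*-identityˡ (seq y k)))))
    (≈-trans {H * (fromℕ (2 ℕ.^ n) * y)} {H * (e x * y)} {H}
      (*-congˡ {H} {fromℕ (2 ℕ.^ n) * y} {e x * y} 0≤H (*-congʳ {y} {fromℕ (2 ℕ.^ n)} {e x} (0≤e (- x)) (≈-sym {e x} {fromℕ (2 ℕ.^ n)} (e-2^ n))))
      (≈-trans {H * (e x * y)} {H * 1ℝ} {H} (*-congˡ {H} {e x * y} {1ℝ} 0≤H (e-inverse x)) (pointwise-≈ {H * 1ℝ} {H} λ _ → ℚ.*-identityʳ (h n))))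
    where
    x = fromℕ n * log2
    y = e (- x)
    H = fromℚ (h n)
    0≤H = fromℚ-mono-≤ {0ℚ} {h n} (0≤h n)

  2≤2/padicAbs : ∀ p pr q → ι 2 ℚ.≤ 2/padicAbs p pr q
  2≤2/padicAbs p pr q = ℚ.≤-trans (≤-by (gap 1≤N ⊞ gap 1≤N) (solve 1 (λ n → con (ι 2) :* n := con (ι 2) :+ ((n :- con 1ℚ) :+ (n :- con 1ℚ))) refl N))
    (ℚ.≤-reflexive (sym (trans (sym (ℚ.*-identityʳ x)) (trans (cong (x ℚ.*_) (sym Nπ≡1))
      (trans (solve 3 (λ r n π → (con (ι 2) :* r) :* (n :* π) := (con (ι 2) :* n) :* (r :* π)) refl r N π)
        (trans (cong ((ι 2 ℚ.* N) ℚ.*_) (ℚ.*-inverseˡ π {{padicAbs≢0 p pr q}})) (ℚ.*-identityʳ (ι 2 ℚ.* N))))))))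
    where
    N = ι (p ℕ.^ val p q)
    π = padicAbs p pr q
    r = (ℚ.1/ π) {{padicAbs≢0 p pr q}}
    x = 2/padicAbs p pr q
    1≤N : 1ℚ ℚ.≤ N
    1≤N = ι-mono-≤ {1} (ℕ.m^n>0 p {{prime⇒nonZero pr}} (val p q))
    Nπ≡1 : N ℚ.* π ≡ 1ℚ
    Nπ≡1 = *-inverse-/ (p ℕ.^ val p q) {{ℕ.m^n≢0 p (val p q) {{prime⇒nonZero pr}}}}

  product-mono : ∀ Q A B D F Π G C → 0ℝ ≤ Q → 0ℝ ≤ A → A ≤ B → 0ℝ ≤ D → D ≤ F → 0ℝ ≤ Π → 0ℝ ≤ G → G ≤ C → Q * A * D * Π * G ≤ Q * B * F * Π * C
  product-mono Q A B D F Π G C 0≤Q 0≤A A≤B 0≤D D≤F 0≤Π 0≤G G≤C =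
    *-mono-≤ {Q * A * D * Π} {Q * B * F * Π} {G} {C} (0≤-* {Q * B * F} {Π} (0≤-* {Q * B} {F} 0≤QB 0≤F) 0≤Π) 0≤G
      (*-monoʳ-≤ {Π} {Q * A * D} {Q * B * F} 0≤Π (*-mono-≤ {Q * A} {Q * B} {D} {F} 0≤QB 0≤D (*-monoˡ-≤ {Q} {A} {B} 0≤Q A≤B) D≤F)) G≤C
    where
    0≤F = ≤-trans {0ℝ} {D} {F} 0≤D D≤F
    0≤QB = 0≤-* {Q} {B} 0≤Q (≤-trans {0ℝ} {A} {B} 0≤A A≤B)

  -- The Diophantine lower bound at the limit point

  module LowerBound (u-1 p : ℕ) (pr : Prime p) (J : ℕ → ℕ) (J₀ : J 0 ≡ 1)
    (bounds : ∀ t j → J j ℕ.* Construction.R u-1 p pr ℕ.^ t ℕ.≤ J (j ℕ.+ t) × J (j ℕ.+ t) ℕ.< suc (J j) ℕ.* Construction.R u-1 p pr ℕ.^ t)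
    (avoid : ∀ n → J (suc n ℕ.+ Construction.depth u-1 p pr (suc n)) ∉ Construction.forbid u-1 p pr (suc n) (J (suc n)))
    (a : ℝ) (0≤a : 0ℝ ≤ a) (a<1 : a < 1ℝ) (v≤[2-a]u : fromℕ (Construction.v u-1 p pr) ≤ (fromℕ 2 - a) * fromℕ (Construction.u u-1 p pr)) where

    open Construction u-1 p pr

    point : ℝ
    point = α u-1 p pr J J₀ bounds avoid

    -- z absorbs the constants in 2 ^ (u w) ≤ 6 v n = 24 v · n / 4: since 24 v ≤ 2 ^ z, it follows
    -- that 2 ^ (u w - z) ≤ n / 4 ≤ log q. K is what remains when the exponent - (v (w + 2) + 2) +
    -- (2 - a) (u w - z) - a is bounded below by means of v ≤ (2 - a) u and 0 ≤ a ≤ 1.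
    z K : ℕ
    z = 24 ℕ.* v
    K = 2 ℕ.* v ℕ.+ 2 ℕ.+ 2 ℕ.* z ℕ.+ 1

    module _ (q n : ℕ) (q>0 : 0 ℕ.< q) (n>0 : 0 ℕ.< n) (large : 2 ℕ.^ n ℕ.≤ q ℕ.* q)
      (far : ∀ z → fromℚ (ι q ℚ.* h (v ℕ.* (n ℕ.+ depth n))) ≤ ∣ fromℕ q * point - fromℤ z ∣)
      (bound : h (v ℕ.* suc (depth n) ℕ.+ 2) ℚ.≤ ι q ℚ.* (ι q ℚ.* h (v ℕ.* (n ℕ.+ depth n))) ℚ.* padicAbs p pr q) where

      r : ℚ
      r = h (v ℕ.* (n ℕ.+ depth n))

      L₁ L₂ : ℝ
      L₁ = Log (fromℕ q)
      L₂ = Log (fromℚ (2/padicAbs p pr q))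

      -- From 2 ^ n ≤ q² by taking logarithms, n log 2 ≤ 2 log q; one factor ½ comes from the square
      -- and the other from log 2 ≥ ½.
      n/4≤L₁ : fromℚ (½ ℚ.* (½ ℚ.* ι n)) ≤ L₁
      n/4≤L₁ = ≤-cert {fromℚ (½ ℚ.* (½ ℚ.* ι n))} {L₁} {fromℚ ½ * (((L₁ + L₁) - fromℕ n * log2) + fromℕ n * (log2 - fromℚ ½))}
        (0≤-* {fromℚ ½} {((L₁ + L₁) - fromℕ n * log2) + fromℕ n * (log2 - fromℚ ½)} (fromℚ-mono-≤ {0ℚ} {½} 0≤½)
          (0≤-+ {(L₁ + L₁) - fromℕ n * log2} {fromℕ n * (log2 - fromℚ ½)} (0≤gap {fromℕ n * log2} {L₁ + L₁} nℓ≤2L₁)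
            (0≤-* {fromℕ n} {log2 - fromℚ ½} (0≤fromℕ n) (0≤gap {fromℚ ½} {log2} ½≤log2))))
        λ k → solve 3 (λ L n l → L := con ½ :* (con ½ :* n) :+ con ½ :* ((L :+ L :+ :- (n :* l)) :+ n :* (l :+ :- con ½))) refl (seq L₁ k) (ι n) (seq log2 k)
        where
        eL₁ : e L₁ ≈ fromℕ q
        eL₁ = e-log {fromℕ q} (fromℚ-mono-< {0ℚ} {ι q} (ι-mono-< {0} q>0))
        nℓ≤2L₁ : fromℕ n * log2 ≤ L₁ + L₁
        nℓ≤2L₁ = e-cancel-≤ {fromℕ n * log2} {L₁ + L₁} (≤-trans {e (fromℕ n * log2)} {fromℕ (q ℕ.* q)} {e (L₁ + L₁)}
          (≤-trans {e (fromℕ n * log2)} {fromℕ (2 ℕ.^ n)} {fromℕ (q ℕ.* q)} (≈⇒≤ {e (fromℕ n * log2)} {fromℕ (2 ℕ.^ n)} (e-2^ n)) (fromℚ-mono-≤ (ι-mono-≤ large)))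
          (≤-trans {fromℕ (q ℕ.* q)} {fromℕ q * fromℕ q} {e (L₁ + L₁)} (pointwise-≤ {fromℕ (q ℕ.* q)} {fromℕ q * fromℕ q} λ _ → ℚ.≤-reflexive (ι-* q q))
            (≤-trans {fromℕ q * fromℕ q} {e L₁ * e L₁} {e (L₁ + L₁)}
              (*-mono-≤ {fromℕ q} {e L₁} {fromℕ q} {e L₁} (0≤e L₁) (0≤fromℕ q) (≈⇒≥ {e L₁} {fromℕ q} eL₁) (≈⇒≥ {e L₁} {fromℕ q} eL₁))
              (≈⇒≥ {e (L₁ + L₁)} {e L₁ * e L₁} (e-+ L₁ L₁)))))

      log2≤L₂ : log2 ≤ L₂
      log2≤L₂ = ≤-log {fromℚ (2/padicAbs p pr q)} {log2} (≤-trans {e log2} {fromℕ 2} {fromℚ (2/padicAbs p pr q)} (≈⇒≤ {e log2} {fromℕ 2} e-log2) (fromℚ-mono-≤ (2≤2/padicAbs p pr q)))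

      module _ (w : ℕ) (depth≡ : depth n ≡ suc w) (2^≤ : 2 ℕ.^ (u ℕ.* w) ℕ.≤ 6 ℕ.* (v ℕ.* n)) where

        -- y₁ and y₂ are the natural logarithms of 2 ^ (u w - z) and ½, the lower bounds used for
        -- log q and for log (2 / |q|_p). In this form raising to the powers c and a becomes
        -- multiplication.
        y₁ y₂ c : ℝ
        y₁ = fromℕ (u ℕ.* w) * log2 - fromℕ z * log2
        y₂ = - (fromℕ 1 * log2)
        c  = fromℕ 2 - a

        0≤c : 0ℝ ≤ c
        0≤c = ≤-cert {0ℝ} {c} {(1ℝ - a) + 1ℝ} (0≤-+ {1ℝ - a} {1ℝ} (0≤gap {a} {1ℝ} (<⇒≤ {a} {1ℝ} a<1)) (<⇒≤ {0ℝ} {1ℝ} 0<1ℝ))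
          λ k → solve 1 (λ a → con (ι 2) :+ :- a := con 0ℚ :+ ((con 1ℚ :+ :- a) :+ con 1ℚ)) refl (seq a k)

        small-power : ι (2 ℕ.^ (u ℕ.* w)) ℚ.* h z ℚ.≤ ½ ℚ.* (½ ℚ.* ι n)
        small-power = ℚ.≤-trans (ℚ.*-monoʳ-≤-nonNeg (h z) {{ℚ.nonNegative (0≤h z)}} (ι-mono-≤ 2^≤))
          (≤-by (0≤½ ⊠ (0≤½ ⊠ (0≤ι n ⊠ gap zh≤1)))
            (trans (solve 3 (λ n z h → con ½ :* (con ½ :* n) := (con ½ :* (con ½ :* n)) :* (z :* h) :+ con ½ :* (con ½ :* (n :* (con 1ℚ :- z :* h)))) refl (ι n) (ι z) (h z))
              (cong (ℚ._+ ½ ℚ.* (½ ℚ.* (ι n ℚ.* (1ℚ ℚ.- ι z ℚ.* h z)))) (trans (cong (λ x → (½ ℚ.* (½ ℚ.* ι n)) ℚ.* (x ℚ.* h z)) (ι-* 24 v))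
                (trans (solve 3 (λ n v h → (con ½ :* (con ½ :* n)) :* ((con (ι 24) :* v) :* h) := (con (ι 6) :* (v :* n)) :* h) refl (ι n) (ι v) (h z))
                  (cong (ℚ._* h z) (sym (trans (ι-* 6 (v ℕ.* n)) (cong (ι 6 ℚ.*_) (ι-* v n))))))))))
          where
          zh≤1 : ι z ℚ.* h z ℚ.≤ 1ℚ
          zh≤1 = ℚ.≤-trans (ℚ.*-monoʳ-≤-nonNeg (h z) {{ℚ.nonNegative (0≤h z)}} (ι-mono-≤ (n≤2^n z))) (ℚ.≤-reflexive (2^*h z))

        ey₁≤L₁ : e y₁ ≤ L₁
        ey₁≤L₁ = ≤-trans {e y₁} {fromℕ (2 ℕ.^ (u ℕ.* w)) * fromℚ (h z)} {L₁}
          (≤-trans {e y₁} {e A * e (- B)} {fromℕ (2 ℕ.^ (u ℕ.* w)) * fromℚ (h z)} (≈⇒≤ {e y₁} {e A * e (- B)} (e-+ A (- B)))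
            (*-mono-≤ {e A} {fromℕ (2 ℕ.^ (u ℕ.* w))} {e (- B)} {fromℚ (h z)} (0≤fromℕ (2 ℕ.^ (u ℕ.* w))) (0≤e (- B))
              (≈⇒≤ {e A} {fromℕ (2 ℕ.^ (u ℕ.* w))} (e-2^ (u ℕ.* w))) (≈⇒≤ {e (- B)} {fromℚ (h z)} (e-h z))))
          (≤-trans {fromℕ (2 ℕ.^ (u ℕ.* w)) * fromℚ (h z)} {fromℚ (½ ℚ.* (½ ℚ.* ι n))} {L₁} (fromℚ-mono-≤ small-power) n/4≤L₁)
          where
          A = fromℕ (u ℕ.* w) * log2
          B = fromℕ z * log2

        ey₂≤L₂ : e y₂ ≤ L₂
        ey₂≤L₂ = ≤-trans {e y₂} {fromℚ ½} {L₂} (≈⇒≤ {e y₂} {fromℚ ½} (e-h 1)) (≤-trans {fromℚ ½} {log2} {L₂} ½≤log2 log2≤L₂)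

        m : ℕ
        m = v ℕ.* suc (depth n) ℕ.+ 2

        exponent : - (fromℕ K * log2) ≤ - (fromℕ m * log2) + (c * y₁ + a * y₂)
        exponent = ≤-cert { - (fromℕ K * log2)} { - (fromℕ m * log2) + (c * y₁ + a * y₂)} {D}
          (0≤-* {log2} {fromℕ w * (c * fromℕ u - fromℕ v) + (a * fromℕ z + (1ℝ - a))} 0≤log2
            (0≤-+ {fromℕ w * (c * fromℕ u - fromℕ v)} {a * fromℕ z + (1ℝ - a)}
              (0≤-* {fromℕ w} {c * fromℕ u - fromℕ v} (0≤fromℕ w) (0≤gap {fromℕ v} {c * fromℕ u} v≤[2-a]u))
              (0≤-+ {a * fromℕ z} {1ℝ - a} (0≤-* {a} {fromℕ z} 0≤a (0≤fromℕ z)) (0≤gap {a} {1ℝ} (<⇒≤ {a} {1ℝ} a<1)))))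
          λ k → trans (cong₂ (λ m uw → ℚ.- (m ℚ.* seq log2 k) ℚ.+ ((ι 2 ℚ.+ ℚ.- seq a k) ℚ.* (uw ℚ.* seq log2 k ℚ.+ ℚ.- (ι z ℚ.* seq log2 k)) ℚ.+ seq a k ℚ.* (ℚ.- (ι 1 ℚ.* seq log2 k)))) ιm (ι-* u w))
            (trans (solve 6 (λ l a u v w z → :- ((v :* (w :+ con (ι 2)) :+ con (ι 2)) :* l) :+ ((con (ι 2) :+ :- a) :* (u :* w :* l :+ :- (z :* l)) :+ a :* (:- (con (ι 1) :* l)))
                := :- ((con (ι 2) :* v :+ con (ι 2) :+ con (ι 2) :* z :+ con (ι 1)) :* l) :+ l :* (w :* ((con (ι 2) :+ :- a) :* u :+ :- v) :+ (a :* z :+ (con 1ℚ :+ :- a))))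
                refl (seq log2 k) (seq a k) (ι u) (ι v) (ι w) (ι z))
              (cong (λ K → ℚ.- (K ℚ.* seq log2 k) ℚ.+ seq D k) (sym ιK)))
          where
          D = log2 * (fromℕ w * (c * fromℕ u - fromℕ v) + (a * fromℕ z + (1ℝ - a)))
          ιm : ι m ≡ ι v ℚ.* (ι w ℚ.+ ι 2) ℚ.+ ι 2
          ιm = trans (ι-+ (v ℕ.* suc (depth n)) 2) (cong (ℚ._+ ι 2) (trans (ι-* v (suc (depth n)))
            (cong (ι v ℚ.*_) (trans (cong ι (trans (cong suc depth≡) (ℕ.+-comm 2 w))) (ι-+ w 2)))))
          ιK : ι K ≡ ι 2 ℚ.* ι v ℚ.+ ι 2 ℚ.+ ι 2 ℚ.* ι z ℚ.+ ι 1
          ιK = trans (ι-+ (2 ℕ.* v ℕ.+ 2 ℕ.+ 2 ℕ.* z) 1) (cong (ℚ._+ ι 1) (trans (ι-+ (2 ℕ.* v ℕ.+ 2) (2 ℕ.* z))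
            (cong₂ ℚ._+_ (trans (ι-+ (2 ℕ.* v) 2) (cong (ℚ._+ ι 2) (ι-* 2 v))) (ι-* 2 z))))

        product-bound-at : e (- (fromℕ K * log2)) ≤ product a p pr point q
        product-bound-at = ≤-trans {e (- (fromℕ K * log2))} {E₀ * (E₁ * E₂)} {product a p pr point q}
          (≤-trans {e (- (fromℕ K * log2))} {e (- (fromℕ m * log2) + (c * y₁ + a * y₂))} {E₀ * (E₁ * E₂)} (e-mono-≤ { - (fromℕ K * log2)} { - (fromℕ m * log2) + (c * y₁ + a * y₂)} exponent)
            (≤-trans {e (- (fromℕ m * log2) + (c * y₁ + a * y₂))} {E₀ * e (c * y₁ + a * y₂)} {E₀ * (E₁ * E₂)}
              (≈⇒≤ {e (- (fromℕ m * log2) + (c * y₁ + a * y₂))} {E₀ * e (c * y₁ + a * y₂)} (e-+ (- (fromℕ m * log2)) (c * y₁ + a * y₂)))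
              (*-monoˡ-≤ {E₀} {e (c * y₁ + a * y₂)} {E₁ * E₂} (0≤e (- (fromℕ m * log2))) (≈⇒≤ {e (c * y₁ + a * y₂)} {E₁ * E₂} (e-+ (c * y₁) (a * y₂))))))
          (≤-trans {E₀ * (E₁ * E₂)} {Q * E₁ * F * Π * E₂} {product a p pr point q}
            (≤-trans {E₀ * (E₁ * E₂)} {fromℚ (ι q ℚ.* (ι q ℚ.* r) ℚ.* padicAbs p pr q) * (E₁ * E₂)} {Q * E₁ * F * Π * E₂}
              (*-monoʳ-≤ {E₁ * E₂} {E₀} {fromℚ (ι q ℚ.* (ι q ℚ.* r) ℚ.* padicAbs p pr q)} (0≤-* {E₁} {E₂} (0≤e (c * y₁)) (0≤e (a * y₂)))
                (≤-trans {E₀} {fromℚ (h m)} {fromℚ (ι q ℚ.* (ι q ℚ.* r) ℚ.* padicAbs p pr q)} (≈⇒≤ {E₀} {fromℚ (h m)} (e-h m)) (fromℚ-mono-≤ bound)))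
              (pointwise-≤ {fromℚ (ι q ℚ.* (ι q ℚ.* r) ℚ.* padicAbs p pr q) * (E₁ * E₂)} {Q * E₁ * F * Π * E₂} λ k →
                ℚ.≤-reflexive (solve 5 (λ q f π a b → q :* f :* π :* (a :* b) := q :* a :* f :* π :* b) refl (ι q) (ι q ℚ.* r) (padicAbs p pr q) (seq E₁ k) (seq E₂ k))))
            (product-mono Q E₁ (Pow L₁ c) F (Dist (fromℕ q * point)) Π E₂ (Pow L₂ a) (0≤fromℕ q) (0≤e (c * y₁)) (e≤Pow {L₁} {y₁} {c} 0≤c ey₁≤L₁)
              (fromℚ-mono-≤ {0ℚ} {ι q ℚ.* r} (0≤ι q ⊠ 0≤h (v ℕ.* (n ℕ.+ depth n)))) (Dist-lower (fromℕ q * point) F far)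
              (fromℚ-mono-≤ {0ℚ} (ℚ.<⇒≤ (0<1/ (p ℕ.^ val p q) {{ℕ.m^n≢0 p (val p q) {{prime⇒nonZero pr}}}})))
              (0≤e (a * y₂)) (e≤Pow {L₂} {y₂} {a} 0≤a ey₂≤L₂)))
          where
          E₀ = e (- (fromℕ m * log2))
          E₁ = e (c * y₁)
          E₂ = e (a * y₂)
          Q = fromℕ q
          F = fromℚ (ι q ℚ.* r)
          Π = fromℚ (padicAbs p pr q)

      product-bound : e (- (fromℕ K * log2)) ≤ product a p pr point q
      product-bound = from (depth n) refl (depth-spec n .proj₂ .proj₁) (depth-spec n .proj₂ .proj₂)
        where
        from : ∀ t → depth n ≡ t → 6 ℕ.* (v ℕ.* n) ℕ.< 2 ℕ.^ (u ℕ.* t) → (∀ w → t ≡ suc w → ¬ 6 ℕ.* (v ℕ.* n) ℕ.< 2 ℕ.^ (u ℕ.* w)) → e (- (fromℕ K * log2)) ≤ product a p pr point q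
        from zero    _   lt _   = ⊥-elim (ℕ.<-irrefl refl (ℕ.<-≤-trans (subst (λ x → 6 ℕ.* (v ℕ.* n) ℕ.< 2 ℕ.^ x) (ℕ.*-zeroʳ u) lt)
          (ℕ.*-mono-≤ {1} {6} (ℕ.s≤s ℕ.z≤n) (ℕ.*-mono-≤ {1} {v} (ℕ.s≤s ℕ.z≤n) n>0))))
        from (suc w) eq _  least = product-bound-at w eq (ℕ.≮⇒≥ (least w refl))

    eventual-bound : ∀ q → R ℕ.^ 4 ℕ.≤ q → e (- (fromℕ K * log2)) ≤ product a p pr point q
    eventual-bound q R⁴≤q = from (estimate u-1 p pr J J₀ bounds avoid q R⁴≤q)
      where
      from : Estimate u-1 p pr point q → e (- (fromℕ K * log2)) ≤ product a p pr point q
      from (n , n>0 , large , far , bound) = product-bound q n (ℕ.<-≤-trans (0<R^ 4) R⁴≤q) n>0 large far bound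

    point∈Exceptional : Exceptional a p pr point
    point∈Exceptional = product-bounded⇒Exceptional a p pr point (e (- (fromℕ K * log2))) (R ℕ.^ 4) (0<e (- (fromℕ K * log2))) eventual-bound

  -- Covers of the line for s > 1

  ∑<-fromℚ : ∀ n c k → seq (∑< n (λ i → fromℚ (c i))) k ≡ ∑ n c
  ∑<-fromℚ zero    c k = refl
  ∑<-fromℚ (suc n) c k = cong (ℚ._+ c n) (∑<-fromℚ n c k)

  -- Block b consists of 2 ^ ((E + 1) b + 1) intervals of length 2 ^ (- E b) covering
  -- [-2 ^ b , 2 ^ b]; when s E ≥ E + 2 their s-th powers add up to at most 2 · 2 ^ (- b).
  module Blocks (E H : ℕ) where

    count top : ℕ → ℕ
    count b = 2 ℕ.^ suc (suc E ℕ.* b)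
    top b = ℕ.pred (count b)

    suc-top : ∀ b → suc (top b) ≡ count b
    suc-top b = ℕ.suc-pred (count b) {{ℕ.m^n≢0 2 (suc (suc E ℕ.* b))}}

    -- Positions run downwards, so that the end of a block is recognised at 0 and the enumeration
    -- needs no comparison.
    next : ℕ × ℕ → ℕ × ℕ
    next (b , zero)  = suc b , top (suc b)
    next (b , suc k) = b , k

    state : ℕ → ℕ × ℕ
    state zero    = H , top H
    state (suc n) = next (state n)

    block position : ℕ → ℕ
    block i = proj₁ (state i)
    position i = proj₂ (state i)

    price : ℕ → ℚ
    price b = h (suc (suc E) ℕ.* b)

    block-price : ∀ b → ι (suc (top b)) ℚ.* price b ≡ h b ℚ.+ h b
    block-price b = trans (cong (λ n → ι n ℚ.* price b) (suc-top b))
      (trans (solve 2 (λ a p → a :* p := a :* (con ½ :* p) :+ a :* (con ½ :* p)) refl (ι (count b)) (price b)) (cong (λ z → z ℚ.+ z) half))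
      where
      half : ι (count b) ℚ.* (½ ℚ.* price b) ≡ h b
      half = trans (cong (ι (count b) ℚ.*_) (trans (cong h (trans (cong suc (ℕ.+-comm b (suc E ℕ.* b))) refl)) (h-+ (suc (suc E ℕ.* b)) b)))
        (trans (sym (ℚ.*-assoc (ι (count b)) (h (suc (suc E ℕ.* b))) (h b))) (trans (cong (ℚ._* h b) (2^*h (suc (suc E ℕ.* b)))) (ℚ.*-identityˡ (h b))))

    -- The exact price of everything still to come: positions k down to 0 of block b, and then the
    -- later blocks, whose prices 2 · 2 ^ (- b′) for b′ > b add up to 2 · 2 ^ (- b).
    remaining : ℕ × ℕ → ℚ
    remaining (b , k) = ι (suc k) ℚ.* price b ℚ.+ (h b ℚ.+ h b)

    remaining-next : ∀ s → price (proj₁ s) ℚ.+ remaining (next s) ≡ remaining s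
    remaining-next (b , zero)  = trans (cong (λ z → price b ℚ.+ (z ℚ.+ (½ ℚ.* h b ℚ.+ ½ ℚ.* h b))) (block-price (suc b)))
      (solve 2 (λ p h → p :+ ((con ½ :* h :+ con ½ :* h) :+ (con ½ :* h :+ con ½ :* h)) := con (ι 1) :* p :+ (h :+ h)) refl (price b) (h b))
    remaining-next (b , suc k) = trans (solve 3 (λ p k h → p :+ (k :* p :+ (h :+ h)) := (con 1ℚ :+ k) :* p :+ (h :+ h)) refl (price b) (ι (suc k)) (h b))
      (cong (λ z → z ℚ.* price b ℚ.+ (h b ℚ.+ h b)) (sym (ι-suc (suc k))))

    spent : ∀ n → ∑ n (λ i → price (block i)) ℚ.+ remaining (state n) ≡ (h H ℚ.+ h H) ℚ.+ (h H ℚ.+ h H)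
    spent zero    = trans (ℚ.+-identityˡ _) (cong (ℚ._+ (h H ℚ.+ h H)) (block-price H))
    spent (suc n) = trans (ℚ.+-assoc (∑ n (λ i → price (block i))) (price (block n)) (remaining (next (state n))))
      (trans (cong (∑ n (λ i → price (block i)) ℚ.+_) (remaining-next (state n))) (spent n))

    0≤remaining : ∀ s → 0ℚ ℚ.≤ remaining s
    0≤remaining (b , k) = 0≤ι (suc k) ⊠ 0≤h (suc (suc E) ℕ.* b) ⊞ (0≤h b ⊞ 0≤h b)

    total-price : ∀ n → ∑ n (λ i → price (block i)) ℚ.≤ (h H ℚ.+ h H) ℚ.+ (h H ℚ.+ h H)
    total-price n = ≤-by (0≤remaining (state n)) (sym (spent n))

    descend : ∀ j i b k → state i ≡ (b , j ℕ.+ k) → ∃[ i′ ] state i′ ≡ (b , k)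
    descend zero    i b k eq = i , eq
    descend (suc j) i b k eq = descend j (suc i) b k (cong next eq)

    start : ∀ d → ∃[ i ] state i ≡ (H ℕ.+ d , top (H ℕ.+ d))
    start zero    = 0 , cong (λ b → b , top b) (sym (ℕ.+-identityʳ H))
    start (suc d) =
      let i , eq = start d
          i′ , eq′ = descend (top (H ℕ.+ d)) i (H ℕ.+ d) 0 (trans eq (cong (H ℕ.+ d ,_) (sym (ℕ.+-identityʳ (top (H ℕ.+ d))))))
      in suc i′ , trans (cong next eq′) (cong (λ b → b , top b) (sym (ℕ.+-suc H d)))

    reach : ∀ b k → H ℕ.≤ b → k ℕ.≤ top b → ∃[ i ] state i ≡ (b , k)
    reach b k H≤b k≤top =
      let i , eq = start (b ℕ.∸ H)
      in descend (top b ℕ.∸ k) i b k (trans eq (trans (cong (λ b → b , top b) (ℕ.m+[n∸m]≡n H≤b)) (cong (b ,_) (sym (ℕ.m∸n+n≡m k≤top)))))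

    H≤block : ∀ i → H ℕ.≤ block i
    H≤block zero    = ℕ.≤-refl
    H≤block (suc i) = ℕ.≤-trans (H≤block i) (grows (state i))
      where
      grows : ∀ s → proj₁ s ℕ.≤ proj₁ (next s)
      grows (b , zero)  = ℕ.n≤1+n b
      grows (b , suc k) = ℕ.≤-refl

    mesh : ℕ → ℚ
    mesh b = h (E ℕ.* b)

    endpoint : ℕ → ℕ → ℚ
    endpoint b k = ι k ℚ.* mesh b ℚ.- ι (2 ℕ.^ b)

    Piece : ℕ → ℕ → Pred ℝ 0ℓ
    Piece b k x = fromℚ (endpoint b k) ≤ x × x ≤ fromℚ (endpoint b (suc k))

    endpoint-suc : ∀ b k → endpoint b (suc k) ≡ endpoint b k ℚ.+ mesh b
    endpoint-suc b k = trans (cong (λ z → z ℚ.* mesh b ℚ.- ι (2 ℕ.^ b)) (ι-suc k))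
      (solve 3 (λ k m c → (con 1ℚ :+ k) :* m :- c := (k :* m :- c) :+ m) refl (ι k) (mesh b) (ι (2 ℕ.^ b)))

    Piece-short : ∀ b k x y → Piece b k x → Piece b k y → ∣ x - y ∣ ≤ fromℚ (mesh b)
    Piece-short b k x y (l≤x , x≤u) (l≤y , y≤u) = ∣∣-least {x - y} {fromℚ (mesh b)} (half x y x≤u l≤y)
      (≤-trans { - (x - y)} {y - x} {fromℚ (mesh b)} (pointwise-≤ { - (x - y)} {y - x} λ n → ℚ.≤-reflexive (solve 2 (λ x y → :- (x :+ :- y) := y :+ :- x) refl (seq x n) (seq y n))) (half y x y≤u l≤x))
      where
      l = fromℚ (endpoint b k)
      u = fromℚ (endpoint b (suc k))
      half : ∀ x y → x ≤ u → l ≤ y → x - y ≤ fromℚ (mesh b)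
      half x y x≤u l≤y = ≤-cert {x - y} {fromℚ (mesh b)} {(u - x) + (y - l)} (0≤-+ {u - x} {y - l} (0≤gap {x} {u} x≤u) (0≤gap {l} {y} l≤y))
        λ n → trans (solve 4 (λ x y l m → m := (x :+ :- y) :+ (((l :+ m) :+ :- x) :+ (y :+ :- l))) refl (seq x n) (seq y n) (endpoint b k) (mesh b))
          (cong (λ z → (seq x n ℚ.+ ℚ.- seq y n) ℚ.+ ((z ℚ.+ ℚ.- seq x n) ℚ.+ (seq y n ℚ.+ ℚ.- endpoint b k))) (sym (endpoint-suc b k)))

    locate : ∀ b x m → fromℚ (endpoint b 0) ≤ x → x ≤ fromℚ (endpoint b (suc m)) → ∃[ k ] k ℕ.≤ m × Piece b k x
    locate b x zero    l≤x x≤u = 0 , ℕ.z≤n , l≤x , x≤u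
    locate b x (suc m) l≤x x≤u with ≤-or-> x (fromℚ (endpoint b (suc m)))
    ... | inj₁ x≤m = let k , k≤m , piece = locate b x m l≤x x≤m in k , ℕ.m≤n⇒m≤1+n k≤m , piece
    ... | inj₂ m<x = suc m , ℕ.≤-refl , <⇒≤ {fromℚ (endpoint b (suc m))} {x} m<x , x≤u

    endpoint-top : ∀ b → endpoint b (suc (top b)) ≡ ι (2 ℕ.^ b)
    endpoint-top b = trans (cong (λ n → ι n ℚ.* mesh b ℚ.- ι (2 ℕ.^ b)) (suc-top b))
      (trans (cong (ℚ._- ι (2 ℕ.^ b)) whole) (solve 1 (λ c → (c :+ c) :- c := c) refl (ι (2 ℕ.^ b))))
      where
      whole : ι (count b) ℚ.* mesh b ≡ ι (2 ℕ.^ b) ℚ.+ ι (2 ℕ.^ b)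
      whole = trans (cong (λ n → ι n ℚ.* mesh b) (trans (cong (2 ℕ.^_) (sym (ℕ.+-suc b (E ℕ.* b) ))) (trans (ℕ.^-distribˡ-+-* 2 b (suc (E ℕ.* b))) refl)))
        (trans (cong (ℚ._* mesh b) (ι-* (2 ℕ.^ b) (2 ℕ.^ suc (E ℕ.* b))))
          (trans (cong (λ z → ι (2 ℕ.^ b) ℚ.* z ℚ.* mesh b) (2^-suc (E ℕ.* b)))
            (trans (solve 3 (λ c d m → c :* (d :+ d) :* m := c :* (d :* m) :+ c :* (d :* m)) refl (ι (2 ℕ.^ b)) (ι (2 ℕ.^ (E ℕ.* b))) (mesh b))
              (cong (λ z → z ℚ.+ z) (trans (cong (ι (2 ℕ.^ b) ℚ.*_) (2^*h (E ℕ.* b))) (ℚ.*-identityʳ (ι (2 ℕ.^ b))))))))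

    covered : ∀ x → ∃[ i ] Piece (block i) (position i) x
    covered x =
      let B , -B≤x = lower-bound x
          C , x≤C = upper-bound x
          b = H ℕ.+ (B ℕ.+ C)
          B≤ = ℕ.≤-trans (ℕ.≤-trans (ℕ.m≤m+n B C) (ℕ.m≤n+m (B ℕ.+ C) H)) (n≤2^n b)
          C≤ = ℕ.≤-trans (ℕ.≤-trans (ℕ.m≤n+m C B) (ℕ.m≤n+m (B ℕ.+ C) H)) (n≤2^n b)
          l≤x = ≤-trans {fromℚ (endpoint b 0)} { - fromℕ B} {x}
            (pointwise-≤ {fromℚ (endpoint b 0)} { - fromℕ B} λ _ → ≤-by (gap (ι-mono-≤ B≤)) (solve 3 (λ m c B → :- B := (con (ι 0) :* m :- c) :+ (c :- B)) refl (mesh b) (ι (2 ℕ.^ b)) (ι B)))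
            -B≤x
          x≤u = ≤-trans {x} {fromℕ C} {fromℚ (endpoint b (suc (top b)))} x≤C
            (pointwise-≤ {fromℕ C} {fromℚ (endpoint b (suc (top b)))} λ _ → ℚ.≤-trans (ι-mono-≤ C≤) (ℚ.≤-reflexive (sym (endpoint-top b))))
          k , k≤top , piece = locate b x (top b) l≤x x≤u
          i , eq = reach b k (ℕ.m≤m+n H (B ℕ.+ C)) k≤top
      in i , subst (λ s → Piece (proj₁ s) (proj₂ s) x) (sym eq) piece

    Pow≤price : ∀ s → 0ℝ < s → fromℕ (suc (suc E)) ≤ s * fromℕ E → ∀ b d → d ≤ fromℚ (mesh b) → Pow d s ≤ fromℚ (price b)
    Pow≤price s 0<s E+2≤sE b d d≤ = ≤-trans {Pow d s} {e (s * y)} {fromℚ (price b)}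
      (Pow≤e {d} {y} {s} 0<s (≤-trans {d} {fromℚ (mesh b)} {e y} d≤ (≈⇒≥ {e y} {fromℚ (mesh b)} (e-h (E ℕ.* b)))))
      (≤-trans {e (s * y)} {e (- (fromℕ (suc (suc E) ℕ.* b) * log2))} {fromℚ (price b)} (e-mono-≤ {s * y} { - (fromℕ (suc (suc E) ℕ.* b) * log2)} exponents)
        (≈⇒≤ {e (- (fromℕ (suc (suc E) ℕ.* b) * log2))} {fromℚ (price b)} (e-h (suc (suc E) ℕ.* b))))
      where
      y = - (fromℕ (E ℕ.* b) * log2)
      exponents : s * y ≤ - (fromℕ (suc (suc E) ℕ.* b) * log2)
      exponents = ≤-cert {s * y} { - (fromℕ (suc (suc E) ℕ.* b) * log2)} {(s * fromℕ E - fromℕ (suc (suc E))) * (fromℕ b * log2)}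
        (0≤-* {s * fromℕ E - fromℕ (suc (suc E))} {fromℕ b * log2} (0≤gap {fromℕ (suc (suc E))} {s * fromℕ E} E+2≤sE) (0≤-* {fromℕ b} {log2} (0≤fromℕ b) 0≤log2))
        λ n → trans (cong (λ z → ℚ.- (z ℚ.* seq log2 n)) (ι-* (suc (suc E)) b))
          (trans (solve 5 (λ s E F b l → :- (F :* b :* l) := s :* (:- (E :* b :* l)) :+ (s :* E :+ :- F) :* (b :* l)) refl (seq s n) (ι E) (ι (suc (suc E))) (ι b) (seq log2 n))
            (cong (λ z → seq s n ℚ.* (ℚ.- (z ℚ.* seq log2 n)) ℚ.+ (seq s n ℚ.* ι E ℚ.+ ℚ.- ι (suc (suc E))) ℚ.* (ι b ℚ.* seq log2 n)) (sym (ι-* E b))))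

  priced-cover : ∀ S s → 1ℝ < s → ∀ δ ε → 0ℝ < δ → 0ℚ ℚ.< ε → PricedCover s δ (0ℝ + fromℚ ε) S
  priced-cover S s 1<s δ ε 0<δ ε>0 = record
    { piece = λ i → Piece (block i) (position i)
    ; size = λ i → fromℚ (mesh (block i))
    ; price = λ i → fromℚ (price (block i))
    ; 0≤size = λ i → fromℚ-mono-≤ {0ℚ} {mesh (block i)} (0≤h (M ℕ.* block i))
    ; short = λ i → Piece-short (block i) (position i)
    ; size≤δ = λ i → ≤-trans {fromℚ (mesh (block i))} {fromℚ η} {δ} (fromℚ-mono-≤ {mesh (block i)} {η} (ℚ.≤-trans (h-mono (ℕ.≤-trans H₁≤H (ℕ.≤-trans (H≤block i) (ℕ.m≤n*m (block i) M)))) hH₁≤η))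
        (≤-trans {fromℚ η} {0ℝ + fromℚ η} {δ} (pointwise-≤ {fromℚ η} {0ℝ + fromℚ η} λ _ → ℚ.≤-reflexive (sym (ℚ.+-identityˡ η))) η≤δ)
    ; covers = λ x _ → covered x
    ; priced = λ i → Pow≤price s (<-≤-trans {0ℝ} {1ℝ} {s} 0<1ℝ (<⇒≤ {1ℝ} {s} 1<s)) E+2≤sE (block i)
    ; cost≤ = λ n → pointwise-≤ {∑< n (λ i → fromℚ (price (block i)))} {0ℝ + fromℚ ε} λ k →
        ℚ.≤-trans (ℚ.≤-reflexive (∑<-fromℚ n (λ i → price (block i)) k)) (ℚ.≤-trans (total-price n)
          (≤-by (gap 4hH≤ε) (solve 2 (λ h e → con 0ℚ :+ e := ((h :+ h) :+ (h :+ h)) :+ (e :- con (ι 4) :* h)) refl (h H) ε)))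
    }
    where
    gap₁ = <⇒+ε≤ {1ℝ} {s} 1<s
    ε₁ = proj₁ gap₁
    rec = reciprocal ε₁ (proj₁ (proj₂ gap₁))
    r = proj₁ rec
    arch = archimedean (r ℚ.+ r)
    -- M ≥ 2 / ε₁, where s ≥ 1 + ε₁, so that s M ≥ M + 2; the successor makes M positive, so that
    -- meshes shrink from block to block.
    M = suc (proj₁ arch)
    η = proj₁ (<⇒+ε≤ {0ℝ} {δ} 0<δ)
    η≤δ = proj₂ (proj₂ (<⇒+ε≤ {0ℝ} {δ} 0<δ))
    null₁ = h-null η (proj₁ (proj₂ (<⇒+ε≤ {0ℝ} {δ} 0<δ)))
    null₂ = h-null (h 2 ℚ.* ε) (0<* (0<h 2) ε>0)
    H₁ = proj₁ null₁
    hH₁≤η = proj₂ null₁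
    -- The first summand makes every mesh at most δ; the second makes the total price 4 · 2 ^ (- H)
    -- at most ε.
    H = H₁ ℕ.+ proj₁ null₂
    H₁≤H : H₁ ℕ.≤ H
    H₁≤H = ℕ.m≤m+n H₁ (proj₁ null₂)
    4hH≤ε : ι 4 ℚ.* h H ℚ.≤ ε
    4hH≤ε = ℚ.≤-trans (ℚ*-mono (ι 4) (0≤ι 4) (ℚ.≤-trans (h-mono (ℕ.m≤n+m (proj₁ null₂) H₁)) (proj₂ null₂)))
      (ℚ.≤-reflexive (solve 1 (λ e → con (ι 4) :* (con (h 2) :* e) := e) refl ε))
    open Blocks M H
    2≤εE : ι 2 ℚ.≤ ε₁ ℚ.* ι M
    2≤εE = ℚ.≤-trans (ℚ.≤-reflexive (sym (trans (ℚ.*-distribˡ-+ ε₁ r r) (cong (λ z → z ℚ.+ z) (proj₂ (proj₂ rec))))))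
      (ℚ*-mono ε₁ (ℚ.<⇒≤ (proj₁ (proj₂ gap₁))) (ℚ.≤-trans (proj₂ arch) (ι-mono-≤ (ℕ.n≤1+n (proj₁ arch)))))
    E+2≤sE : fromℕ (suc (suc M)) ≤ s * fromℕ M
    E+2≤sE = ≤-cert {fromℕ (suc (suc M))} {s * fromℕ M} {(s - (1ℝ + fromℚ ε₁)) * fromℕ M + fromℚ (ε₁ ℚ.* ι M ℚ.- ι 2)}
      (0≤-+ {(s - (1ℝ + fromℚ ε₁)) * fromℕ M} {fromℚ (ε₁ ℚ.* ι M ℚ.- ι 2)}
        (0≤-* {s - (1ℝ + fromℚ ε₁)} {fromℕ M} (0≤gap {1ℝ + fromℚ ε₁} {s} (proj₂ (proj₂ gap₁))) (0≤fromℕ M)) (fromℚ-mono-≤ {0ℚ} (gap 2≤εE)))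
      λ n → trans (solve 3 (λ s m e → s :* m := (con (ι 2) :+ m) :+ ((s :+ :- (con 1ℚ :+ e)) :* m :+ (e :* m :- con (ι 2)))) refl (seq s n) (ι M) ε₁)
        (cong (ℚ._+ ((seq s n ℚ.+ ℚ.- (1ℚ ℚ.+ ε₁)) ℚ.* ι M ℚ.+ (ε₁ ℚ.* ι M ℚ.- ι 2))) (sym (ι-+ 2 M)))

  -- No cover of small cost for s < 1

  window : ℕ → List ℕ
  window y = y ∷ 1 ℕ.+ y ∷ 2 ℕ.+ y ∷ 3 ℕ.+ y ∷ 4 ℕ.+ y ∷ []

  ∈-window : ∀ {y z} → y ℕ.≤ z → z ℕ.≤ 4 ℕ.+ y → z ∈ window y
  ∈-window {y} {z} y≤z z≤ = subst (_∈ window y) (ℕ.m∸n+n≡m y≤z)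
    (at (z ℕ.∸ y) (ℕ.+-cancelʳ-≤ y (z ℕ.∸ y) 4 (subst (ℕ._≤ 4 ℕ.+ y) (sym (ℕ.m∸n+n≡m y≤z)) z≤)))
    where
    at : ∀ d → d ℕ.≤ 4 → d ℕ.+ y ∈ window y
    at 0 _ = here refl
    at 1 _ = there (here refl)
    at 2 _ = there (there (here refl))
    at 3 _ = there (there (there (here refl)))
    at 4 _ = there (there (there (there (here refl))))
    at (suc (suc (suc (suc (suc d))))) (ℕ.s≤s (ℕ.s≤s (ℕ.s≤s (ℕ.s≤s ()))))

  ∑-h : ∀ m N → ∑ N (λ i → h (i ℕ.+ suc m)) ℚ.≤ h m
  ∑-h m N = ≤-by (0≤h (N ℕ.+ m)) (sym (go N))
    where
    go : ∀ N → ∑ N (λ i → h (i ℕ.+ suc m)) ℚ.+ h (N ℕ.+ m) ≡ h m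
    go zero    = ℚ.+-identityˡ (h m)
    go (suc N) = trans (cong (λ z → ∑ N (λ i → h (i ℕ.+ suc m)) ℚ.+ h z ℚ.+ ½ ℚ.* h (N ℕ.+ m)) (ℕ.+-suc N m))
      (trans (solve 2 (λ s a → s :+ con ½ :* a :+ con ½ :* a := s :+ a) refl (∑ N (λ i → h (i ℕ.+ suc m))) (h (N ℕ.+ m))) (go N))

  -- With A = 5 · 2 ^ u this is 2 ^ (- A) / 4, and A ≤ 2 ^ A bounds A times it by ¼. The extra terms
  -- 2 ^ (- i - 3) of all pieces add at most another ¼, so the forbidden weight of the cover stays
  -- below 1.
  threshold : ℕ → ℚ
  threshold u = h (5 ℕ.* 2 ℕ.^ u ℕ.+ 2)

  module Contradiction (u-1 p : ℕ) (pr : Prime p) (S : Pred ℝ 0ℓ) (s : ℝ) (0≤s : 0ℝ ≤ s)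
    (sv≤u : s * fromℕ (Construction.v u-1 p pr) ≤ fromℕ (Construction.u u-1 p pr))
    (points : ∀ J J₀ bounds avoid → S (α u-1 p pr J J₀ bounds avoid)) where

    open Construction u-1 p pr

    module _ (𝒰 : SmallCover s (fromℚ (threshold u)) S) where
      open SmallCover 𝒰

      A : ℕ
      A = 5 ℕ.* 2 ℕ.^ u

      charge : ℕ → ℝ
      charge i = Pow (size i) s

      -- Piece i is treated at a level j where it is no longer than a node. If it is also longer
      -- than R ^ (- j - 1), then s v ≤ u makes its charge at least 2 ^ (- u (j + 1)), and A times
      -- the charge pays for five nodes of weight 2 ^ (- u j). A piece too short for this, possibly
      -- of diameter 0, goes to level i + 6, where five nodes weigh at most 2 ^ (- i - 3) because 5
      -- ≤ 2 ^ 3.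
      Level : ℕ → ℕ → Set
      Level i j = size i ≤ fromℚ (h (v ℕ.* j)) × fromℚ (ι 5 ℚ.* h (u ℕ.* j)) ≤ fromℕ A * charge i + fromℚ (h (i ℕ.+ 3))

      deep : ∀ i → ι 5 ℚ.* h (u ℕ.* (i ℕ.+ 6)) ℚ.≤ h (i ℕ.+ 3)
      deep i = ℚ.≤-trans (ℚ*-mono (ι 5) (0≤ι 5) (h-mono (ℕ.m≤n*m (i ℕ.+ 6) u)))
        (≤-by (0≤h 3 ⊠ 0≤ι 3 ⊠ 0≤h (i ℕ.+ 3)) (trans (solve 1 (λ x → x := con (ι 5) :* (x :* con (h 3)) :+ con (h 3) :* con (ι 3) :* x) refl (h (i ℕ.+ 3)))
          (cong (λ z → ι 5 ℚ.* z ℚ.+ h 3 ℚ.* ι 3 ℚ.* h (i ℕ.+ 3)) (trans (sym (h-+ (i ℕ.+ 3) 3)) (cong h (ℕ.+-assoc i 3 3))))))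

      charge-lower : ∀ i m → fromℚ (h (v ℕ.* suc m)) < size i → fromℚ (h (u ℕ.* suc m)) ≤ charge i
      charge-lower i m lt = ≤-trans {fromℚ (h (u ℕ.* suc m))} {e (s * y)} {charge i}
        (≤-trans {fromℚ (h (u ℕ.* suc m))} {e w} {e (s * y)} (≈⇒≥ {e w} {fromℚ (h (u ℕ.* suc m))} (e-h (u ℕ.* suc m))) (e-mono-≤ {w} {s * y} exponents))
        (e≤Pow {size i} {y} {s} 0≤s (≤-trans {e y} {fromℚ (h (v ℕ.* suc m))} {size i} (≈⇒≤ {e y} {fromℚ (h (v ℕ.* suc m))} (e-h (v ℕ.* suc m))) (<⇒≤ {fromℚ (h (v ℕ.* suc m))} {size i} lt)))
        where
        y = - (fromℕ (v ℕ.* suc m) * log2)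
        w = - (fromℕ (u ℕ.* suc m) * log2)
        exponents : w ≤ s * y
        exponents = ≤-cert {w} {s * y} {(fromℕ u - s * fromℕ v) * (fromℕ (suc m) * log2)}
          (0≤-* {fromℕ u - s * fromℕ v} {fromℕ (suc m) * log2} (0≤gap {s * fromℕ v} {fromℕ u} sv≤u) (0≤-* {fromℕ (suc m)} {log2} (0≤fromℕ (suc m)) 0≤log2))
          λ n → trans (cong (λ z → seq s n ℚ.* ℚ.- (z ℚ.* seq log2 n)) (ι-* v (suc m)))
            (trans (solve 5 (λ s v m l u → s :* (:- (v :* m :* l)) := :- (u :* m :* l) :+ (u :+ :- (s :* v)) :* (m :* l)) refl (seq s n) (ι v) (ι (suc m)) (seq log2 n) (ι u))
              (cong (λ z → ℚ.- (z ℚ.* seq log2 n) ℚ.+ (ι u ℚ.+ ℚ.- (seq s n ℚ.* ι v)) ℚ.* (ι (suc m) ℚ.* seq log2 n)) (sym (ι-* u (suc m)))))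

      0≤A·charge : ∀ i → 0ℝ ≤ fromℕ A * charge i
      0≤A·charge i = 0≤-* {fromℕ A} {charge i} (0≤fromℕ A) (Pow-nonneg (size i) s)

      level-spec : ∀ i → ∃ (Level i)
      level-spec i = by-size (≤-or-> (size i) (fromℚ (h (v ℕ.* (i ℕ.+ 6)))))
        where
        Big : ℕ → Set
        Big j = fromℚ (h (v ℕ.* j)) < size i
        by-size : size i ≤ fromℚ (h (v ℕ.* (i ℕ.+ 6))) ⊎ Big (i ℕ.+ 6) → ∃ (Level i)
        by-size (inj₁ le) = i ℕ.+ 6 , le , ≤-trans {fromℚ (ι 5 ℚ.* h (u ℕ.* (i ℕ.+ 6)))} {fromℚ (h (i ℕ.+ 3))} {fromℕ A * charge i + fromℚ (h (i ℕ.+ 3))} (fromℚ-mono-≤ (deep i))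
          (≤-cert {fromℚ (h (i ℕ.+ 3))} {fromℕ A * charge i + fromℚ (h (i ℕ.+ 3))} {fromℕ A * charge i} (0≤A·charge i) λ n → ℚ.+-comm (ι A ℚ.* seq (charge i) n) (h (i ℕ.+ 3)))
        by-size (inj₂ big) = by-least (least-index {Big} (λ j → em) (i ℕ.+ 6) big)
          where
          by-least : (∃[ j ] Big j × (∀ m → j ≡ suc m → ¬ Big m)) → ∃ (Level i)
          -- At level 0 a node has length 1, and no piece is longer than that.
          by-least (zero , lt , _) = ⊥-elim (size≤1 i (subst (λ z → fromℚ (h z) < size i) (ℕ.*-zeroʳ v) lt))
          by-least (suc m , lt , ¬big) = m , ¬big m refl ,
            ≤-trans {fromℚ (ι 5 ℚ.* h (u ℕ.* m))} {fromℕ A * fromℚ (h (u ℕ.* suc m))} {fromℕ A * charge i + fromℚ (h (i ℕ.+ 3))}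
              (pointwise-≤ {fromℚ (ι 5 ℚ.* h (u ℕ.* m))} {fromℕ A * fromℚ (h (u ℕ.* suc m))} λ _ → ℚ.≤-reflexive (sym scale))
              (≤-trans {fromℕ A * fromℚ (h (u ℕ.* suc m))} {fromℕ A * charge i} {fromℕ A * charge i + fromℚ (h (i ℕ.+ 3))}
                (*-monoˡ-≤ {fromℕ A} {fromℚ (h (u ℕ.* suc m))} {charge i} (0≤fromℕ A) (charge-lower i m lt))
                (≤-cert {fromℕ A * charge i} {fromℕ A * charge i + fromℚ (h (i ℕ.+ 3))} {fromℚ (h (i ℕ.+ 3))} (fromℚ-mono-≤ {0ℚ} (0≤h (i ℕ.+ 3))) λ n → refl))
            where
            scale : ι A ℚ.* h (u ℕ.* suc m) ≡ ι 5 ℚ.* h (u ℕ.* m)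
            scale = trans (cong₂ ℚ._*_ (ι-* 5 (2 ℕ.^ u)) (trans (cong h (ℕ.*-suc u m)) (h-+ u (u ℕ.* m))))
              (trans (solve 3 (λ a b c → con (ι 5) :* a :* (b :* c) := con (ι 5) :* (a :* b) :* c) refl (ι (2 ℕ.^ u)) (h u) (h (u ℕ.* m)))
                (cong (ℚ._* h (u ℕ.* m)) (trans (cong (ι 5 ℚ.*_) (2^*h u)) (ℚ.*-identityʳ (ι 5)))))

      level : ℕ → ℕ
      level i = proj₁ (level-spec i)

      mesh : ℕ → ℚ
      mesh i = h (v ℕ.* level i)

      Reaches : ℕ → ℚ → ℕ → Set
      Reaches i ξ y = ξ ℚ.≤ (ι y ℚ.+ ι 3) ℚ.* mesh i

      first : ∀ i ξ → ∃[ y ] Reaches i ξ y × (∀ m → y ≡ suc m → ¬ Reaches i ξ m)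
      first i ξ = least-index (λ y → ξ ℚ.≤? (ι y ℚ.+ ι 3) ℚ.* mesh i) n
        (≤-by (gap le ⊠ 0≤h (v ℕ.* level i) ⊞ 0≤ι 3 ⊠ 0≤h (v ℕ.* level i))
          (trans (solve 4 (λ n r x s → (n :+ con (ι 3)) :* r := x :* (s :* r) :+ ((n :- x :* s) :* r :+ con (ι 3) :* r)) refl (ι n) (mesh i) ξ (ι (R ℕ.^ level i)))
            (cong (ℚ._+ ((ι n ℚ.- ξ ℚ.* ι (R ℕ.^ level i)) ℚ.* mesh i ℚ.+ ι 3 ℚ.* mesh i)) (trans (cong (ξ ℚ.*_) (R^*h (level i))) (ℚ.*-identityʳ ξ)))))
        where
        n = proj₁ (archimedean (ξ ℚ.* ι (R ℕ.^ level i)))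
        le = proj₂ (archimedean (ξ ℚ.* ι (R ℕ.^ level i)))

      approximation : ∀ i x → ∃[ ξ ] x ≤ fromℚ ξ × fromℚ ξ ≤ x + fromℚ (mesh i)
      approximation i x = approx x (mesh i) (0<h (v ℕ.* level i))

      cover-at : ∀ i → Dec (∃ (piece i)) → List ℕ
      cover-at i (no _)        = []
      cover-at i (yes (x , _)) = window (proj₁ (first i (proj₁ (approximation i x))))

      cover : ℕ → List ℕ
      cover i = cover-at i em

      length-cover : ∀ i → length (cover i) ℕ.≤ 5
      length-cover i = at em
        where
        at : ∀ d → length (cover-at i d) ℕ.≤ 5
        at (no _)  = ℕ.z≤n
        at (yes _) = ℕ.≤-refl

      -- Let r be the mesh. The piece lies within r of its sample point x, and x ≤ ξ ≤ x + r, so β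
      -- lies between ξ - 2 r and ξ + r. As y r ≤ β ≤ (y + 1) r, the index y lies between ξ / r - 3
      -- and ξ / r + 1. The search for ξ ≤ (y₀ + 3) r finds the first of these at most five
      -- integers.
      covered : ∀ i y β → piece i β → fromℚ (ι y ℚ.* mesh i) ≤ β → β ≤ fromℚ (ι y ℚ.* mesh i ℚ.+ mesh i) → y ∈ cover i
      covered i y β β∈ l≤β β≤u = at em
        where
        r = mesh i
        ρ = fromℚ r
        at : ∀ d → y ∈ cover-at i d
        at (no none)       = ⊥-elim (none (β , β∈))
        at (yes (x , x∈)) = ∈-window lower upper
          where
          ξ = proj₁ (approximation i x)
          x≤ξ = proj₁ (proj₂ (approximation i x))
          ξ≤ = proj₂ (proj₂ (approximation i x))
          y₀ = proj₁ (first i ξ)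
          near : ∣ β - x ∣ ≤ ρ
          near = ≤-trans {∣ β - x ∣} {size i} {ρ} (proj₂ (measure i) β x β∈ x∈) (proj₁ (proj₂ (level-spec i)))
          reaches : Reaches i ξ y
          reaches = ℚ.≮⇒≥ λ lt → ≤-cert {fromℚ ξ} {fromℚ ((ι y ℚ.+ ι 3) ℚ.* r)}
            {(x + ρ - fromℚ ξ) + ((ρ - (- (β - x))) + (fromℚ (ι y ℚ.* r ℚ.+ r) - β))}
            (0≤-+ {x + ρ - fromℚ ξ} {(ρ - (- (β - x))) + (fromℚ (ι y ℚ.* r ℚ.+ r) - β)} (0≤gap {fromℚ ξ} {x + ρ} ξ≤)
              (0≤-+ {ρ - (- (β - x))} {fromℚ (ι y ℚ.* r ℚ.+ r) - β} (0≤gap { - (β - x)} {ρ} (≤-trans { - (β - x)} {∣ β - x ∣} {ρ} (-x≤∣x∣ (β - x)) near)) (0≤gap {β} {fromℚ (ι y ℚ.* r ℚ.+ r)} β≤u)))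
            (λ n → solve 5 (λ y r x b ξ → (y :+ con (ι 3)) :* r := ξ :+ ((x :+ r :+ :- ξ) :+ ((r :+ :- (:- (b :+ :- x))) :+ ((y :* r :+ r) :+ :- b)))) refl (ι y) r (seq x n) (seq β n) ξ)
            (fromℚ-mono-< lt)
          lower : y₀ ℕ.≤ y
          lower = ℕ.≮⇒≥ λ y<y₀ → before y₀ y<y₀ (proj₂ (proj₂ (first i ξ)))
            where
            before : ∀ y₀ → y ℕ.< y₀ → (∀ m → y₀ ≡ suc m → ¬ Reaches i ξ m) → ⊥
            before (suc m) y<1+m ¬reaches = ¬reaches m refl (ℚ.≤-trans reaches
              (ℚ.*-monoʳ-≤-nonNeg r {{ℚ.nonNegative (0≤h (v ℕ.* level i))}} (ℚ.+-monoˡ-≤ (ι 3) (ι-mono-≤ (ℕ.≤-pred y<1+m)))))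
          upper₀ : ι y ℚ.* r ℚ.≤ ξ ℚ.+ r
          upper₀ = ℚ.≮⇒≥ λ lt → ≤-cert {fromℚ (ι y ℚ.* r)} {fromℚ (ξ ℚ.+ r)} {(β - fromℚ (ι y ℚ.* r)) + ((ρ - (β - x)) + (fromℚ ξ - x))}
            (0≤-+ {β - fromℚ (ι y ℚ.* r)} {(ρ - (β - x)) + (fromℚ ξ - x)} (0≤gap {fromℚ (ι y ℚ.* r)} {β} l≤β)
              (0≤-+ {ρ - (β - x)} {fromℚ ξ - x} (0≤gap {β - x} {ρ} (≤-trans {β - x} {∣ β - x ∣} {ρ} (x≤∣x∣ (β - x)) near)) (0≤gap {x} {fromℚ ξ} x≤ξ)))
            (λ n → solve 5 (λ l r x b ξ → ξ :+ r := l :+ ((b :+ :- l) :+ ((r :+ :- (b :+ :- x)) :+ (ξ :+ :- x)))) refl (ι y ℚ.* r) r (seq x n) (seq β n) ξ)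
            (fromℚ-mono-< lt)
          upper : y ℕ.≤ 4 ℕ.+ y₀
          upper = ℕ.≮⇒≥ λ lt → ℚ.<-irrefl refl (ℚ.<-≤-trans (ℚ*-mono-< r (0<h (v ℕ.* level i)) (ι-mono-< lt))
            (ℚ.≤-trans (ℚ.≤-reflexive (ℚ.*-comm r (ι y))) (ℚ.≤-trans upper₀ (≤-by (gap (proj₁ (proj₂ (first i ξ))))
              (trans (cong (r ℚ.*_) (ι-+ 4 y₀)) (solve 3 (λ r y ξ → r :* (con (ι 4) :+ y) := ξ :+ r :+ ((y :+ con (ι 3)) :* r :- ξ)) refl r (ι y₀) ξ))))))

      weight-at : ℕ → ℚ
      weight-at i = ι (length (cover i)) ℚ.* qpow (h u) (level i)

      weight-at≤ : ∀ i → weight-at i ℚ.≤ ι 5 ℚ.* h (u ℕ.* level i)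
      weight-at≤ i = ℚ.≤-trans (ℚ.≤-reflexive (cong (ι (length (cover i)) ℚ.*_) (qpow-h u (level i))))
        (ℚ.*-monoʳ-≤-nonNeg (h (u ℕ.* level i)) {{ℚ.nonNegative (0≤h (u ℕ.* level i))}} (ι-mono-≤ (length-cover i)))

      partial : ∀ N → fromℚ (∑ N weight-at) ≤ fromℕ A * ∑< N charge + fromℚ (∑ N (λ i → h (i ℕ.+ 3)))
      partial zero    = pointwise-≤ {fromℚ 0ℚ} {fromℕ A * 0ℝ + fromℚ 0ℚ} λ _ → ℚ.≤-reflexive (solve 1 (λ a → con 0ℚ := a :* con 0ℚ :+ con 0ℚ) refl (ι A))
      partial (suc N) = ≤-trans {fromℚ (∑ (suc N) weight-at)} {X + Y} {fromℕ A * ∑< (suc N) charge + fromℚ (∑ (suc N) (λ i → h (i ℕ.+ 3)))}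
        (+-mono-≤ {fromℚ (∑ N weight-at)} {X} {fromℚ (weight-at N)} {Y} (partial N)
          (≤-trans {fromℚ (weight-at N)} {fromℚ (ι 5 ℚ.* h (u ℕ.* level N))} {Y} (fromℚ-mono-≤ (weight-at≤ N)) (proj₂ (proj₂ (level-spec N)))))
        (pointwise-≤ {X + Y} {fromℕ A * ∑< (suc N) charge + fromℚ (∑ (suc N) (λ i → h (i ℕ.+ 3)))} λ n → ℚ.≤-reflexive
          (solve 5 (λ a s c g k → (a :* s :+ g) :+ (a :* c :+ k) := a :* (s :+ c) :+ (g :+ k)) refl (ι A) (seq (∑< N charge) n) (seq (charge N) n) (∑ N (λ i → h (i ℕ.+ 3))) (h (N ℕ.+ 3))))
        where
        X = fromℕ A * ∑< N charge + fromℚ (∑ N (λ i → h (i ℕ.+ 3)))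
        Y = fromℕ A * charge N + fromℚ (h (N ℕ.+ 3))

      thin : ∀ N → ∑ N weight-at ℚ.< 1ℚ
      thin N = fromℚ-cancel-< (≤-<-trans {fromℚ (∑ N weight-at)} {fromℕ A * fromℚ (threshold u) + fromℚ (h 2)} {1ℝ}
        (≤-trans {fromℚ (∑ N weight-at)} {fromℕ A * ∑< N charge + fromℚ (∑ N (λ i → h (i ℕ.+ 3)))} {fromℕ A * fromℚ (threshold u) + fromℚ (h 2)} (partial N)
          (+-mono-≤ {fromℕ A * ∑< N charge} {fromℕ A * fromℚ (threshold u)} {fromℚ (∑ N (λ i → h (i ℕ.+ 3)))} {fromℚ (h 2)}
            (*-monoˡ-≤ {fromℕ A} {∑< N charge} {fromℚ (threshold u)} (0≤fromℕ A) (cost≤ N)) (fromℚ-mono-≤ (∑-h 2 N))))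
        (fromℚ-mono-< {ι A ℚ.* threshold u ℚ.+ h 2} {1ℚ} (<-by (0<+ 0<½ (0≤h 2 ⊠ gap Ah≤1))
          (trans (solve 2 (λ a h′ → con 1ℚ := a :* (h′ :* con (h 2)) :+ con (h 2) :+ (con ½ :+ con (h 2) :* (con 1ℚ :- a :* h′))) refl (ι A) (h A))
            (cong (λ z → ι A ℚ.* z ℚ.+ h 2 ℚ.+ (½ ℚ.+ h 2 ℚ.* (1ℚ ℚ.- ι A ℚ.* h A))) (sym (h-+ A 2)))))))
        where
        Ah≤1 : ι A ℚ.* h A ℚ.≤ 1ℚ
        Ah≤1 = ℚ.≤-trans (ℚ.*-monoʳ-≤-nonNeg (h A) {{ℚ.nonNegative (0≤h A)}} (ι-mono-≤ (n≤2^n A))) (ℚ.≤-reflexive (2^*h A))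

      escape : ∀ J J₀ bounds avoid → (∀ i → J (level i) ∉ cover i) → ⊥
      escape J J₀ bounds avoid avoid-cover = from (covers x (points J J₀ bounds avoid))
        where
        x = α u-1 p pr J J₀ bounds avoid
        from : ∃[ i ] piece i x → ⊥
        from (i , x∈) = avoid-cover i (covered i (J (level i)) x x∈
          (approximant≤α u-1 p pr J J₀ bounds avoid (level i)) (α≤approximant u-1 p pr J J₀ bounds avoid (level i)))

      -- The given cover supplies the initial family of the path, so the point depends on it.
      -- Nevertheless the point lies in S, by `points`, which speaks of every path that avoids the
      -- nodes forbidden around fractions.
      no-small-cover : ⊥
      no-small-cover = escape P.J refl P.J-bounds P.avoids-forbidden P.avoids-cover
        where module P = Path depth forbid few level cover thin

  multiple≥1 : ∀ x → 0ℝ < x → ∃[ n ] 1ℝ ≤ fromℕ n * x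
  multiple≥1 x 0<x =
    let ε , ε>0 , ε≤x = <⇒+ε≤ {0ℝ} {x} 0<x
        r , _ , εr≡1 = reciprocal ε ε>0
        n , r≤n = archimedean r
        1≤nε : 1ℚ ℚ.≤ ι n ℚ.* ε
        1≤nε = ℚ.≤-trans (ℚ.≤-reflexive (sym εr≡1)) (ℚ.≤-trans (ℚ*-mono ε (ℚ.<⇒≤ ε>0) r≤n) (ℚ.≤-reflexive (ℚ.*-comm ε (ι n))))
    in n , ≤-trans {1ℝ} {fromℕ n * (0ℝ + fromℚ ε)} {fromℕ n * x}
      (pointwise-≤ {1ℝ} {fromℕ n * (0ℝ + fromℚ ε)} λ _ → ℚ.≤-trans 1≤nε (ℚ.≤-reflexive (cong (ι n ℚ.*_) (sym (ℚ.+-identityˡ ε)))))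
      (*-monoˡ-≤ {fromℕ n} {0ℝ + fromℚ ε} {x} (0≤fromℕ n) ε≤x)

  -- Taking u above both M and N gives u (1 - a) ≥ 1, which is v ≤ (2 - a) u, and u (1 - s) ≥ 1,
  -- which with s ≤ 1 gives s v ≤ u. The cost κ that no cover can undercut depends on a and s
  -- through u.
  Exceptional-positive : ∀ a → 0ℝ ≤ a → a < 1ℝ → ∀ p pr s → 0ℝ ≤ s → s < 1ℝ → ∃[ κ ] 0ℝ < κ × ¬ SmallCover s κ (Exceptional a p pr)
  Exceptional-positive a 0≤a a<1 p pr s 0≤s s<1 = from (multiple≥1 (1ℝ - a) (0<gap {a} {1ℝ} a<1)) (multiple≥1 (1ℝ - s) (0<gap {s} {1ℝ} s<1))
    where
    from : (∃[ n ] 1ℝ ≤ fromℕ n * (1ℝ - a)) → (∃[ n ] 1ℝ ≤ fromℕ n * (1ℝ - s)) → ∃[ κ ] 0ℝ < κ × ¬ SmallCover s κ (Exceptional a p pr)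
    from (M , 1≤Ma) (N , 1≤Ns) = fromℚ (threshold u) , fromℚ-mono-< {0ℚ} {threshold u} (0<h (5 ℕ.* 2 ℕ.^ u ℕ.+ 2)) ,
      Contradiction.no-small-cover u-1 p pr (Exceptional a p pr) s 0≤s sv≤u
        λ J J₀ bounds avoid → LowerBound.point∈Exceptional u-1 p pr J J₀ bounds avoid a 0≤a a<1 v≤[2-a]u
      where
      u-1 u v : ℕ
      u-1 = M ℕ.+ N
      u = suc u-1
      v = suc u
      grow : ∀ n m x → n ℕ.≤ m → 0ℝ ≤ x → 1ℝ ≤ fromℕ n * x → 1ℝ ≤ fromℕ m * x
      grow n m x n≤m 0≤x le = ≤-trans {1ℝ} {fromℕ n * x} {fromℕ m * x} le (*-monoʳ-≤ {x} {fromℕ n} {fromℕ m} 0≤x (fromℚ-mono-≤ (ι-mono-≤ n≤m)))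
      1≤ua : 1ℝ ≤ fromℕ u * (1ℝ - a)
      1≤ua = grow M u (1ℝ - a) (ℕ.m≤n⇒m≤1+n (ℕ.m≤m+n M N)) (0≤gap {a} {1ℝ} (<⇒≤ {a} {1ℝ} a<1)) 1≤Ma
      1≤us : 1ℝ ≤ fromℕ u * (1ℝ - s)
      1≤us = grow N u (1ℝ - s) (ℕ.m≤n⇒m≤1+n (ℕ.m≤n+m N M)) (0≤gap {s} {1ℝ} (<⇒≤ {s} {1ℝ} s<1)) 1≤Ns
      v≤[2-a]u : fromℕ v ≤ (fromℕ 2 - a) * fromℕ u
      v≤[2-a]u = ≤-cert {fromℕ v} {(fromℕ 2 - a) * fromℕ u} {fromℕ u * (1ℝ - a) - 1ℝ} (0≤gap {1ℝ} {fromℕ u * (1ℝ - a)} 1≤ua)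
        λ n → trans (solve 2 (λ u a → (con (ι 2) :+ :- a) :* u := (con 1ℚ :+ u) :+ (u :* (con 1ℚ :+ :- a) :+ :- con 1ℚ)) refl (ι u) (seq a n))
          (cong (λ z → z ℚ.+ (ι u ℚ.* (1ℚ ℚ.+ ℚ.- seq a n) ℚ.+ ℚ.- 1ℚ)) (sym (ι-suc u)))
      sv≤u : s * fromℕ v ≤ fromℕ u
      sv≤u = ≤-cert {s * fromℕ v} {fromℕ u} {(fromℕ u * (1ℝ - s) - 1ℝ) + (1ℝ - s)}
        (0≤-+ {fromℕ u * (1ℝ - s) - 1ℝ} {1ℝ - s} (0≤gap {1ℝ} {fromℕ u * (1ℝ - s)} 1≤us) (0≤gap {s} {1ℝ} (<⇒≤ {s} {1ℝ} s<1)))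
        λ n → trans (solve 2 (λ u s → u := s :* (con 1ℚ :+ u) :+ ((u :* (con 1ℚ :+ :- s) :+ :- con 1ℚ) :+ (con 1ℚ :+ :- s))) refl (ι u) (seq s n))
          (cong (λ z → seq s n ℚ.* z ℚ.+ ((ι u ℚ.* (1ℚ ℚ.+ ℚ.- seq s n) ℚ.+ ℚ.- 1ℚ) ℚ.+ (1ℚ ℚ.+ ℚ.- seq s n))) (sym (ι-suc u)))

  dimension : ∀ (a : ℝ) → 0ℝ ≤ a → a < 1ℝ → ∀ (p : ℕ) (pr : Prime p) →
    Classical.dimH em (λ α → fin 0ℝ <∞ Classical.liminf em (λ n → Classical.littlewoodProduct em a p pr α (suc n))) ≈∞ fin 1ℝ
  dimension a 0≤a a<1 p pr = dimH-Exceptional a p pr (λ s 1<s → priced-cover (Exceptional a p pr) s 1<s) (Exceptional-positive a 0≤a a<1 p pr)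

theorem5 : (em : ∀ {ℓ} → ExcludedMiddle ℓ) → let open Classical em in
    ∀ (a : ℝ) → 0ℝ ≤ a → a < 1ℝ → ∀ (p : ℕ) (pr : Prime p) →
    dimH (λ α → fin 0ℝ <∞ liminf (λ n → littlewoodProduct a p pr α (suc n))) ≈∞ fin 1ℝ
theorem5 = dimension
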